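{- There is no algorithm that, given a finite set $\mathcal{F}$ of finite graphs, decides whether the class of finite graphs containing no induced subgraph isomorphic to a member of $\mathcal{F}$ has the joint homomorphism property.
   Context: Graphs are simple and undirected. A homomorphism of graphs $A\to C$ is a map on vertices sending edges to edges (not necessarily injective). A class $\mathcal{C}$ of finite graphs has the joint homomorphism property if for any $A,B\in\mathcal{C}$ there is $C\in\mathcal{C}$ admitting homomorphisms from both $A$ and $B$. -}

module Defs where

open import Data.Nat using (ℕ; zero; suc; _+_; _*_; _<_)
open import Data.Nat.Properties using ()
open import Data.Fin using (Fin)
open import Data.Vec using (Vec; []; _∷_; lookup)
open import Data.List using (List; []; _∷_; map; allFin; concatMap)
open import Data.List.Membership.Propositional using (_∈_)
open import Data.Bool using (Bool; true; false)
open import Data.Product using (Σ; _×_; _,_)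
open import Relation.Binary.PropositionalEquality using (_≡_)
open import Relation.Nullary using (¬_)
open import Function.Definitions using (Injective)

record Graph : Set where
  field
    size   : ℕ
    adj    : Fin size → Fin size → Bool
    symm   : ∀ i j → adj i j ≡ adj j i
    irrefl : ∀ i → adj i i ≡ false
open Graph public

Hom : Graph → Graph → Set
Hom A C = Σ (Fin (size A) → Fin (size C)) λ f →
  ∀ i j → adj A i j ≡ true → adj C (f i) (f j) ≡ true

InducedSub : Graph → Graph → Set
InducedSub H G = Σ (Fin (size H) → Fin (size G)) λ f →
  Injective _≡_ _≡_ f × (∀ i j → adj G (f i) (f j) ≡ adj H i j)

Forb : List Graph → Graph → Set
Forb F G = ∀ H → H ∈ F → ¬ InducedSub H G

JHP : (Graph → Set) → Set
JHP C = ∀ A B → C A → C B → Σ Graph λ D → C D × Hom A D × Hom B D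

data PR : ℕ → Set where
  Z    : ∀ {n} → PR n
  S    : PR 1
  P    : ∀ {n} → Fin n → PR n
  Comp : ∀ {m n} → PR m → Vec (PR n) m → PR n
  Rec  : ∀ {n} → PR n → PR (suc (suc n)) → PR (suc n)
  Mu   : ∀ {n} → PR (suc n) → PR n

data Eval : ∀ {n} → PR n → Vec ℕ n → ℕ → Set
data EvalAll : ∀ {m n} → Vec (PR n) m → Vec ℕ n → Vec ℕ m → Set

data Eval where
  evZ    : ∀ {n} {xs : Vec ℕ n} → Eval Z xs 0
  evS    : ∀ {x} → Eval S (x ∷ []) (suc x)
  evP    : ∀ {n} {i : Fin n} {xs} → Eval (P i) xs (lookup xs i)
  evComp : ∀ {m n} {f : PR m} {gs : Vec (PR n) m} {xs ys z} →
           EvalAll gs xs ys → Eval f ys z → Eval (Comp f gs) xs z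
  evRec0 : ∀ {n} {f : PR n} {g xs z} →
           Eval f xs z → Eval (Rec f g) (0 ∷ xs) z
  evRecS : ∀ {n} {f : PR n} {g xs k r z} →
           Eval (Rec f g) (k ∷ xs) r → Eval g (k ∷ r ∷ xs) z →
           Eval (Rec f g) (suc k ∷ xs) z
  evMu   : ∀ {n} {f : PR (suc n)} {xs k} →
           Eval f (k ∷ xs) 0 →
           (∀ j → j < k → Σ ℕ λ v → Eval f (j ∷ xs) (suc v)) →
           Eval (Mu f) xs k

data EvalAll where
  []  : ∀ {n} {xs : Vec ℕ n} → EvalAll [] xs []
  _∷_ : ∀ {m n} {g : PR n} {gs : Vec (PR n) m} {xs y ys} →
        Eval g xs y → EvalAll gs xs ys → EvalAll (g ∷ gs) xs (y ∷ ys)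

-- Cantor pairing
tri : ℕ → ℕ
tri zero    = zero
tri (suc k) = suc k + tri k

pair : ℕ → ℕ → ℕ
pair a b = tri (a + b) + b

codeList : List ℕ → ℕ
codeList []       = 0
codeList (x ∷ xs) = suc (pair x (codeList xs))

bit : Bool → ℕ
bit true  = 1
bit false = 0

codeGraph : Graph → ℕ
codeGraph G = pair (size G)
  (codeList (concatMap (λ i → map (λ j → bit (adj G i j)) (allFin (size G)))
                       (allFin (size G))))

-- a finite set of graphs is given as a list of graphs
codeGraphs : List Graph → ℕ
codeGraphs F = codeList (map codeGraph F)

Decides : PR 1 → (List Graph → Set) → Set
Decides e Q = ∀ F → (Q F → Eval e (codeGraphs F ∷ []) 1)
                  × (¬ Q F → Eval e (codeGraphs F ∷ []) 0)

-- A point of a graph is a homomorphic image of a rigid ten-vertex gadget; five variants of the gadget, told apart by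
-- one extra chord, serve as cells of time lines, cells of space lines and digits hanging off the cells of space lines.
-- Finitely many forbidden graphs make distinct points disjoint, allow between them only successor links and label
-- edges from time cells to digits, and make the labels on every window of two consecutive times and two consecutive
-- space cells obey the local rules of a counter machine.  Since points and links survive homomorphisms, a graph of the
-- class that receives both a long time line and a long space line must label their product with the run of the
-- machine, which is impossible if the machine halts.  If it never halts, the disjoint union of any two graphs of the
-- class can be completed by the label edges that the positions on the lines dictate.  One more forbidden graph, whose
-- code is computable from n, fixes the input n by forcing the label that marks cell n of the initial row.
--
-- Given a decider e, let the machine read x as the code of a list F, query e on F extended by the graph for input x,
-- and halt exactly on the answer yes.  Its own list F exists at least up to double negation, and running the machine
-- on the code of F refutes e.

module Submission where

open import Defs
open import Data.Bool using (Bool; true; false; _∧_; _∨_; not; if_then_else_; T)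
open import Data.Bool.Properties using (∧-comm; ∨-comm; ∨-identityʳ) renaming (_≟_ to _≟ᵇ_)
open import Data.Empty using (⊥; ⊥-elim)
open import Data.Fin using (Fin; zero; suc; toℕ; #_; _≟_; inject₁; fromℕ; fromℕ<; combine; remQuot; splitAt; join; _↑ˡ_; _↑ʳ_)
open import Data.Fin.Induction using (<-weakInduction)
open import Data.Fin.Properties using (all?; any?; toℕ-injective; toℕ-inject₁; toℕ-fromℕ; toℕ-fromℕ<; toℕ<n; toℕ-combine; combine-remQuot; remQuot-combine; splitAt-↑ˡ; splitAt-↑ʳ; splitAt-join; join-splitAt; injective⇒≤) renaming (suc-injective to sucᶠ-injective)
open import Data.List using (List; []; _∷_; _++_; map; foldr; allFin; concatMap; cartesianProductWith) renaming (tabulate to tabulateˡ)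
open import Data.List.Membership.Propositional using (_∈_)
open import Data.List.Membership.Propositional.Properties using (∈-allFin; ∈-map⁺; ∈-++⁺ˡ; ∈-++⁺ʳ; ∈-cartesianProductWith⁺)
open import Data.List.Relation.Unary.All using (All; []; _∷_)
open import Data.List.Relation.Unary.Any using (here; there)
open import Data.Maybe using (Maybe; just; nothing)
open import Data.Nat using (ℕ; zero; suc; pred; _+_; _*_; _∸_; _⊔_; _≤_; _<_; z≤n; s≤s; s≤s⁻¹; _≡ᵇ_; _<ᵇ_)
open import Data.Nat.Properties using (≤-refl; ≤-reflexive; ≤-trans; <⇒≤; <⇒≢; <-irrefl; n≤1+n; m≤m+n; m≤n+m; m≤m⊔n; m≤n⊔m; m≤n⇒m≤1+n; m≤n⇒m<n∨m≡n; ≡ᵇ⇒≡; suc-injective; +-comm; +-suc; +-identityʳ; *-comm; m+n∸n≡m) renaming (_≟_ to _≟ⁿ_)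
open import Data.Product using (Σ; ∃; _×_; _,_; proj₁; proj₂; uncurry)
open import Data.Sum using (_⊎_; inj₁; inj₂; map₁; [_,_]′)
open import Data.Sum.Properties using (inj₁-injective; inj₂-injective)
open import Data.Unit using (⊤; tt)
open import Data.Vec using (Vec; []; _∷_; lookup; tabulate)
open import Data.Vec.Properties using (lookup∘tabulate; tabulate-cong)
open import Function using (_∘_; id)
open import Function.Definitions using (Injective)
open import Relation.Binary.PropositionalEquality using (_≡_; _≢_; refl; sym; trans; cong; cong₂; subst; subst₂; _≗_; ≢-sym)
open import Relation.Nullary using (¬_; Dec; yes; no; does)
open import Relation.Nullary.Decidable using (from-yes; map′; dec-true; _→-dec_; _×-dec_)

-- A rigid gadget

-- Homomorphisms carry edges but not non-edges into a common target, so the conditions of the class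
-- speak of homomorphic images of gadgets instead of induced copies. Both values of a label bit,
-- edge and non-edge, are read off in the target, where the windows and the forbidden input graph
-- control them.
--
-- A line in a graph of the class need not start at a root: successors may branch, and predecessors,
-- though unique, may run round a cycle. The completion of a disjoint union therefore places a point
-- only by tracing its predecessors back to a root, and it adds no label at points without a
-- position. The local rules have to tolerate such blank windows, yet the two long lines must not
-- escape through a blank labelling. This is why blankness is excluded exactly at the corner where
-- both lines start, and why definedness spreads from there.
--
-- A fixed finite list sees only windows of bounded size, so an unbounded input cannot enter through
-- it; hence the additional graph, whose size grows with n.

Role : Set
Role = Fin 10

data Ty : Set where
  τ₀ τ₊ ι₀ ι₊ δ : Ty

sourceRole targetRole labelRole : Role
sourceRole = # 0
targetRole = # 4
labelRole  = # 8

joins : ℕ → ℕ → ℕ → ℕ → Bool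
joins p q r s = ((r ≡ᵇ p) ∧ (s ≡ᵇ q)) ∨ ((r ≡ᵇ q) ∧ (s ≡ᵇ p))

-- Found by computer search: even with all five chords added to the target, the identity is the only homomorphism.
coreEdges : List (ℕ × ℕ)
coreEdges =
  (0 , 1) ∷ (0 , 2) ∷ (0 , 3) ∷ (0 , 6) ∷ (1 , 2) ∷ (1 , 3) ∷ (1 , 4) ∷ (1 , 5) ∷ (1 , 6) ∷ (1 , 9) ∷
  (2 , 3) ∷ (2 , 4) ∷ (2 , 5) ∷ (2 , 9) ∷ (3 , 4) ∷ (3 , 7) ∷ (3 , 8) ∷ (4 , 5) ∷ (4 , 7) ∷ (5 , 6) ∷
  (5 , 9) ∷ (6 , 7) ∷ (6 , 8) ∷ (7 , 8) ∷ (8 , 9) ∷ []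

joinsAny : List (ℕ × ℕ) → ℕ → ℕ → Bool
joinsAny []             r s = false
joinsAny ((p , q) ∷ es) r s = joins p q r s ∨ joinsAny es r s

opaque
  core : Role → Role → Bool
  core i j = joinsAny coreEdges (toℕ i) (toℕ j)

  chord : Ty → Role × Role
  chord τ₀ = # 0 , # 8
  chord τ₊ = # 7 , # 9
  chord ι₀ = # 5 , # 7
  chord ι₊ = # 6 , # 9
  chord δ  = # 0 , # 7

  isChord : Ty → Role → Role → Bool
  isChord τ i j = let (p , q) = chord τ in joins (toℕ p) (toℕ q) (toℕ i) (toℕ j)

  -- The vertices of a gadget are its roles; the type of the gadget is recorded by one extra chord.
  gadget : Ty → Role → Role → Bool
  gadget τ i j = core i j ∨ isChord τ i j

  anyChord : Role → Role → Bool
  anyChord i j = isChord τ₀ i j ∨ isChord τ₊ i j ∨ isChord ι₀ i j ∨ isChord ι₊ i j ∨ isChord δ i j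

  allChords : Role → Role → Bool
  allChords i j = core i j ∨ anyChord i j

  every : ∀ {A : Set} → (A → Bool) → List A → Bool
  every p []       = true
  every p (x ∷ xs) = p x ∧ every p xs

  every-∈ : ∀ {A : Set} {p : A → Bool} {xs x} → every p xs ≡ true → x ∈ xs → p x ≡ true
  every-∈ {p = p} {y ∷ _} eq (here refl) with p y
  ... | true = refl
  every-∈ {p = p} {y ∷ _} eq (there m) with p y
  ... | true = every-∈ eq m

  extends : List (Role × Role) → Role → Role → Bool
  extends as i v = every (λ (j , w) → not (core i j) ∨ allChords v w) as

  -- Backtracking over all maps of roles. A branch is cut as soon as a core edge towards an already
  -- assigned role is not sent to an edge of `allChords`; a branch that survives to the end must be
  -- the identity.
  search : List Role → List (Role × Role) → Bool
  search []       as = every (λ (i , v) → does (i ≟ v)) as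
  search (i ∷ is) as = every (λ v → not (extends as i v) ∨ search is ((i , v) ∷ as)) (allFin 10)

  ≟-sound : ∀ {i j : Role} → does (i ≟ j) ≡ true → i ≡ j
  ≟-sound {i} {j} eq with i ≟ j
  ... | yes p = p

  Folding : (Role → Role) → Set
  Folding c = ∀ i j → core i j ≡ true → allChords (c i) (c j) ≡ true

  extends-hom : ∀ c → Folding c → ∀ as i → All (λ (j , w) → c j ≡ w) as → extends as i (c i) ≡ true
  extends-hom c hom []             i []         = refl
  extends-hom c hom ((j , w) ∷ as) i (refl ∷ h) with core i j in eq
  ... | false = extends-hom c hom as i h
  ... | true rewrite hom i j eq = extends-hom c hom as i h

  -- The search is followed along the one branch that chooses the values of `c`: `extends-hom` keeps
  -- this branch alive, so the final test is made on `c` itself. The second component carries its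
  -- outcome back to the assignments made on the way.
  search-sound : ∀ c → Folding c → ∀ is as → search is as ≡ true → All (λ (j , w) → c j ≡ w) as →
                 (∀ {i} → i ∈ is → c i ≡ i) × (∀ {i v} → (i , v) ∈ as → i ≡ v)
  search-sound c hom []       as ok h = (λ ()) , λ m → ≟-sound (every-∈ {p = λ (i , v) → does (i ≟ v)} ok m)
  search-sound c hom (i ∷ is) as ok h with every-∈ {p = λ v → not (extends as i v) ∨ search is ((i , v) ∷ as)} ok
      (∈-allFin (c i))
  ... | step rewrite extends-hom c hom as i h with search-sound c hom is ((i , c i) ∷ as) step (refl ∷ h)
  ... | f , g = (λ { (here refl) → sym (g (here refl)) ; (there m) → f m }) , λ m → g (there m)

  core-rigid : ∀ c → Folding c → ∀ i → c i ≡ i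
  -- The first `refl` evaluates the whole search.
  core-rigid c hom i = proj₁ (search-sound c hom (allFin 10) [] refl []) (∈-allFin i)

  gadget-core : ∀ τ i j → core i j ≡ true → gadget τ i j ≡ true
  gadget-core τ i j eq rewrite eq = refl

  isChord-any : ∀ τ i j → isChord τ i j ≡ true → anyChord i j ≡ true
  isChord-any τ i j with isChord τ₀ i j in a | isChord τ₊ i j in b | isChord ι₀ i j in c | isChord ι₊ i j in d
      | isChord δ i j in e
  ... | true  | _ | _ | _ | _ = λ _ → refl
  ... | false | true  | _ | _ | _ = λ _ → refl
  ... | false | false | true  | _ | _ = λ _ → refl
  ... | false | false | false | true | _ = λ _ → refl
  ... | false | false | false | false | true = λ _ → refl
  isChord-any τ₀ i j | false | false | false | false | false = λ h → trans (sym a) h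
  isChord-any τ₊ i j | false | false | false | false | false = λ h → trans (sym b) h
  isChord-any ι₀ i j | false | false | false | false | false = λ h → trans (sym c) h
  isChord-any ι₊ i j | false | false | false | false | false = λ h → trans (sym d) h
  isChord-any δ  i j | false | false | false | false | false = λ h → trans (sym e) h

  gadget-allChords : ∀ τ i j → gadget τ i j ≡ true → allChords i j ≡ true
  gadget-allChords τ i j h with core i j
  ... | true  = refl
  ... | false = isChord-any τ i j h

  gadget-sym : ∀ τ i j → gadget τ i j ≡ gadget τ j i
  gadget-sym τ₀ = from-yes (all? λ i → all? λ j → gadget τ₀ i j ≟ᵇ gadget τ₀ j i)
  gadget-sym τ₊ = from-yes (all? λ i → all? λ j → gadget τ₊ i j ≟ᵇ gadget τ₊ j i)
  gadget-sym ι₀ = from-yes (all? λ i → all? λ j → gadget ι₀ i j ≟ᵇ gadget ι₀ j i)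
  gadget-sym ι₊ = from-yes (all? λ i → all? λ j → gadget ι₊ i j ≟ᵇ gadget ι₊ j i)
  gadget-sym δ  = from-yes (all? λ i → all? λ j → gadget δ i j ≟ᵇ gadget δ j i)

  gadget-irrefl : ∀ τ i → gadget τ i i ≡ false
  gadget-irrefl τ₀ = from-yes (all? λ i → gadget τ₀ i i ≟ᵇ false)
  gadget-irrefl τ₊ = from-yes (all? λ i → gadget τ₊ i i ≟ᵇ false)
  gadget-irrefl ι₀ = from-yes (all? λ i → gadget ι₀ i i ≟ᵇ false)
  gadget-irrefl ι₊ = from-yes (all? λ i → gadget ι₊ i i ≟ᵇ false)
  gadget-irrefl δ  = from-yes (all? λ i → gadget δ i i ≟ᵇ false)

  gadget-chord : ∀ τ → gadget τ (proj₁ (chord τ)) (proj₂ (chord τ)) ≡ true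
  gadget-chord τ₀ = refl
  gadget-chord τ₊ = refl
  gadget-chord ι₀ = refl
  gadget-chord ι₊ = refl
  gadget-chord δ  = refl

  -- The five chords are distinct pairs and none of them is a core edge, so evaluation excludes
  -- every off-diagonal case.
  chord-type : ∀ τ τ′ → gadget τ′ (proj₁ (chord τ)) (proj₂ (chord τ)) ≡ true → τ ≡ τ′
  chord-type τ₀ τ₀ _ = refl
  chord-type τ₊ τ₊ _ = refl
  chord-type ι₀ ι₀ _ = refl
  chord-type ι₊ ι₊ _ = refl
  chord-type δ  δ  _ = refl

  -- Forgetting which chord is present turns `c` into a folding of the core, hence into the
  -- identity; then the chord of `τ` itself has to be an edge of the gadget of `τ′`, which tells the
  -- types apart.
  gadget-rigid : ∀ {τ τ′} (c : Role → Role) → (∀ i j → gadget τ i j ≡ true → gadget τ′ (c i) (c j) ≡ true) →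
                 τ ≡ τ′ × (∀ i → c i ≡ i)
  gadget-rigid {τ} {τ′} c hom = chord-type τ τ′ chord-kept , c≡id
    where
    c≡id : ∀ i → c i ≡ i
    c≡id = core-rigid c λ i j eq → gadget-allChords τ′ (c i) (c j) (hom i j (gadget-core τ i j eq))
    p q : Role
    p = proj₁ (chord τ)
    q = proj₂ (chord τ)
    chord-kept : gadget τ′ p q ≡ true
    chord-kept = trans (cong₂ (gadget τ′) (sym (c≡id p)) (sym (c≡id q))) (hom p q (gadget-chord τ))

  -- Every role is joined to role 0 through a sequence of triangles of the core.
  core-connected : ∀ {V S : Set} (adj : V → V → Bool) (side : V → S) →
    (∀ u v w → adj u v ≡ true → adj u w ≡ true → adj v w ≡ true → side u ≡ side v) →
    (c : Role → V) → (∀ i j → core i j ≡ true → adj (c i) (c j) ≡ true) →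
    ∀ i → side (c i) ≡ side (c zero)
  core-connected adj side mono c hom = go
    where
    triangle-step : ∀ i p w → core i p ≡ true → core i w ≡ true → core p w ≡ true → side (c i) ≡ side (c p)
    triangle-step i p w ip iw pw = mono _ _ _ (hom i p ip) (hom i w iw) (hom p w pw)
    s1 : side (c (# 1)) ≡ side (c zero)
    s1 = triangle-step (# 1) (# 0) (# 2) refl refl refl
    s3 : side (c (# 3)) ≡ side (c zero)
    s3 = triangle-step (# 3) (# 0) (# 1) refl refl refl
    s7 : side (c (# 7)) ≡ side (c zero)
    s7 = trans (triangle-step (# 7) (# 3) (# 4) refl refl refl) s3
    go : ∀ i → side (c i) ≡ side (c zero)
    go zero = refl
    go (suc zero) = s1
    go (suc (suc zero)) = triangle-step (# 2) (# 0) (# 1) refl refl refl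
    go (suc (suc (suc zero))) = s3
    go (suc (suc (suc (suc zero)))) = trans (triangle-step (# 4) (# 1) (# 2) refl refl refl) s1
    go (suc (suc (suc (suc (suc zero))))) = trans (triangle-step (# 5) (# 1) (# 2) refl refl refl) s1
    go (suc (suc (suc (suc (suc (suc zero)))))) = triangle-step (# 6) (# 0) (# 1) refl refl refl
    go (suc (suc (suc (suc (suc (suc (suc zero))))))) = s7
    go (suc (suc (suc (suc (suc (suc (suc (suc zero)))))))) =
        trans (triangle-step (# 8) (# 3) (# 7) refl refl refl) s3
    go (suc (suc (suc (suc (suc (suc (suc (suc (suc zero))))))))) =
        trans (triangle-step (# 9) (# 1) (# 2) refl refl refl) s1

  -- Keeps steps apart from edges inside a single gadget: an edge from a source role to a target
  -- role always comes from an arc.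
  gadget-source-target : ∀ τ → gadget τ sourceRole targetRole ≡ false
  gadget-source-target τ₀ = refl
  gadget-source-target τ₊ = refl
  gadget-source-target ι₀ = refl
  gadget-source-target ι₊ = refl
  gadget-source-target δ  = refl

-- The class of graphs

Rel : Set → Set
Rel V = V → V → Bool

Pt : ∀ {V} → Rel V → Ty → (Role → V) → Set
Pt adj τ c = ∀ i j → gadget τ i j ≡ true → adj (c i) (c j) ≡ true

Step : ∀ {V} → Rel V → (Role → V) → (Role → V) → Set
Step adj c d = adj (c sourceRole) (d targetRole) ≡ true

label : ∀ {V} → Rel V → (Role → V) → (Role → V) → Bool
label adj c d = adj (c labelRole) (d labelRole)

infix 4 _⟶_
-- No arrow ends in `τ₀` or `ι₀`, which makes them the roots of lines. The first digit hangs off a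
-- space cell and each further digit off the one before it.
data _⟶_ : Ty → Ty → Set where
  τ₀τ₊ : τ₀ ⟶ τ₊
  τ₊τ₊ : τ₊ ⟶ τ₊
  ι₀ι₊ : ι₀ ⟶ ι₊
  ι₊ι₊ : ι₊ ⟶ ι₊
  ι₀δ  : ι₀ ⟶ δ
  ι₊δ  : ι₊ ⟶ δ
  δδ   : δ ⟶ δ

data Time : Ty → Set where
  τ₀ : Time τ₀
  τ₊ : Time τ₊

data Link (τ τ′ : Ty) : Role → Role → Set where
  forward  : τ ⟶ τ′ → Link τ τ′ sourceRole targetRole
  backward : τ′ ⟶ τ → Link τ τ′ targetRole sourceRole
  label→   : Time τ → τ′ ≡ δ → Link τ τ′ labelRole labelRole
  label←   : Time τ′ → τ ≡ δ → Link τ τ′ labelRole labelRole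

timeTy spaceTy : Bool → Ty
timeTy  first = if first then τ₀ else τ₊
spaceTy first = if first then ι₀ else ι₊

-- `L` is the number of label bits per cell. The rule `W` receives two neighbouring cells at one
-- time and then the same two cells at the next time; its flags tell whether the window begins at
-- the root of the time line and at the root of the space line.
module Class (L : ℕ) (W : Bool → Bool → (v v′ u u′ : Vec Bool L) → Set) where

  -- Entry `zero` is the space cell, entry `suc j` its digit `j`.
  Comb : Set → Set
  Comb V = Fin (suc L) → Role → V

  bits : ∀ {V} → Rel V → (Role → V) → Comb V → Vec Bool L
  bits adj t e = tabulate λ j → label adj t (e (suc j))

  record Window {V} (adj : Rel V) (zt zi : Bool) (t t′ : Role → V) (e e′ : Comb V) : Set where
    field
      time    : Pt adj (timeTy zt) t
      time′   : Pt adj τ₊ t′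
      tick    : Step adj t t′
      space   : Pt adj (spaceTy zi) (e zero)
      space′  : Pt adj ι₊ (e′ zero)
      shift   : Step adj (e zero) (e′ zero)
      digit   : ∀ j → Pt adj δ (e (suc j))
      digit′  : ∀ j → Pt adj δ (e′ (suc j))
      tooth   : ∀ j → Step adj (e (inject₁ j)) (e (suc j))
      tooth′  : ∀ j → Step adj (e′ (inject₁ j)) (e′ (suc j))
  open Window public

  -- `parent` makes predecessors unique across all types, so that tracing back from a point yields a
  -- well-defined position; successors may branch freely.
  record Cond {V} (adj : Rel V) : Set where
    field
      disjoint : ∀ {τ τ′ c c′ i j} → Pt adj τ c → Pt adj τ′ c′ → c i ≡ c′ j → τ ≡ τ′ × i ≡ j × c ≗ c′
      links   : ∀ {τ τ′ c c′ i j} → Pt adj τ c → Pt adj τ′ c′ → adj (c i) (c′ j) ≡ true →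
                (c ≗ c′ × gadget τ i j ≡ true) ⊎ Link τ τ′ i j
      parent  : ∀ {τ τ′ υ c c′ d} → Pt adj τ c → Pt adj τ′ c′ → Pt adj υ d → Step adj c d → Step adj c′ d → c ≗ c′
      windows : ∀ {zt zi t t′ e e′} → Window adj zt zi t t′ e e′ →
                W zt zi (bits adj t e) (bits adj t e′) (bits adj t′ e) (bits adj t′ e′)
  open Cond public

  W-resp : ∀ zt zi {v v′ u u′ x x′ y y′} → v ≡ x → v′ ≡ x′ → u ≡ y → u′ ≡ y′ → W zt zi v v′ u u′ → W zt zi x x′ y y′
  W-resp _ _ refl refl refl refl w = w

  -- Points, steps and windows are pushed forward along `f`, injectivity brings coincidences of
  -- points back, and the labels agree because non-edges are preserved as well. Both heredity and
  -- the passage to numbered vertices are instances.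
  cond-pull : ∀ {V V′} {adj : Rel V} {adj′ : Rel V′} (f : V′ → V) → Injective _≡_ _≡_ f →
              (∀ u v → adj′ u v ≡ adj (f u) (f v)) → Cond adj → Cond adj′
  cond-pull {V} {V′} {adj} {adj′} f inj same C = record
    { disjoint = λ p p′ eq → let (a , b , e) = disjoint C (pt p) (pt p′) (cong f eq) in a , b , λ i → inj (e i)
    ; links   = λ p p′ eq → pull-link (links C (pt p) (pt p′) (to eq))
    ; parent  = λ p p′ q s s′ i → inj (parent C (pt p) (pt p′) (pt q) (to s) (to s′) i)
    ; windows = λ {zt} {zi} {t} {t′} {e} {e′} w → W-resp zt zi (pull-bits t e) (pull-bits t e′) (pull-bits t′ e)
        (pull-bits t′ e′) (windows C (pull-window w))
    }
    where
    to : ∀ {u v} → adj′ u v ≡ true → adj (f u) (f v) ≡ true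
    to {u} {v} eq = trans (sym (same u v)) eq
    pt : ∀ {τ c} → Pt adj′ τ c → Pt adj τ (f ∘ c)
    pt p i j g = to (p i j g)
    pull-window : ∀ {zt zi t t′ e e′} → Window adj′ zt zi t t′ e e′ →
                  Window adj zt zi (f ∘ t) (f ∘ t′) (λ j → f ∘ e j) (λ j → f ∘ e′ j)
    pull-window w = record
      { time = pt (time w) ; time′ = pt (time′ w) ; tick = to (tick w) ; space = pt (space w) ; space′ = pt (space′ w)
      ; shift = to (shift w) ; digit = λ j → pt (digit w j) ; digit′ = λ j → pt (digit′ w j)
      ; tooth = λ j → to (tooth w j) ; tooth′ = λ j → to (tooth′ w j) }
    pull-link : ∀ {τ τ′ c c′ i j} → (f ∘ c ≗ f ∘ c′ × gadget τ i j ≡ true) ⊎ Link τ τ′ i j →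
                (c ≗ c′ × gadget τ i j ≡ true) ⊎ Link τ τ′ i j
    pull-link (inj₁ (e , g)) = inj₁ ((λ i → inj (e i)) , g)
    pull-link (inj₂ l)       = inj₂ l
    pull-bits : ∀ t e → bits adj (f ∘ t) (λ j → f ∘ e j) ≡ bits adj′ t e
    pull-bits t e = tabulate-cong λ j → sym (same _ _)

-- Locality of the conditions

image : ∀ {k n} (g : Fin k → Fin n) → Σ ℕ λ m → m ≤ k × Σ (Fin m → Fin n) λ f → Injective _≡_ _≡_ f ×
        Σ (Fin k → Fin m) λ h → ∀ x → f (h x) ≡ g x
image {zero} g = 0 , z≤n , (λ ()) , (λ { {()} }) , (λ ()) , λ ()
image {suc k} g with image (g ∘ suc)
... | m , m≤k , f , inj , h , eq with any? (λ y → f y ≟ g zero)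
... | yes (y , fy) = m , m≤n⇒m≤1+n m≤k , f , inj , (λ { zero → y ; (suc x) → h x }) , λ { zero → fy ; (suc x) → eq x }
... | no ¬y = suc m , s≤s m≤k , f⁺ , inj⁺ , (λ { zero → zero ; (suc x) → suc (h x) })
    , λ { zero → refl ; (suc x) → eq x }
  where
  f⁺ : Fin (suc m) → _
  f⁺ zero    = g zero
  f⁺ (suc y) = f y
  inj⁺ : Injective _≡_ _≡_ f⁺
  inj⁺ {zero}  {zero}  _ = refl
  inj⁺ {zero}  {suc y} e = ⊥-elim (¬y (y , sym e))
  inj⁺ {suc x} {zero}  e = ⊥-elim (¬y (x , e))
  inj⁺ {suc x} {suc y} e = cong suc (inj e)

restrict : ∀ G {m} → (Fin m → Fin (size G)) → Graph
restrict G {m} f =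
    record { size = m ; adj = λ i j → adj G (f i) (f j) ; symm = λ i j → symm G (f i) (f j) ; irrefl = λ i →
    irrefl G (f i) }

module Locality (L : ℕ) (W : Bool → Bool → (v v′ u u′ : Vec Bool L) → Set) where
  open Class L W

  opaque
    -- Two times of ten vertices each and two combs of `suc L` gadgets each: the extent of a window,
    -- which also accommodates the two or three gadgets of the other conditions.
    bound : ℕ
    bound = 2 * 10 + (2 * suc L) * 10

    verticesT : ∀ {n} → (Fin 2 → Role → Fin n) → Fin (2 * 10) → Fin n
    verticesT t y = uncurry t (remQuot 10 y)

    verticesE : ∀ {n} → (Fin 2 → Comb (Fin n)) → Fin ((2 * suc L) * 10) → Fin n
    verticesE e y = uncurry (uncurry e ∘ remQuot (suc L)) (remQuot {2 * suc L} 10 y)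

    vertices : ∀ {n} → (Fin 2 → Role → Fin n) → (Fin 2 → Comb (Fin n)) → Fin bound → Fin n
    vertices t e x = [ verticesT t , verticesE e ]′ (splitAt (2 * 10) x)

    indexT : Fin 2 → Role → Fin bound
    indexT i r = combine i r ↑ˡ ((2 * suc L) * 10)

    indexE : Fin 2 → Fin (suc L) → Role → Fin bound
    indexE i j r = (2 * 10) ↑ʳ combine (combine i j) r

    vertices-T : ∀ {n} (t : Fin 2 → Role → Fin n) e i r → vertices t e (indexT i r) ≡ t i r
    vertices-T t e i r =
        trans (cong [ verticesT t , verticesE e ]′ (splitAt-↑ˡ (2 * 10) (combine i r) ((2 * suc L) * 10)))
                               (cong (uncurry t) (remQuot-combine i r))

    vertices-E : ∀ {n} (t : Fin 2 → Role → Fin n) e i j r → vertices t e (indexE i j r) ≡ e i j r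
    vertices-E t e i j r =
        trans (cong [ verticesT t , verticesE e ]′ (splitAt-↑ʳ (2 * 10) ((2 * suc L) * 10) (combine (combine i j) r)))
                          (trans (cong (uncurry (uncurry e ∘ remQuot (suc L))) (remQuot-combine (combine i j) r))
                                 (cong (λ p → uncurry e p r) (remQuot-combine i j)))

  record Piece (G : Graph) (t : Fin 2 → Role → Fin (size G)) (e : Fin 2 → Comb (Fin (size G))) : Set where
    field
      {m}   : ℕ
      small : m ≤ bound
      f     : Fin m → Fin (size G)
      inj   : Injective _≡_ _≡_ f
      t′    : Fin 2 → Role → Fin m
      e′    : Fin 2 → Comb (Fin m)
      T-eq  : ∀ i r → f (t′ i r) ≡ t i r
      E-eq  : ∀ i j r → f (e′ i j r) ≡ e i j r

  opaque
    piece : ∀ G t e → Piece G t e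
    piece G t e with image (vertices t e)
    ... | m , small , f , inj , h , eq = record
      { small = small ; f = f ; inj = inj ; t′ = λ i r → h (indexT i r) ; e′ = λ i j r → h (indexE i j r)
      ; T-eq = λ i r → trans (eq _) (vertices-T t e i r) ; E-eq = λ i j r → trans (eq _) (vertices-E t e i j r) }

  -- Each instance of a condition lives on the vertices of at most two times and two combs, and
  -- these span a small induced subgraph in which the condition is available. The two time slots
  -- serve for any pair of points to be compared, and slots left over are filled by repeating a
  -- point.
  local : ∀ G → (∀ H → size H ≤ bound → InducedSub H G → Cond (adj H)) → Cond (adj G)
  local G loc = record
    { disjoint = λ {τ} {τ′} {c} {c′} p p′ eq →
        let open At (two c c′) (λ _ _ → c)
            (a , b , g) = disjoint C (pt T-eq p) (pt T-eq p′)
                (inj (trans (T-eq zero _) (trans eq (sym (T-eq (suc zero) _)))))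
        in a , b , push g
    ; links   = λ {τ} {τ′} {c} {c′} p p′ eq →
        let open At (two c c′) (λ _ _ → c) in
        [ (λ (g , h) → inj₁ (push g , h)) , inj₂ ]′ (links C (pt T-eq p) (pt T-eq p′) (from T-eq T-eq eq))
    ; parent  = λ {_} {_} {_} {c} {c′} {d} p p′ q s s′ →
        let open At (two c c′) (λ _ _ → d) in
        push (parent C (pt T-eq p) (pt T-eq p′) (pt (E-eq zero) {x = zero} q) (from T-eq (E-eq zero) s)
            (from T-eq (E-eq zero) s′))
    ; windows = λ {zt} {zi} {t} {t′} {e} {e′} w →
        let open At (two t t′) (two e e′)
        in W-resp zt zi (push-bits zero zero) (push-bits zero (suc zero)) (push-bits (suc zero) zero)
            (push-bits (suc zero) (suc zero))
             (windows C (push-window w))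
    }
    where
    V = Fin (size G)
    two : ∀ {A : Set} → A → A → Fin 2 → A
    two x y zero       = x
    two x y (suc zero) = y
    module At (t : Fin 2 → Role → V) (e : Fin 2 → Comb V) where
      open Piece (piece G t e) public
      H : Graph
      H = restrict G f
      C : Cond (adj H)
      C = loc H small (f , inj , λ _ _ → refl)
      pt : ∀ {A : Set} {b : A → Role → Fin m} {c : A → Role → V} (eq : ∀ x r → f (b x r) ≡ c x r) {τ x} →
          Pt (adj G) τ (c x) → Pt (adj H) τ (b x)
      pt eq p i j g = trans (cong₂ (adj G) (eq _ i) (eq _ j)) (p i j g)
      from : ∀ {A B : Set} {b : A → Role → Fin m} {c : A → Role → V} {b′ : B → Role → Fin m} {c′ : B → Role → V}
             (eq : ∀ x r → f (b x r) ≡ c x r) (eq′ : ∀ x r → f (b′ x r) ≡ c′ x r) {x y i j} →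
             adj G (c x i) (c′ y j) ≡ true → adj H (b x i) (b′ y j) ≡ true
      from eq eq′ {x} {y} {i} {j} a = trans (cong₂ (adj G) (eq x i) (eq′ y j)) a
      push : t′ zero ≗ t′ (suc zero) → t zero ≗ t (suc zero)
      push g i = trans (sym (T-eq zero i)) (trans (cong f (g i)) (T-eq (suc zero) i))
      push-bits : ∀ i j → bits (adj H) (t′ i) (e′ j) ≡ bits (adj G) (t i) (e j)
      push-bits i j = tabulate-cong λ k → cong₂ (adj G) (T-eq i _) (E-eq j (suc k) _)

      push-window : ∀ {zt zi} → Window (adj G) zt zi (t zero) (t (suc zero)) (e zero) (e (suc zero)) →
                    Window (adj H) zt zi (t′ zero) (t′ (suc zero)) (e′ zero) (e′ (suc zero))
      push-window w = record
        { time = pt T-eq (time w) ; time′ = pt T-eq (time′ w) ; tick = from T-eq T-eq (tick w)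
        ; space = pt (E-eq zero) (space w) ; space′ = pt (E-eq (suc zero)) (space′ w) ; shift =
            from (E-eq zero) (E-eq (suc zero)) (shift w)
        ; digit = λ j → pt (E-eq zero) (digit w j) ; digit′ = λ j → pt (E-eq (suc zero)) (digit′ w j)
        ; tooth = λ j → from (E-eq zero) (E-eq zero) (tooth w j) ; tooth′ =
            λ j → from (E-eq (suc zero)) (E-eq (suc zero)) (tooth′ w j) }

-- Finite bases

functions : ∀ {A : Set} → List A → ∀ m → List (Fin m → A)
functions xs zero    = (λ ()) ∷ []
functions xs (suc m) = cartesianProductWith (λ x f → λ { zero → x ; (suc i) → f i }) xs (functions xs m)

-- Functions are listed only up to pointwise agreement, and agreement of values is itself a
-- parameter: a second use with `_≗_` as `_~_` then covers matrices.
functions-complete : ∀ {A : Set} (_~_ : A → A → Set) {xs} → (∀ a → ∃ λ x → x ∈ xs × x ~ a) →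
                     ∀ m (f : Fin m → A) → ∃ λ g → g ∈ functions xs m × (∀ i → g i ~ f i)
functions-complete _~_ cover zero    f = _ , here refl , λ ()
functions-complete _~_ cover (suc m) f =
  let (x , x∈ , x~) = cover (f zero)
      (g , g∈ , g~) = functions-complete _~_ cover m (f ∘ suc)
  in _ , ∈-cartesianProductWith⁺ _ x∈ g∈ , λ { zero → x~ ; (suc i) → g~ i }

-- Forces an arbitrary matrix into the shape of a graph, so that it suffices to enumerate matrices;
-- a genuine adjacency matrix keeps all its entries.
symmetrized : ∀ {m} → (Fin m → Fin m → Bool) → Graph
symmetrized {m} α = record
  { size   = m
  ; adj    = λ i j → not (does (i ≟ j)) ∧ (α i j ∧ α j i)
  ; symm   = λ i j → cong₂ _∧_ (cong not (≟-sym i j)) (∧-comm (α i j) (α j i))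
  ; irrefl = λ i → diagonal i }
  where
  ≟-sym : ∀ i j → does (i ≟ j) ≡ does (j ≟ i)
  ≟-sym i j with i ≟ j | j ≟ i
  ... | yes _ | yes _ = refl
  ... | no  _ | no  _ = refl
  ... | yes p | no  q = ⊥-elim (q (sym p))
  ... | no  p | yes q = ⊥-elim (p (sym q))
  diagonal : ∀ i → not (does (i ≟ i)) ∧ (α i i ∧ α i i) ≡ false
  diagonal i with i ≟ i
  ... | yes _ = refl
  ... | no  p = ⊥-elim (p refl)

symmetrized-adj : ∀ H {α} → (∀ i j → α i j ≡ adj H i j) → ∀ i j → adj (symmetrized α) i j ≡ adj H i j
symmetrized-adj H {α} eq i j with i ≟ j
... | yes refl = sym (irrefl H i)
... | no  _    = trans (cong₂ _∧_ (eq i j) (trans (eq j i) (symm H j i))) (idem (adj H i j))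
  where
  idem : ∀ b → b ∧ b ≡ b
  idem false = refl
  idem true  = refl

graphsOfSize : ℕ → List Graph
graphsOfSize m = map symmetrized (functions (functions (true ∷ false ∷ []) m) m)

graphsUpTo : ℕ → List Graph
graphsUpTo zero    = graphsOfSize zero
graphsUpTo (suc k) = graphsOfSize (suc k) ++ graphsUpTo k

Iso : Graph → Graph → Set
Iso H H′ = InducedSub H H′ × InducedSub H′ H

graphsOfSize-complete : ∀ H → ∃ λ H′ → H′ ∈ graphsOfSize (size H) × Iso H H′
graphsOfSize-complete H =
  let (α , α∈ , eq) = functions-complete _≗_ (functions-complete _≡_ bool (size H)) (size H) (adj H)
      same = symmetrized-adj H eq
  in _ , ∈-map⁺ symmetrized α∈ , (id , id , same) , (id , id , λ i j → sym (same i j))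
  where
  bool : ∀ b → ∃ λ x → x ∈ (true ∷ false ∷ []) × x ≡ b
  bool true  = true  , here refl , refl
  bool false = false , there (here refl) , refl

graphsUpTo-complete : ∀ k H → size H ≤ k → ∃ λ H′ → H′ ∈ graphsUpTo k × Iso H H′
graphsUpTo-complete k H le with m≤n⇒m<n∨m≡n le
graphsUpTo-complete zero    H le | inj₂ refl = graphsOfSize-complete H
graphsUpTo-complete (suc k) H le | inj₂ refl = let (H′ , m , iso) = graphsOfSize-complete H in H′ , ∈-++⁺ˡ m , iso
graphsUpTo-complete (suc k) H le | inj₁ (s≤s lt) =
  let (H′ , m , iso) = graphsUpTo-complete k H lt in H′ , ∈-++⁺ʳ (graphsOfSize (suc k)) m , iso

InducedSub-trans : ∀ {A B C} → InducedSub A B → InducedSub B C → InducedSub A C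
InducedSub-trans (f , f-inj , f-same) (g , g-inj , g-same) =
  g ∘ f , f-inj ∘ g-inj , λ i j → trans (g-same (f i) (f j)) (f-same i j)

-- Each `Q x` is decided up to double negation, and finitely many such decisions combine. The
-- outcome serves the derivation of a contradiction, where double negation does no harm.
refuted : ∀ {A : Set} (Q : A → Set) (xs : List A) →
          ¬ ¬ (Σ (List A) λ F → (∀ x → x ∈ F → ¬ Q x) × (∀ x → x ∈ xs → x ∈ F ⊎ Q x))
refuted Q [] k = k ([] , (λ _ ()) , λ _ ())
refuted Q (x ∷ xs) k = refuted Q xs step
  where
  step : ¬ (Σ (List _) λ F → (∀ x → x ∈ F → ¬ Q x) × (∀ x → x ∈ xs → x ∈ F ⊎ Q x))
  step (F , sound , complete) =
      not-refuted λ q → k (F , sound , λ { _ (here refl) → inj₂ q ; y (there m) → complete y m })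
    where
    not-refuted : ¬ ¬ Q x
    not-refuted ¬q = k (x ∷ F , (λ { _ (here refl) → ¬q ; y (there m) → sound y m })
                              , λ { _ (here refl) → inj₁ (here refl) ; y (there m) → map₁ there (complete y m) })

module Finite (L : ℕ) (W : Bool → Bool → (v v′ u u′ : Vec Bool L) → Set) where
  open Class L W
  open Locality L W

  cond-hereditary : ∀ H G → InducedSub H G → Cond (adj G) → Cond (adj H)
  cond-hereditary H G (f , inj , same) = cond-pull f inj λ u v → sym (same u v)

  -- The basis consists of the small graphs that violate the conditions. That avoiding them suffices
  -- is locality; that the class avoids them is heredity.
  finite-basis : ¬ ¬ (Σ (List Graph) λ F → ∀ G → (Forb F G → Cond (adj G)) × (Cond (adj G) → Forb F G))
  finite-basis k = refuted (Cond ∘ adj) (graphsUpTo bound) λ (F , sound , complete) → k (F , λ G →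
    (λ avoids → local G λ H small sub →
      let (H′ , m , (to , from)) = graphsUpTo-complete bound H small in
      [ (λ m → ⊥-elim (avoids H′ m (InducedSub-trans {H′} {H} {G} from sub)))
          , cond-hereditary H H′ to ]′ (complete H′ m)) ,
    λ C H m sub → sound H m (cond-hereditary H G sub C))

-- Graphs assembled from gadgets

-- A blueprint with one gadget per element and one source-to-target edge per arc; graphs built from
-- it carry no label edges.
record Structure : Set where
  field
    card        : ℕ
    ty          : Fin card → Ty
    arc         : Fin card → Fin card → Bool
    arc-typed   : ∀ x y → arc x y ≡ true → ty x ⟶ ty y
    arc-unique  : ∀ x x′ y → arc x y ≡ true → arc x′ y ≡ true → x ≡ x′
    arc-irrefl  : ∀ x → arc x x ≢ true
open Structure public

Cell : Structure → Set
Cell M = Fin (card M) × Role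

data Edge (M : Structure) : Cell M → Cell M → Set where
  inner : ∀ {x i j} → gadget (ty M x) i j ≡ true → Edge M (x , i) (x , j)
  arc→  : ∀ {x y} → arc M x y ≡ true → Edge M (x , sourceRole) (y , targetRole)
  arc←  : ∀ {x y} → arc M y x ≡ true → Edge M (x , targetRole) (y , sourceRole)

bool-ext : ∀ {a b} → (a ≡ true → b ≡ true) → (b ≡ true → a ≡ true) → a ≡ b
bool-ext {true}  {b}     f g = sym (f refl)
bool-ext {false} {true}  f g = g refl
bool-ext {false} {false} f g = refl

≢true⇒false : ∀ {b} → b ≢ true → b ≡ false
≢true⇒false {true}  p = ⊥-elim (p refl)
≢true⇒false {false} p = refl

false≢true : ∀ {b} → b ≡ false → b ≢ true
false≢true refl ()

opaque
  arcEdge : Bool → Role → Role → Bool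
  arcEdge a i j = a ∧ (does (i ≟ sourceRole) ∧ does (j ≟ targetRole))

  innerEdge : Bool → Ty → Role → Role → Bool
  innerEdge same τ i j = same ∧ gadget τ i j

  edge : (M : Structure) → Rel (Cell M)
  edge M (x , i) (y , j) = innerEdge (does (x ≟ y)) (ty M x) i j ∨ (arcEdge (arc M x y) i j ∨ arcEdge (arc M y x) j i)

  arcEdge-sound : ∀ a i j → arcEdge a i j ≡ true → a ≡ true × i ≡ sourceRole × j ≡ targetRole
  arcEdge-sound true i j eq with i ≟ sourceRole | j ≟ targetRole
  ... | yes p | yes q = refl , p , q

  edge-sound : ∀ M u v → edge M u v ≡ true → Edge M u v
  edge-sound M (x , i) (y , j) eq with x ≟ y
  edge-sound M (x , i) (y , j) eq | yes refl with gadget (ty M x) i j in g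
  ... | true = inner g
  edge-sound M (x , i) (y , j) eq | yes refl | false with arcEdge (arc M x x) i j in a
  ... | true = let (p , _) = arcEdge-sound (arc M x x) i j a in ⊥-elim (arc-irrefl M x p)
  ... | false = let (p , _) = arcEdge-sound (arc M x x) j i eq in ⊥-elim (arc-irrefl M x p)
  edge-sound M (x , i) (y , j) eq | no _ with arcEdge (arc M x y) i j in a
  ... | true with arcEdge-sound (arc M x y) i j a
  ... | p , refl , refl = arc→ p
  edge-sound M (x , i) (y , j) eq | no _ | false with arcEdge-sound (arc M y x) j i eq
  ... | p , refl , refl = arc← p

  edge-inner : ∀ M x i j → gadget (ty M x) i j ≡ true → edge M (x , i) (x , j) ≡ true
  edge-inner M x i j g with x ≟ x
  ... | no ¬p = ⊥-elim (¬p refl)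
  ... | yes _ rewrite g = refl

  edge-arc : ∀ M x y → arc M x y ≡ true → edge M (x , sourceRole) (y , targetRole) ≡ true
  edge-arc M x y a rewrite a with innerEdge (does (x ≟ y)) (ty M x) sourceRole targetRole
  ... | true  = refl
  ... | false = refl

  edge-sym : ∀ M u v → edge M u v ≡ edge M v u
  edge-sym M (x , i) (y , j) = cong₂ _∨_ inner-sym (∨-comm (arcEdge (arc M x y) i j) _)
    where
    inner-sym : innerEdge (does (x ≟ y)) (ty M x) i j ≡ innerEdge (does (y ≟ x)) (ty M y) j i
    inner-sym with x ≟ y | y ≟ x
    ... | yes refl | yes _ = gadget-sym (ty M x) i j
    ... | no  _ | no  _ = refl
    ... | yes p | no  q = ⊥-elim (q (sym p))
    ... | no  p | yes q = ⊥-elim (p (sym q))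

  edge-irrefl : ∀ M u → edge M u u ≡ false
  edge-irrefl M (x , i) = ≢true⇒false λ eq → no-loop (edge-sound M (x , i) (x , i) eq)
    where
    no-loop : ¬ Edge M (x , i) (x , i)
    no-loop (inner g) = false≢true (gadget-irrefl (ty M x) i) g

graphOf : Structure → Graph
graphOf M = record
  { size   = card M * 10
  ; adj    = λ u v → edge M (remQuot 10 u) (remQuot 10 v)
  ; symm   = λ u v → edge-sym M (remQuot 10 u) (remQuot 10 v)
  ; irrefl = λ u → edge-irrefl M (remQuot 10 u) }

remQuot-injective : ∀ {m} n → Injective _≡_ _≡_ (remQuot {m} n)
remQuot-injective {m} n {u} {v} eq =
  trans (sym (combine-remQuot {m} n u)) (trans (cong (uncurry combine) eq) (combine-remQuot {m} n v))

-- An arc edge joins a source role to a target role. A triangle through it would either have both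
-- ends in one copy or repeat a vertex, which would be a loop.
triangle : ∀ M u v w → edge M u v ≡ true → edge M u w ≡ true → edge M v w ≡ true → proj₁ u ≡ proj₁ v
triangle M u v w uv uw vw = go (edge-sound M u v uv) (edge-sound M u w uw) (edge-sound M v w vw)
  where
  go : ∀ {u v w} → Edge M u v → Edge M u w → Edge M v w → proj₁ u ≡ proj₁ v
  go (inner _) _         _         = refl
  go (arc→ _)  (inner g) (inner _) = refl
  go (arc→ _)  (inner g) (arc← _)  = ⊥-elim (false≢true (gadget-irrefl (ty M _) sourceRole) g)
  go (arc→ _)  (arc→ _)  (inner g) = ⊥-elim (false≢true (gadget-irrefl (ty M _) targetRole) g)
  go (arc← _)  (inner g) (inner _) = refl
  go (arc← _)  (inner g) (arc→ _)  = ⊥-elim (false≢true (gadget-irrefl (ty M _) targetRole) g)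
  go (arc← _)  (arc← _)  (inner g) = ⊥-elim (false≢true (gadget-irrefl (ty M _) sourceRole) g)

-- Triangles stay inside one copy and the core hangs together through triangles, so a point lies in
-- a single copy, where rigidity makes it that copy itself.
points-of-structure : ∀ M {τ c} → Pt (edge M) τ c → ∃ λ x → τ ≡ ty M x × (∀ i → c i ≡ (x , i))
points-of-structure M {τ} {c} p =
  let (e , f) = gadget-rigid {τ} {ty M x} (proj₂ ∘ c) inside
  in x , e , λ i → cong₂ _,_ (at-x i) (f i)
  where
  x : Fin (card M)
  x = proj₁ (c zero)
  at-x : ∀ i → proj₁ (c i) ≡ x
  at-x = core-connected (edge M) proj₁ (triangle M) c λ i j h → p i j (gadget-core τ i j h)
  same-copy : ∀ {u v} → Edge M u v → proj₁ u ≡ x → proj₁ v ≡ x → gadget (ty M x) (proj₂ u) (proj₂ v) ≡ true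
  same-copy (inner g) refl _    = g
  same-copy (arc→ a)  refl refl = ⊥-elim (arc-irrefl M x a)
  same-copy (arc← a)  refl refl = ⊥-elim (arc-irrefl M x a)
  inside : ∀ i j → gadget τ i j ≡ true → gadget (ty M x) (proj₂ (c i)) (proj₂ (c j)) ≡ true
  inside i j g = same-copy (edge-sound M (c i) (c j) (p i j g)) (at-x i) (at-x j)

module Structures (L : ℕ) (W : Bool → Bool → (v v′ u u′ : Vec Bool L) → Set) where
  open Class L W

  module _ (M : Structure) (one-sided : ∀ x y zt zi → timeTy zt ≡ ty M x → spaceTy zi ≡ ty M y → ⊥) where

    -- Since times and space cells do not occur together, there are no windows; the remaining
    -- conditions are read off the arcs, because the points are exactly the copies.
    edge-cond : Cond (edge M)
    edge-cond = record
      { disjoint = λ p p′ → disjoint-edge (points-of-structure M p) (points-of-structure M p′)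
      ; links    = λ p p′ → links-edge (points-of-structure M p) (points-of-structure M p′)
      ; parent   = λ p p′ q → parent-edge (points-of-structure M p) (points-of-structure M p′)
          (points-of-structure M q)
      ; windows  = λ {zt} {zi} w →
          let (x , e , _) = points-of-structure M (time w)
              (y , e′ , _) = points-of-structure M (space w)
          in ⊥-elim (one-sided x y zt zi e e′)
      }
      where
      Copy : Ty → (Role → Cell M) → Set
      Copy τ c = ∃ λ x → τ ≡ ty M x × (∀ i → c i ≡ (x , i))
      disjoint-edge : ∀ {τ τ′ c c′ i j} → Copy τ c → Copy τ′ c′ → c i ≡ c′ j → τ ≡ τ′ × i ≡ j × c ≗ c′
      disjoint-edge {i = i} {j} (x , refl , e) (y , refl , e′) eq with trans (sym (e i)) (trans eq (e′ j))
      ... | refl = refl , refl , λ k → trans (e k) (sym (e′ k))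
      links-edge : ∀ {τ τ′ c c′ i j} → Copy τ c → Copy τ′ c′ → edge M (c i) (c′ j) ≡ true →
                   (c ≗ c′ × gadget τ i j ≡ true) ⊎ Link τ τ′ i j
      links-edge {i = i} {j} (x , refl , e) (y , refl , e′) eq
        with edge-sound M (x , i) (y , j) (trans (cong₂ (edge M) (sym (e i)) (sym (e′ j))) eq)
      ... | inner g = inj₁ ((λ k → trans (e k) (sym (e′ k))) , g)
      ... | arc→ a  = inj₂ (forward (arc-typed M x y a))
      ... | arc← a  = inj₂ (backward (arc-typed M y x a))
      parent-edge : ∀ {τ τ′ υ c c′ d} → Copy τ c → Copy τ′ c′ → Copy υ d → Step (edge M) c d → Step (edge M) c′ d →
          c ≗ c′
      parent-edge (x , _ , e) (x′ , _ , e′) (y , refl , f) s s′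
        with edge-sound M (x , sourceRole) (y , targetRole)
            (trans (cong₂ (edge M) (sym (e sourceRole)) (sym (f targetRole))) s)
           | edge-sound M (x′ , sourceRole) (y , targetRole)
               (trans (cong₂ (edge M) (sym (e′ sourceRole)) (sym (f targetRole))) s′)
      ... | inner g | _       = ⊥-elim (false≢true (gadget-source-target (ty M y)) g)
      ... | arc→ _  | inner g = ⊥-elim (false≢true (gadget-source-target (ty M y)) g)
      ... | arc→ a  | arc→ a′ with arc-unique M x x′ y a a′
      ... | refl = λ k → trans (e k) (sym (e′ k))

    graphOf-cond : Cond (adj (graphOf M))
    graphOf-cond = cond-pull (remQuot 10) (remQuot-injective 10) (λ _ _ → refl) edge-cond

  copy : ∀ M {D} → Hom (graphOf M) D → Fin (card M) → Role → Fin (size D)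
  copy M (f , _) x i = f (combine x i)

  copy-edge : ∀ M {D} (f : Hom (graphOf M) D) x i y j → edge M (x , i) (y , j) ≡ true →
      adj D (copy M {D} f x i) (copy M {D} f y j) ≡ true
  copy-edge M (f , hom) x i y j e = hom _ _ (trans (cong₂ (edge M) (remQuot-combine x i) (remQuot-combine y j)) e)

  copy-pt : ∀ M {D} (f : Hom (graphOf M) D) x → Pt (adj D) (ty M x) (copy M {D} f x)
  copy-pt M {D} f x i j g = copy-edge M {D} f x i x j (edge-inner M x i j g)

  copy-step : ∀ M {D} (f : Hom (graphOf M) D) x y → arc M x y ≡ true → Step (adj D) (copy M {D} f x) (copy M {D} f y)
  copy-step M {D} f x y a = copy-edge M {D} f x sourceRole y targetRole (edge-arc M x y a)

  module _ (M : Structure) (D : Graph) (C : Cond (adj D)) (p : Fin (card M) → Role → Fin (size D))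
    (p-pt       : ∀ x → Pt (adj D) (ty M x) (p x))
    (p-step     : ∀ x y → arc M x y ≡ true → Step (adj D) (p x) (p y))
    (p-distinct : ∀ x y → p x ≗ p y → x ≡ y)
    (p-label    : ∀ x y → Time (ty M x) → ty M y ≡ δ → label (adj D) (p x) (p y) ≡ false)
    (rooted     : ∀ y → (∃ λ x → arc M x y ≡ true) ⊎ (∀ {τ} → ¬ (τ ⟶ ty M y)))
    where

    -- Since `y` is not a root, some arc leads from a `z` to `y`, and `parent` in `D` identifies the
    -- images of `x` and `z`.
    arc-reflected : ∀ x y → ty M x ⟶ ty M y → Step (adj D) (p x) (p y) → arc M x y ≡ true
    arc-reflected x y typed s with rooted y
    ... | inj₂ root     = ⊥-elim (root typed)
    ... | inj₁ (z , a) with p-distinct x z (parent C (p-pt x) (p-pt z) (p-pt y) s (p-step z y a))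
    ... | refl = a

    edge-reflected : ∀ x i y j → adj D (p x i) (p y j) ≡ true → edge M (x , i) (y , j) ≡ true
    edge-reflected x i y j e with links C (p-pt x) (p-pt y) e
    ... | inj₂ (forward typed)  = edge-arc M x y (arc-reflected x y typed e)
    ... | inj₂ (backward typed) =
        trans (edge-sym M (x , i) (y , j)) (edge-arc M y x (arc-reflected y x typed (trans (symm D _ _) e)))
    ... | inj₂ (label→ t d) = ⊥-elim (false≢true (p-label x y t d) e)
    ... | inj₂ (label← t d) = ⊥-elim (false≢true (p-label y x t d) (trans (symm D _ _) e))
    ... | inj₁ (same , g) with p-distinct x y same
    ... | refl = edge-inner M x i j g

    edge-preserved : ∀ {u v} → Edge M u v → adj D (uncurry p u) (uncurry p v) ≡ true
    edge-preserved (inner {x} g) = p-pt x _ _ g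
    edge-preserved (arc→ a)      = p-step _ _ a
    edge-preserved (arc← a)      = trans (symm D _ _) (p-step _ _ a)

    -- `links` leaves only steps and label edges as edges between different points. Label edges are
    -- excluded by assumption and steps are reflected by uniqueness of predecessors, so the points
    -- span an induced copy.
    embedding : InducedSub (graphOf M) D
    embedding = uncurry p ∘ remQuot 10 , (λ eq → remQuot-injective 10 (p-injective _ _ eq)) ,
      λ u v → let (x , i) = remQuot 10 u ; (y , j) = remQuot 10 v in
        bool-ext (edge-reflected x i y j) (λ e → edge-preserved (edge-sound M (x , i) (y , j) e))
      where
      p-injective : ∀ u v → uncurry p u ≡ uncurry p v → u ≡ v
      p-injective (x , i) (y , j) eq with disjoint C (p-pt x) (p-pt y) eq
      ... | _ , refl , same with p-distinct x y same
      ... | refl = refl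

-- Positions on lines

-- The search reaches only functions assembled by `cons`, which agree with a given one pointwise;
-- hence the invariance demanded of `Q`.
any-function? : ∀ {n} m (Q : (Fin m → Fin n) → Set) → (∀ {f g} → f ≗ g → Q f → Q g) → (∀ f → Dec (Q f)) → Dec (∃ Q)
any-function? {n} zero Q resp Q? = map′ (λ q → none , q) (λ (f , q) → resp {f} {none} (λ ()) q) (Q? none)
  where
  none : Fin zero → Fin n
  none ()
any-function? {n} (suc m) Q resp Q? =
    map′ (λ (x , f , q) → cons x f , q) (λ (f , q) → f zero , f ∘ suc , resp (λ { zero → refl ; (suc _) → refl }) q)
  (any? λ x → any-function? m (λ f → Q (cons x f)) (λ e → resp λ { zero → refl ; (suc i) → e i })
      (λ f → Q? (cons x f)))
  where
  cons : Fin n → (Fin m → Fin n) → Fin (suc m) → Fin n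
  cons x f zero    = x
  cons x f (suc i) = f i

module _ {V : Set} (adj : Rel V) where

  pt-resp : ∀ {τ c d} → c ≗ d → Pt adj τ c → Pt adj τ d
  pt-resp e p i j g = trans (cong₂ adj (sym (e i)) (sym (e j))) (p i j g)

  step-resp : ∀ {c c′ d d′} → c ≗ c′ → d ≗ d′ → Step adj c d → Step adj c′ d′
  step-resp e e′ s = trans (cong₂ adj (sym (e sourceRole)) (sym (e′ targetRole))) s

  -- A position is witnessed by the way back to a base point, because in the class predecessors are
  -- unique while successors need not be.
  Chain : ((Role → V) → Set) → Ty → ℕ → (Role → V) → Set
  Chain Base τ zero    c = Base c
  Chain Base τ (suc n) c = Pt adj τ c × ∃ λ d → Step adj d c × Chain Base τ n d

  chain-resp : ∀ {Base} → (∀ {c d} → c ≗ d → Base c → Base d) → ∀ {τ} n {c d} → c ≗ d → Chain Base τ n c →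
      Chain Base τ n d
  chain-resp resp zero    e b = resp e b
  chain-resp resp (suc n) e (p , d , s , ch) = pt-resp e p , d , step-resp {d} {d} (λ _ → refl) e s , ch

  TimeAt : ℕ → (Role → V) → Set
  TimeAt = Chain (Pt adj τ₀) τ₊

  SpaceAt : ℕ → (Role → V) → Set
  SpaceAt = Chain (Pt adj ι₀) ι₊

  -- Length `0` is the space cell itself, so digit `j` sits at length `suc j`.
  DigitAt : ℕ → ℕ → (Role → V) → Set
  DigitAt k = Chain (SpaceAt k) δ

  timeAt-resp : ∀ n {c d} → c ≗ d → TimeAt n c → TimeAt n d
  timeAt-resp = chain-resp pt-resp

  spaceAt-resp : ∀ n {c d} → c ≗ d → SpaceAt n c → SpaceAt n d
  spaceAt-resp = chain-resp pt-resp

  digitAt-resp : ∀ k n {c d} → c ≗ d → DigitAt k n c → DigitAt k n d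
  digitAt-resp k = chain-resp (spaceAt-resp k)

  timeAt-type : ∀ n {c} → TimeAt n c → ∃ λ τ → Time τ × Pt adj τ c
  timeAt-type zero    p       = τ₀ , τ₀ , p
  timeAt-type (suc n) (p , _) = τ₊ , τ₊ , p

  spaceAt-type : ∀ n {c} → SpaceAt n c → ∃ λ τ → τ ≢ δ × Pt adj τ c
  spaceAt-type zero    p       = ι₀ , (λ ()) , p
  spaceAt-type (suc n) (p , _) = ι₊ , (λ ()) , p

module Chains (L : ℕ) (W : Bool → Bool → (v v′ u u′ : Vec Bool L) → Set) where
  open Class L W

  module _ {V : Set} {adj : Rel V} (C : Cond adj) where

    Rooted : ((Role → V) → Set) → Ty → Set
    Rooted Base τ = ∀ {c} → Base c → ∃ λ ρ → ρ ≢ τ × Pt adj ρ c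

    chain-type : ∀ {Base τ} → Rooted Base τ → ∀ n {c} → Chain adj Base τ n c → ∃ λ ρ → Pt adj ρ c
    chain-type root zero    b       = let (ρ , _ , q) = root b in ρ , q
    chain-type root (suc n) (p , _) = _ , p

    chain-unique : ∀ {Base Base′ τ} → Rooted Base τ → Rooted Base′ τ →
                   ∀ n m {c d} → c ≗ d → Chain adj Base τ n c → Chain adj Base′ τ m d →
                   n ≡ m × ∃ λ b → ∃ λ b′ → Base b × Base′ b′ × b ≗ b′
    chain-unique root root′ zero    zero    e b b′ = refl , _ , _ , b , b′ , e
    chain-unique root root′ zero    (suc m) e b (p , _) =
      let (ρ , ρ≢τ , q) = root b in ⊥-elim (ρ≢τ (proj₁ (disjoint C q p (e zero))))
    chain-unique root root′ (suc n) zero    e (p , _) b =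
      let (ρ , ρ≢τ , q) = root′ b in ⊥-elim (ρ≢τ (sym (proj₁ (disjoint C p q (e zero)))))
    chain-unique root root′ (suc n) (suc m) e (p , c , s , ch) (p′ , d , s′ , ch′) =
      let (_ , q)  = chain-type root n ch
          (_ , q′) = chain-type root′ m ch′
          (eq , rest) = chain-unique root root′ n m (parent C q q′ p′ (step-resp adj {c} {c} (λ _ → refl) e s) s′) ch
              ch′
      in cong suc eq , rest

    timeAt-unique : ∀ n m {c d} → c ≗ d → TimeAt adj n c → TimeAt adj m d → n ≡ m
    timeAt-unique n m e a b = proj₁ (chain-unique (λ p → τ₀ , (λ ()) , p) (λ p → τ₀ , (λ ()) , p) n m e a b)

    spaceAt-unique : ∀ n m {c d} → c ≗ d → SpaceAt adj n c → SpaceAt adj m d → n ≡ m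
    spaceAt-unique n m e a b = proj₁ (chain-unique (λ p → ι₀ , (λ ()) , p) (λ p → ι₀ , (λ ()) , p) n m e a b)

    digitAt-unique : ∀ k l n m {c d} → c ≗ d → DigitAt adj k n c → DigitAt adj l m d → k ≡ l × n ≡ m
    digitAt-unique k l n m e a b =
      let (n≡m , _ , _ , x , y , same) = chain-unique (spaceAt-type adj k) (spaceAt-type adj l) n m e a b
      in spaceAt-unique k l same x y , n≡m

    predecessor : ∀ {Base τ} → Rooted Base τ → ∀ n {c d σ} → Pt adj σ c → Step adj c d →
                  Chain adj Base τ (suc n) d → (∀ {c d} → c ≗ d → Base c → Base d) → Chain adj Base τ n c
    predecessor root n q s (p , d , s′ , ch) resp =
      let (_ , q′) = chain-type root n ch in chain-resp adj resp n (parent C q′ q p s′ s) ch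

  module _ (G : Graph) (C : Cond (adj G)) where

    pt? : ∀ τ c → Dec (Pt (adj G) τ c)
    pt? τ c = all? λ i → all? λ j → (gadget τ i j ≟ᵇ true) →-dec (adj G (c i) (c j) ≟ᵇ true)

    chain? : ∀ {Base τ} → (∀ {c d} → c ≗ d → Base c → Base d) → (∀ c → Dec (Base c)) → ∀ n c →
        Dec (Chain (adj G) Base τ n c)
    chain? resp Base? zero    c = Base? c
    chain? {τ = τ} resp Base? (suc n) c = pt? τ c ×-dec
      any-function? 10 _ (λ {f} {g} e (s , ch) → step-resp (adj G) {f} {g} {c} {c} e (λ _ → refl) s
          , chain-resp (adj G) resp n e ch)
        (λ d → (adj G (d sourceRole) (c targetRole) ≟ᵇ true) ×-dec chain? resp Base? n d)

    timeAt? : ∀ n c → Dec (TimeAt (adj G) n c)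
    timeAt? = chain? (pt-resp (adj G)) (pt? τ₀)

    spaceAt? : ∀ n c → Dec (SpaceAt (adj G) n c)
    spaceAt? = chain? (pt-resp (adj G)) (pt? ι₀)

    digitAt? : ∀ k n c → Dec (DigitAt (adj G) k n c)
    digitAt? k = chain? (spaceAt-resp (adj G) k) (spaceAt? k)

    -- The points of a chain are disjoint, so a chain is no longer than the number of vertices.
    chain-bounded : ∀ {ρ τ} → ρ ≢ τ → ∀ n {c} → Chain (adj G) (Pt (adj G) ρ) τ n c → n < size G
    chain-bounded {ρ} {τ} ρ≢τ n {c} ch = injective⇒≤ {f = λ i → proj₁ (ancestor i) zero} λ {i} {j} eq →
      let (c , a) = ancestor i ; (d , b) = ancestor j
          (_ , p) = chain-type C root (toℕ i) a ; (_ , q) = chain-type C root (toℕ j) b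
          (_ , _ , same) = disjoint C p q eq
      in toℕ-injective (proj₁ (chain-unique C root root (toℕ i) (toℕ j) same a b))
      where
      root : Rooted C (Pt (adj G) ρ) τ
      root p = ρ , ρ≢τ , p
      above : ∀ n {c} → Chain (adj G) (Pt (adj G) ρ) τ n c → ∀ {m} → m ≤ n → ∃ λ d →
          Chain (adj G) (Pt (adj G) ρ) τ m d
      above n ch {m} le with m≤n⇒m<n∨m≡n le
      ... | inj₂ refl = _ , ch
      above (suc n) (_ , d , _ , ch) le | inj₁ (s≤s lt) = above n ch lt
      ancestor : (i : Fin (suc n)) → ∃ λ d → Chain (adj G) (Pt (adj G) ρ) τ (toℕ i) d
      ancestor i = above n ch (s≤s⁻¹ (toℕ<n i))

    -- `chain-bounded` leaves finitely many lengths to test. A point whose predecessors run round a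
    -- cycle has no length, so both answers occur.
    chainLength? : ∀ {ρ τ} → ρ ≢ τ → ∀ c → Dec (∃ λ n → Chain (adj G) (Pt (adj G) ρ) τ n c)
    chainLength? {ρ} ρ≢τ c = map′ (λ (n , ch) → toℕ n , ch)
      (λ (n , ch) → let lt = chain-bounded ρ≢τ n ch in
        fromℕ< lt , subst (λ n → Chain (adj G) _ _ n c) (sym (toℕ-fromℕ< lt)) ch)
      (any? {n = size G} λ n → chain? (pt-resp (adj G)) (pt? ρ) (toℕ n) c)

-- The input graph, the time line and the space line

≡ᵇ-sound : ∀ m n → (m ≡ᵇ n) ≡ true → m ≡ n
≡ᵇ-sound m n eq = ≡ᵇ⇒≡ m n (subst (λ b → T b) (sym eq) tt)

≡ᵇ-refl : ∀ n → (n ≡ᵇ n) ≡ true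
≡ᵇ-refl zero    = refl
≡ᵇ-refl (suc n) = ≡ᵇ-refl n

chainTy : Ty → Ty → ℕ → Ty
chainTy root next zero    = root
chainTy root next (suc _) = next

inputTy : ℕ → ℕ → Ty
inputTy n zero          = τ₀
inputTy n (suc zero)    = ι₀
inputTy n (suc (suc k)) = if k ≡ᵇ n then δ else ι₊

inputArc : ℕ → ℕ → Bool
inputArc zero    y = false
inputArc (suc x) y = suc (suc x) ≡ᵇ y

inputTy-space : ∀ n k → k ≤ n → inputTy n (suc k) ≡ chainTy ι₀ ι₊ k
inputTy-space n zero    le = refl
inputTy-space n (suc k) le with k ≡ᵇ n in eq
... | false = refl
... | true  with ≡ᵇ-sound k n eq
... | refl = ⊥-elim (<-irrefl refl le)

inputArc-typed : ∀ n x y → y < 3 + n → inputArc x y ≡ true → inputTy n x ⟶ inputTy n y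
inputArc-typed n (suc x) y lt eq with ≡ᵇ-sound (suc (suc x)) y eq
... | refl rewrite inputTy-space n x (s≤s⁻¹ (s≤s⁻¹ (s≤s⁻¹ lt))) = go x (x ≡ᵇ n)
  where
  go : ∀ k b → chainTy ι₀ ι₊ k ⟶ (if b then δ else ι₊)
  go zero    true  = ι₀δ
  go zero    false = ι₀ι₊
  go (suc k) true  = ι₊δ
  go (suc k) false = ι₊ι₊

inputArc-unique : ∀ x x′ y → inputArc x y ≡ true → inputArc x′ y ≡ true → x ≡ x′
inputArc-unique (suc x) (suc x′) y eq eq′ with ≡ᵇ-sound (suc (suc x)) y eq | ≡ᵇ-sound (suc (suc x′)) y eq′
... | refl | refl = refl

sucn≢ᵇn : ∀ n → (suc n ≡ᵇ n) ≢ true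
sucn≢ᵇn (suc n) eq = sucn≢ᵇn n eq

inputArc-irrefl : ∀ x → inputArc x x ≢ true
inputArc-irrefl (suc x) = sucn≢ᵇn x

-- Vertex 0 is an isolated time root; vertices 1, …, n + 1 are the cells 0, …, n of a space line and vertex n + 2 is a
-- digit of cell n.
inputStructure : ℕ → Structure
inputStructure n = record
  { card = 3 + n
  ; ty   = λ x → inputTy n (toℕ x)
  ; arc  = λ x y → inputArc (toℕ x) (toℕ y)
  ; arc-typed  = λ x y → inputArc-typed n (toℕ x) (toℕ y) (toℕ<n y)
  ; arc-unique = λ x x′ y a a′ → toℕ-injective (inputArc-unique (toℕ x) (toℕ x′) (toℕ y) a a′)
  ; arc-irrefl = λ x → inputArc-irrefl (toℕ x) }

inputGraph : ℕ → Graph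
inputGraph n = graphOf (inputStructure n)

timeStructure : ℕ → Structure
timeStructure N = record
  { card = suc N
  ; ty   = λ x → chainTy τ₀ τ₊ (toℕ x)
  ; arc  = λ x y → suc (toℕ x) ≡ᵇ toℕ y
  ; arc-typed  = λ x y a → typed (toℕ x) (toℕ y) (≡ᵇ-sound (suc (toℕ x)) (toℕ y) a)
  ; arc-unique = λ x x′ y a a′ →
      toℕ-injective (unique (toℕ x) (toℕ x′) (toℕ y) (≡ᵇ-sound (suc (toℕ x)) (toℕ y) a)
      (≡ᵇ-sound (suc (toℕ x′)) (toℕ y) a′))
  ; arc-irrefl = λ x → sucn≢ᵇn (toℕ x) }
  where
  typed : ∀ x y → suc x ≡ y → chainTy τ₀ τ₊ x ⟶ chainTy τ₀ τ₊ y
  typed zero    _ refl = τ₀τ₊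
  typed (suc x) _ refl = τ₊τ₊
  unique : ∀ x x′ y → suc x ≡ y → suc x′ ≡ y → x ≡ x′
  unique _ _ _ refl refl = refl

combTy : ℕ → ℕ → Ty
combTy k zero    = chainTy ι₀ ι₊ k
combTy k (suc j) = δ

combArc : ℕ → ℕ → ℕ → ℕ → Bool
combArc k zero    k′ zero     = suc k ≡ᵇ k′
combArc k (suc j) k′ zero     = false
combArc k j       k′ (suc j′) = (k ≡ᵇ k′) ∧ (j ≡ᵇ j′)

combArc-digit : ∀ k j k′ j′ → combArc k j k′ (suc j′) ≡ true → k ≡ k′ × j ≡ j′
combArc-digit k zero    k′ j′ eq with k ≡ᵇ k′ in p
... | true = ≡ᵇ-sound k k′ p , ≡ᵇ-sound 0 j′ eq
combArc-digit k (suc j) k′ j′ eq with k ≡ᵇ k′ in p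
... | true = ≡ᵇ-sound k k′ p , ≡ᵇ-sound (suc j) j′ eq

combArc-digit-refl : ∀ k j → combArc k j k (suc j) ≡ true
combArc-digit-refl k zero    rewrite ≡ᵇ-refl k = refl
combArc-digit-refl k (suc j) rewrite ≡ᵇ-refl k = ≡ᵇ-refl j

combArc-typed : ∀ k j k′ j′ → combArc k j k′ j′ ≡ true → combTy k j ⟶ combTy k′ j′
combArc-typed k zero k′ zero eq with ≡ᵇ-sound (suc k) k′ eq
combArc-typed zero    zero _ zero eq | refl = ι₀ι₊
combArc-typed (suc k) zero _ zero eq | refl = ι₊ι₊
combArc-typed k j k′ (suc j′) eq with combArc-digit k j k′ j′ eq
combArc-typed zero    zero    k′ (suc j′) eq | _ = ι₀δ
combArc-typed (suc k) zero    k′ (suc j′) eq | _ = ι₊δ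
combArc-typed k       (suc j) k′ (suc j′) eq | _ = δδ

combArc-unique : ∀ k j l m k′ j′ → combArc k j k′ j′ ≡ true → combArc l m k′ j′ ≡ true → k ≡ l × j ≡ m
combArc-unique k zero l zero k′ zero eq eq′ with ≡ᵇ-sound (suc k) k′ eq | ≡ᵇ-sound (suc l) k′ eq′
... | refl | refl = refl , refl
combArc-unique k j l m k′ (suc j′) eq eq′ with combArc-digit k j k′ j′ eq | combArc-digit l m k′ j′ eq′
... | refl , refl | refl , refl = refl , refl

combArc-irrefl : ∀ k j → combArc k j k j ≢ true
combArc-irrefl k zero    eq = sucn≢ᵇn k eq
combArc-irrefl k (suc j) eq with combArc-digit k (suc j) k j eq
... | _ , e = <-irrefl (sym e) ≤-refl

module _ (L N : ℕ) where

  cellOf digitOf : Fin (suc N * suc L) → ℕ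
  cellOf  x = toℕ (proj₁ (remQuot {suc N} (suc L) x))
  digitOf x = toℕ (proj₂ (remQuot {suc N} (suc L) x))

  spaceStructure : Structure
  spaceStructure = record
    { card = suc N * suc L
    ; ty   = λ x → combTy (cellOf x) (digitOf x)
    ; arc  = λ x y → combArc (cellOf x) (digitOf x) (cellOf y) (digitOf y)
    ; arc-typed  = λ x y → combArc-typed (cellOf x) (digitOf x) (cellOf y) (digitOf y)
    ; arc-unique = λ x x′ y a a′ →
        let (e , e′) = combArc-unique (cellOf x) (digitOf x) (cellOf x′) (digitOf x′) (cellOf y) (digitOf y) a a′ in
        remQuot-injective {suc N} (suc L) (cong₂ _,_ (toℕ-injective e) (toℕ-injective e′))
    ; arc-irrefl = λ x → combArc-irrefl (cellOf x) (digitOf x) }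

no-label-edge : ∀ M x y → x ≢ y → edge M (x , labelRole) (y , labelRole) ≡ false
no-label-edge M x y x≢y = ≢true⇒false λ e → go (edge-sound M (x , labelRole) (y , labelRole) e)
  where
  go : ¬ Edge M (x , labelRole) (y , labelRole)
  go (inner _) = x≢y refl

-- Amalgamation

does-sound : ∀ {A : Set} (a? : Dec A) → does a? ≡ true → A
does-sound (yes a) _ = a

∨-true : ∀ a {b} → a ∨ b ≡ true → a ≡ true ⊎ b ≡ true
∨-true true  _ = inj₁ refl
∨-true false e = inj₂ e

module Amalgam (L : ℕ) (W : Bool → Bool → (v v′ u u′ : Vec Bool L) → Set)
  (cell : ℕ → ℕ → Fin L → Bool)
  (W-cell : ∀ t k zt zi → (zt ≡ true → t ≡ 0) → (zi ≡ true → k ≡ 0) →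
            W zt zi (tabulate (cell t k)) (tabulate (cell t (suc k))) (tabulate (cell (suc t) k))
                (tabulate (cell (suc t) (suc k))))
  -- Serves the windows whose time or space cell has no position; such a window cannot begin at both
  -- roots, since a root has position 0.
  (W-blank : ∀ zt zi → (zt ≡ true → zi ≡ true → ⊥) →
             W zt zi (tabulate λ _ → false) (tabulate λ _ → false) (tabulate λ _ → false) (tabulate λ _ → false))
  (part : Bool → Graph) (part-cond : ∀ s → Class.Cond L W (adj (part s)))
  where
  open Class L W
  open Chains L W

  Vertex : Bool → Set
  Vertex s = Fin (size (part s))

  padj : ∀ s → Rel (Vertex s)
  padj s = adj (part s)

  record TimeLabel (s : Bool) (u : Vertex s) (t : ℕ) : Set where
    constructor timeLabel
    field
      point : Role → Vertex s
      chain : TimeAt (padj s) t point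
      at-u  : point labelRole ≡ u

  record DigitLabel (s : Bool) (u : Vertex s) (k j : ℕ) : Set where
    constructor digitLabel
    field
      point : Role → Vertex s
      chain : DigitAt (padj s) k (suc j) point
      at-u  : point labelRole ≡ u

  timeLabel? : ∀ s u t → Dec (TimeLabel s u t)
  timeLabel? s u t = map′ (λ (c , ch , eq) → timeLabel c ch eq) (λ (timeLabel c ch eq) → c , ch , eq)
    (any-function? 10 _ (λ e (ch , eq) → timeAt-resp (padj s) t e ch , trans (sym (e labelRole)) eq)
      (λ c → timeAt? (part s) (part-cond s) t c ×-dec (c labelRole ≟ u)))

  digitLabel? : ∀ s u k j → Dec (DigitLabel s u k j)
  digitLabel? s u k j = map′ (λ (c , ch , eq) → digitLabel c ch eq) (λ (digitLabel c ch eq) → c , ch , eq)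
    (any-function? 10 _ (λ e (ch , eq) → digitAt-resp (padj s) k (suc j) e ch , trans (sym (e labelRole)) eq)
      (λ c → digitAt? (part s) (part-cond s) k (suc j) c ×-dec (c labelRole ≟ u)))

  -- Positions range over numbers below the number of vertices, which `chain-bounded` justifies and
  -- which keeps the relation decidable.
  Labelled : ∀ s s′ → Vertex s → Vertex s′ → Set
  Labelled s s′ u v = ∃ λ (t : Vertex s) → ∃ λ (k : Vertex s′) → ∃ λ (j : Fin L) →
    TimeLabel s u (toℕ t) × DigitLabel s′ v (toℕ k) (toℕ j) × cell (toℕ t) (toℕ k) j ≡ true

  labelled? : ∀ s s′ u v → Dec (Labelled s s′ u v)
  labelled? s s′ u v = any? λ t → any? λ k → any? λ j →
    timeLabel? s u (toℕ t) ×-dec digitLabel? s′ v (toℕ k) (toℕ j) ×-dec (cell (toℕ t) (toℕ k) j ≟ᵇ true)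

  opaque
    -- the label edges from the time points of part s to the digit points of part s′
    half : ∀ s s′ → Vertex s → Vertex s′ → Bool
    half s s′ u v = does (labelled? s s′ u v)

    half-sound : ∀ s s′ u v → half s s′ u v ≡ true → Labelled s s′ u v
    half-sound s s′ u v = does-sound (labelled? s s′ u v)

    half-complete : ∀ s s′ u v → Labelled s s′ u v → half s s′ u v ≡ true
    half-complete s s′ u v = dec-true (labelled? s s′ u v)

  digitAt-base : ∀ s k n {c} → DigitAt (padj s) k n c → ∃ λ b → SpaceAt (padj s) k b
  digitAt-base s k zero    b                = _ , b
  digitAt-base s k (suc n) (_ , _ , _ , ch) = digitAt-base s k n ch

  -- Disjointness recovers a point from its label vertex and positions are unique, so no second
  -- reading of the same two vertices can contribute another label.
  half-cell : ∀ s s′ t k (j : Fin L) {c e} → TimeAt (padj s) t c → DigitAt (padj s′) k (suc (toℕ j)) e →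
              half s s′ (c labelRole) (e labelRole) ≡ cell t k j
  half-cell s s′ t k j {c} {e} ct ej = bool-ext to from
    where
    t< : t < size (part s)
    t< = chain-bounded (part s) (part-cond s) (λ ()) t ct
    k< : k < size (part s′)
    k< = chain-bounded (part s′) (part-cond s′) (λ ()) k (proj₂ (digitAt-base s′ k (suc (toℕ j)) ej))
    to : half s s′ (c labelRole) (e labelRole) ≡ true → cell t k j ≡ true
    to h with half-sound s s′ _ _ h
    ... | t′ , k′ , j′ , timeLabel c′ ct′ eq , digitLabel e′ ej′ eq′ , bit
      with disjoint (part-cond s) (proj₂ (proj₂ (timeAt-type (padj s) t ct)))
          (proj₂ (proj₂ (timeAt-type (padj s) (toℕ t′) ct′))) (sym eq)
         | disjoint (part-cond s′) (proj₁ ej) (proj₁ ej′) (sym eq′)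
    ... | _ , _ , same | _ , _ , same′
      with timeAt-unique (part-cond s) t (toℕ t′) same ct ct′
          | digitAt-unique (part-cond s′) k (toℕ k′) (suc (toℕ j)) (suc (toℕ j′)) same′ ej ej′
    ... | refl | refl , j≡j′ with toℕ-injective (suc-injective j≡j′)
    ... | refl = bit
    from : cell t k j ≡ true → half s s′ (c labelRole) (e labelRole) ≡ true
    from bit = half-complete s s′ _ _ (fromℕ< t< , fromℕ< k< , j
      , timeLabel c (subst (λ x → TimeAt (padj s) x c) (sym (toℕ-fromℕ< t<)) ct) refl
      , digitLabel e (subst (λ x → DigitAt (padj s′) x (suc (toℕ j)) e) (sym (toℕ-fromℕ< k<)) ej) refl
      , subst₂ (λ x y → cell x y j ≡ true) (sym (toℕ-fromℕ< t<)) (sym (toℕ-fromℕ< k<)) bit)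

  cross : ∀ s s′ → Vertex s → Vertex s′ → Bool
  cross s s′ u v = half s s′ u v ∨ half s′ s v u

  cross-sym : ∀ s s′ u v → cross s s′ u v ≡ cross s′ s v u
  cross-sym s s′ u v = ∨-comm (half s s′ u v) (half s′ s v u)

  timeLabel-point : ∀ s {u t} → TimeLabel s u t → ∃ λ τ → ∃ λ c → Time τ × Pt (padj s) τ c × c labelRole ≡ u
  timeLabel-point s {t = t} (timeLabel c ch eq) =
    let (τ , time , p) = timeAt-type (padj s) t ch in τ , c , time , p , eq

  no-time-digit : ∀ s {u t k j} → TimeLabel s u t → DigitLabel s u k j → ⊥
  no-time-digit s {u} tl (digitLabel d ch eq) with timeLabel-point s tl
  ... | τ , c , time , p , eq′ with disjoint (part-cond s) p (proj₁ ch) (trans eq′ (sym eq))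
  no-time-digit s {u} tl (digitLabel d ch eq) | _ , _ , () , _ | refl , _

  no-label-self : ∀ s {u v} → ∀ {τ τ′ c c′} → Pt (padj s) τ c → Pt (padj s) τ′ c′ → c labelRole ≡ u →
      c′ labelRole ≡ v →
                  padj s u v ≡ true → (Time τ → τ′ ≢ δ) → (Time τ′ → τ ≢ δ) → ⊥
  no-label-self s p p′ refl refl e n n′ with links (part-cond s) p p′ e
  ... | inj₁ (_ , g) = false≢true (gadget-irrefl _ labelRole) g
  ... | inj₂ (label→ t d) = n t d
  ... | inj₂ (label← t d) = n′ t d

  no-time-time : ∀ s {u v t t′} → TimeLabel s u t → TimeLabel s v t′ → padj s u v ≡ true → ⊥
  no-time-time s a b e with timeLabel-point s a | timeLabel-point s b
  ... | _ , _ , time , p , eq | _ , _ , time′ , p′ , eq′ =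
      no-label-self s p p′ eq eq′ e (λ _ → not-δ time′) (λ _ → not-δ time)
    where
    not-δ : ∀ {τ} → Time τ → τ ≢ δ
    not-δ () refl

  no-digit-digit : ∀ s {u v k j k′ j′} → DigitLabel s u k j → DigitLabel s v k′ j′ → padj s u v ≡ true → ⊥
  no-digit-digit s (digitLabel _ (p , _) eq) (digitLabel _ (p′ , _) eq′) e =
      no-label-self s p p′ eq eq′ e (λ ()) (λ ())

  -- No vertex is the label vertex of both a time and a digit, so the two neighbours of `v` are of
  -- the same kind, and label vertices of the same kind are never adjacent inside a part.
  cross-triangle : ∀ s s′ {u v w} → cross s s′ u v ≡ true → cross s s′ w v ≡ true → padj s u w ≡ true → ⊥
  cross-triangle s s′ {u} {v} {w} uv wv uw with ∨-true (half s s′ u v) uv | ∨-true (half s s′ w v) wv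
  ... | inj₁ a | inj₁ b with half-sound s s′ u v a | half-sound s s′ w v b
  ... | _ , _ , _ , ta , _ | _ , _ , _ , tb , _ = no-time-time s ta tb uw
  cross-triangle s s′ {u} {v} {w} uv wv uw | inj₁ a | inj₂ b with half-sound s s′ u v a | half-sound s′ s v w b
  ... | _ , _ , _ , _ , da , _ | _ , _ , _ , tb , _ = no-time-digit s′ tb da
  cross-triangle s s′ {u} {v} {w} uv wv uw | inj₂ a | inj₁ b with half-sound s′ s v u a | half-sound s s′ w v b
  ... | _ , _ , _ , ta , _ | _ , _ , _ , _ , db , _ = no-time-digit s′ ta db
  cross-triangle s s′ {u} {v} {w} uv wv uw | inj₂ a | inj₂ b with half-sound s′ s v u a | half-sound s′ s v w b
  ... | _ , _ , _ , _ , da , _ | _ , _ , _ , _ , db , _ = no-digit-digit s da db uw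

  cross-link : ∀ s s′ {τ τ′ c d i j} → Pt (padj s) τ c → Pt (padj s′) τ′ d → cross s s′ (c i) (d j) ≡ true →
               i ≡ labelRole × Link τ τ′ i j
  cross-link s s′ {τ} {τ′} {c} {d} {i} {j} p q e with ∨-true (half s s′ (c i) (d j)) e
  ... | inj₁ h with half-sound s s′ _ _ h
  ... | _ , _ , _ , tl , digitLabel _ (q′ , _) eq′ , _ with timeLabel-point s tl
  ... | _ , _ , time , p′ , eq with disjoint (part-cond s) p p′ (sym eq) | disjoint (part-cond s′) q q′ (sym eq′)
  ... | refl , refl , _ | refl , refl , _ = refl , label→ time refl
  cross-link s s′ {τ} {τ′} {c} {d} {i} {j} p q e | inj₂ h with half-sound s′ s _ _ h
  ... | _ , _ , _ , tl , digitLabel _ (p′ , _) eq , _ with timeLabel-point s′ tl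
  ... | _ , _ , time , q′ , eq′ with disjoint (part-cond s) p p′ (sym eq) | disjoint (part-cond s′) q q′ (sym eq′)
  ... | refl , refl , _ | refl , refl , _ = refl , label← time refl

  Sum : Set
  Sum = Σ Bool Vertex

  fibre : ∀ {s} (u : Sum) → proj₁ u ≡ s → ∃ λ v → u ≡ (s , v)
  fibre (_ , v) refl = v , refl

  opaque
    sumAdj : Rel Sum
    sumAdj (true  , u) (true  , v) = padj true u v
    sumAdj (false , u) (false , v) = padj false u v
    sumAdj (true  , u) (false , v) = cross true false u v
    sumAdj (false , u) (true  , v) = cross false true u v

    sumAdj-same : ∀ s u v → sumAdj (s , u) (s , v) ≡ padj s u v
    sumAdj-same true  u v = refl
    sumAdj-same false u v = refl

    sumAdj-cross : ∀ s s′ u v → s ≢ s′ → sumAdj (s , u) (s′ , v) ≡ cross s s′ u v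
    sumAdj-cross true  true  u v n = ⊥-elim (n refl)
    sumAdj-cross false false u v n = ⊥-elim (n refl)
    sumAdj-cross true  false u v n = refl
    sumAdj-cross false true  u v n = refl

    sumAdj-sym : ∀ u v → sumAdj u v ≡ sumAdj v u
    sumAdj-sym (true  , u) (true  , v) = symm (part true) u v
    sumAdj-sym (false , u) (false , v) = symm (part false) u v
    sumAdj-sym (true  , u) (false , v) = cross-sym true false u v
    sumAdj-sym (false , u) (true  , v) = cross-sym false true u v

    sumAdj-irrefl : ∀ u → sumAdj u u ≡ false
    sumAdj-irrefl (true  , u) = irrefl (part true) u
    sumAdj-irrefl (false , u) = irrefl (part false) u

    -- Confines triangles, and through `core-connected` whole points, to one part.
    sum-triangle : ∀ u v w → sumAdj u v ≡ true → sumAdj u w ≡ true → sumAdj v w ≡ true → proj₁ u ≡ proj₁ v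
    sum-triangle (true  , u) (true  , v) w _ _ _ = refl
    sum-triangle (false , u) (false , v) w _ _ _ = refl
    sum-triangle (true  , u) (false , v) (true  , w) uv uw vw =
        ⊥-elim (cross-triangle true false uv (trans (cross-sym true false w v) vw) uw)
    sum-triangle (true  , u) (false , v) (false , w) uv uw vw =
        ⊥-elim (cross-triangle false true (trans (cross-sym false true v u) uv)
        (trans (cross-sym false true w u) uw) vw)
    sum-triangle (false , u) (true  , v) (false , w) uv uw vw =
        ⊥-elim (cross-triangle false true uv (trans (cross-sym false true w v) vw) uw)
    sum-triangle (false , u) (true  , v) (true  , w) uv uw vw =
        ⊥-elim (cross-triangle true false (trans (cross-sym true false v u) uv)
        (trans (cross-sym true false w u) uw) vw)

  lower : ∀ {s} {c : Role → Sum} → (∀ i → proj₁ (c i) ≡ s) → Σ (Role → Vertex s) λ c′ → ∀ i → c i ≡ (s , c′ i)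
  lower {s} {c} at = (λ i → proj₁ (fibre (c i) (at i))) , λ i → proj₂ (fibre (c i) (at i))

  point-side : ∀ {τ c} → Pt sumAdj τ c → ∀ i → proj₁ (c i) ≡ proj₁ (c zero)
  point-side {τ} {c} p = core-connected sumAdj proj₁ sum-triangle c λ i j h → p i j (gadget-core τ i j h)

  pt-down : ∀ {s τ} {c : Role → Sum} {c′ : Role → Vertex s} → (∀ i → c i ≡ (s , c′ i)) → Pt sumAdj τ c →
      Pt (padj s) τ c′
  pt-down {s} eq p i j g = trans (sym (sumAdj-same s _ _)) (trans (cong₂ sumAdj (sym (eq i)) (sym (eq j))) (p i j g))

  record On (τ : Ty) (c : Role → Sum) : Set where
    constructor on
    field
      side  : Bool
      under : Role → Vertex side
      pt    : Pt (padj side) τ under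
      eq    : ∀ i → c i ≡ (side , under i)
  open On public using (side)

  on-side : ∀ {τ c} → Pt sumAdj τ c → On τ c
  on-side {τ} {c} p =
    let (c′ , eq) = lower {c = c} (point-side {c = c} p)
    in on (proj₁ (c zero)) c′ (pt-down {c = c} {c′} eq p) eq

  Σ-injective : ∀ {s s′ u v} → _≡_ {A = Sum} (s , u) (s′ , v) → Σ (s ≡ s′) λ p → subst Vertex p u ≡ v
  Σ-injective refl = refl , refl

  sum-disjoint : ∀ {τ τ′ c d i j} → On τ c → On τ′ d → c i ≡ d j → τ ≡ τ′ × i ≡ j × c ≗ d
  sum-disjoint {i = i} {j} (on s c′ p eq) (on s′ d′ q eq′) h with Σ-injective (trans (sym (eq i)) (trans h (eq′ j)))
  ... | refl , h′ with disjoint (part-cond s) p q h′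
  ... | a , b , same = a , b , λ k → trans (eq k) (trans (cong (s ,_) (same k)) (sym (eq′ k)))

  sum-links : ∀ {τ τ′ c d i j} → On τ c → On τ′ d → sumAdj (c i) (d j) ≡ true → (c ≗ d × gadget τ i j ≡ true)
      ⊎ Link τ τ′ i j
  sum-links {i = i} {j} (on s c′ p eq) (on s′ d′ q eq′) h with s ≟ᵇ s′
      | trans (cong₂ sumAdj (sym (eq i)) (sym (eq′ j))) h
  ... | no s≢s′ | h′ = inj₂ (proj₂ (cross-link s s′ p q (trans (sym (sumAdj-cross s s′ _ _ s≢s′)) h′)))
  ... | yes refl | h′ with links (part-cond s) p q (trans (sym (sumAdj-same s _ _)) h′)
  ... | inj₂ l = inj₂ l
  ... | inj₁ (same , g) = inj₁ ((λ k → trans (eq k) (trans (cong (s ,_) (same k)) (sym (eq′ k)))) , g)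

  -- Cross edges join label roles only, so a step stays on one side.
  sum-step : ∀ {τ τ′ c d} (o : On τ c) → Pt sumAdj τ′ d → Step sumAdj c d →
             Σ (Role → Vertex (side o)) λ d′ → Pt (padj (side o)) τ′ d′ × (∀ i → d i ≡ (side o , d′ i))
                 × Step (padj (side o)) (On.under o) d′
  sum-step (on s c′ p eq) pd h with on-side pd
  ... | on s′ d′ q eq′ with s ≟ᵇ s′ | trans (cong₂ sumAdj (sym (eq sourceRole)) (sym (eq′ targetRole))) h
  ... | yes refl | h′ = d′ , q , eq′ , trans (sym (sumAdj-same s _ _)) h′
  ... | no s≢s′ | h′ with cross-link s s′ p q (trans (sym (sumAdj-cross s s′ _ _ s≢s′)) h′)
  ... | () , _

  pair-injective : ∀ {s u v} → _≡_ {A = Sum} (s , u) (s , v) → u ≡ v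
  pair-injective refl = refl

  sum-parent : ∀ {τ τ′ υ c c′ d} → On τ c → On τ′ c′ → Pt sumAdj υ d → Step sumAdj c d → Step sumAdj c′ d → c ≗ c′
  sum-parent o@(on s c p eq) o′@(on s′ c′ p′ eq′) pd h h′ with sum-step o pd h | sum-step o′ pd h′
  ... | d , q , eqd , st | d′ , q′ , eqd′ , st′ with Σ-injective (trans (sym (eqd zero)) (eqd′ zero))
  ... | refl , _ = λ i →
      trans (eq i) (trans (cong (s ,_) (parent (part-cond s) {c = c} {c′} {d} p p′ q st st″ i)) (sym (eq′ i)))
    where
    st″ : Step (padj s) c′ d
    st″ = trans (cong (padj s (c′ sourceRole)) (pair-injective (trans (sym (eqd targetRole)) (eqd′ targetRole)))) st′

  -- Windows of the amalgam

  halfBits : ∀ s s′ → (Role → Vertex s) → Comb (Vertex s′) → Vec Bool L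
  halfBits s s′ t e = tabulate λ j → half s s′ (t labelRole) (e (suc j) labelRole)

  record TimeSide (s : Bool) (zt : Bool) (t t′ : Role → Vertex s) : Set where
    constructor timeSide
    field
      pt  : Pt (padj s) (timeTy zt) t
      pt′ : Pt (padj s) τ₊ t′
      st  : Step (padj s) t t′

  record SpaceSide (s : Bool) (zi : Bool) (e e′ : Comb (Vertex s)) : Set where
    constructor spaceSide
    field
      pt  : Pt (padj s) (spaceTy zi) (e zero)
      pt′ : Pt (padj s) ι₊ (e′ zero)
      st  : Step (padj s) (e zero) (e′ zero)
      dg  : ∀ j → Pt (padj s) δ (e (suc j))
      dg′ : ∀ j → Pt (padj s) δ (e′ (suc j))
      th  : ∀ j → Step (padj s) (e (inject₁ j)) (e (suc j))
      th′ : ∀ j → Step (padj s) (e′ (inject₁ j)) (e′ (suc j))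

  module _ (s : Bool) where
    private
      C : Cond (padj s)
      C = part-cond s

    comb-chain : ∀ k {e : Comb (Vertex s)} → SpaceAt (padj s) k (e zero) → (∀ j → Pt (padj s) δ (e (suc j))) →
                 (∀ j → Step (padj s) (e (inject₁ j)) (e (suc j))) → ∀ (j : Fin (suc L)) →
                     DigitAt (padj s) k (toℕ j) (e j)
    comb-chain k {e} base dg th = <-weakInduction (λ j → DigitAt (padj s) k (toℕ j) (e j)) base
      λ j ch → dg j , e (inject₁ j) , th j , subst (λ n → DigitAt (padj s) k n (e (inject₁ j))) (toℕ-inject₁ j) ch

    -- Both the comb and the chain are walked back together by unique predecessors. Types keep them
    -- in step: a digit cannot sit at length zero, nor a space cell at a positive length.
    comb-base : ∀ {zi} {e : Comb (Vertex s)} → Pt (padj s) (spaceTy zi) (e zero) → (∀ j → Pt (padj s) δ (e (suc j))) →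
                (∀ j → Step (padj s) (e (inject₁ j)) (e (suc j))) →
                ∀ (j : Fin (suc L)) k n → DigitAt (padj s) k n (e j) → SpaceAt (padj s) k (e zero)
    comb-base {zi} {e} p dg th =
        <-weakInduction (λ j → ∀ k n → DigitAt (padj s) k n (e j) → SpaceAt (padj s) k (e zero)) at-main at-digit
      where
      no-δ : ∀ zi → spaceTy zi ≢ δ
      no-δ true  ()
      no-δ false ()
      main-type : ∀ j → ∃ λ σ → Pt (padj s) σ (e j)
      main-type zero    = _ , p
      main-type (suc j) = _ , dg j
      at-main : ∀ k n → DigitAt (padj s) k n (e zero) → SpaceAt (padj s) k (e zero)
      at-main k zero    b       = b
      at-main k (suc n) (q , _) = ⊥-elim (no-δ zi (proj₁ (disjoint C {i = zero} {zero} p q refl)))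
      at-digit : ∀ j → (∀ k n → DigitAt (padj s) k n (e (inject₁ j)) → SpaceAt (padj s) k (e zero)) →
                 ∀ k n → DigitAt (padj s) k n (e (suc j)) → SpaceAt (padj s) k (e zero)
      at-digit j ih k zero b =
        let (_ , ≢δ , q) =
                spaceAt-type (padj s) k b in ⊥-elim (≢δ (proj₁ (disjoint C {i = zero} {zero} q (dg j) refl)))
      at-digit j ih k (suc n) ch =
        ih k n (predecessor C (spaceAt-type (padj s) k) n {e (inject₁ j)} {e (suc j)} (proj₂ (main-type (inject₁ j)))
            (th j) ch (spaceAt-resp (padj s) k))

    time-next : ∀ {zt t t′} → TimeSide s zt t t′ → ∀ n → TimeAt (padj s) n t → TimeAt (padj s) (suc n) t′
    time-next (timeSide _ pt′ st) n ch = pt′ , _ , st , ch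

    time-prev : ∀ {zt t t′} → TimeSide s zt t t′ → ∀ n → TimeAt (padj s) n t′ → ∃ λ m → TimeAt (padj s) m t
    time-prev (timeSide _ pt′ _) zero p with disjoint C {i = zero} {zero} pt′ p refl
    ... | () , _
    time-prev {t = t} {t′} (timeSide pt _ st) (suc n) ch =
        n , predecessor C {Base = Pt (padj s) τ₀} (λ p → τ₀ , (λ ()) , p) n {t} {t′} pt st ch (pt-resp (padj s))

    space-prev : ∀ {zi e e′} → SpaceSide s zi e e′ → ∀ n → SpaceAt (padj s) n (e′ zero) → ∃ λ m →
        SpaceAt (padj s) m (e zero)
    space-prev σ zero p with disjoint C {i = zero} {zero} (SpaceSide.pt′ σ) p refl
    ... | () , _
    space-prev {e = e} {e′} σ (suc n) ch =
        n , predecessor C {Base = Pt (padj s) ι₀} (λ p → ι₀ , (λ ()) , p) n {e zero} {e′ zero} (SpaceSide.pt σ)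
        (SpaceSide.st σ) ch (pt-resp (padj s))

    time-start : ∀ {zt t t′} → TimeSide s zt t t′ → zt ≡ true → TimeAt (padj s) 0 t
    time-start (timeSide pt _ _) refl = pt

    space-start : ∀ {zi e e′} → SpaceSide s zi e e′ → zi ≡ true → SpaceAt (padj s) 0 (e zero)
    space-start σ refl = SpaceSide.pt σ

  half-digit : ∀ s s′ {c e} → half s s′ (c labelRole) (e labelRole) ≡ true → ∀ {τ τ′} → Pt (padj s) τ c →
      Pt (padj s′) τ′ e →
               (∃ λ t → TimeAt (padj s) t c) × (∃ λ k → ∃ λ j → DigitAt (padj s′) k j e)
  half-digit s s′ {c₀} {e₀} h p q with half-sound s s′ _ _ h
  ... | t , k , j , timeLabel c ch eq , digitLabel e ch′ eq′ , _
    with disjoint (part-cond s) {c = c} {c₀} {labelRole} {labelRole}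
        (proj₂ (proj₂ (timeAt-type (padj s) (toℕ t) ch))) p eq
        | disjoint (part-cond s′) {c = e} {e₀} {labelRole} {labelRole} (proj₁ ch′) q eq′
  ... | _ , _ , same | _ , _ , same′ =
    (toℕ t , timeAt-resp (padj s) (toℕ t) same ch)
        , (toℕ k , suc (toℕ j) , digitAt-resp (padj s′) (toℕ k) (suc (toℕ j)) same′ ch′)

  W-back : ∀ zt zi {v v′ u u′ x x′ y y′} → x ≡ v → x′ ≡ v′ → y ≡ u → y′ ≡ u′ → W zt zi v v′ u u′ → W zt zi x x′ y y′
  W-back zt zi e e′ f f′ = W-resp zt zi (sym e) (sym e′) (sym f) (sym f′)

  -- If `t` and `e zero` both have positions, the four label vectors are those of `cell`. Otherwise
  -- all four are blank: a label requires positions of its time and its digit, and these would pass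
  -- back along ticks, shifts and teeth to `t` and `e zero`.
  half-window : ∀ s s′ {zt zi t t′ e e′} → TimeSide s zt t t′ → SpaceSide s′ zi e e′ →
                W zt zi (halfBits s s′ t e) (halfBits s s′ t e′) (halfBits s s′ t′ e) (halfBits s s′ t′ e′)
  half-window s s′ {zt} {zi} {t} {t′} {e} {e′} θ σ
    with chainLength? (part s) (part-cond s) (λ ()) t | chainLength? (part s′) (part-cond s′) (λ ()) (e zero)
  ... | yes (n , ch) | yes (k , ch′) =
    W-back zt zi (cells n k {t} {e} ch row) (cells n (suc k) {t} {e′} ch row′)
      (cells (suc n) k {t′} {e} ch⁺ row)
      (cells (suc n) (suc k) {t′} {e′} ch⁺ row′)
      (W-cell n k zt zi (λ z → timeAt-unique (part-cond s) n 0 {t} {t} (λ _ → refl) ch (time-start s {t′ = t′} θ z))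
                        (λ z → spaceAt-unique (part-cond s′) k 0 {e zero} {e zero} (λ _ → refl) ch′
                            (space-start s′ σ z)))
    where
    open SpaceSide σ
    cells : ∀ n k {t e} → TimeAt (padj s) n t → (∀ (j : Fin (suc L)) → DigitAt (padj s′) k (toℕ j) (e j)) →
            halfBits s s′ t e ≡ tabulate (cell n k)
    cells n k {t} {e} ch chs = tabulate-cong λ j → half-cell s s′ n k j {t} {e (suc j)} ch (chs (suc j))
    row : ∀ j → DigitAt (padj s′) k (toℕ j) (e j)
    row = comb-chain s′ k ch′ dg th
    row′ : ∀ j → DigitAt (padj s′) (suc k) (toℕ j) (e′ j)
    row′ = comb-chain s′ (suc k) (pt′ , e zero , st , ch′) dg′ th′
    ch⁺ : TimeAt (padj s) (suc n) t′
    ch⁺ = time-next s {zt} θ n ch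
  ... | no ¬ch | _ =
      W-back zt zi (blank t e (TimeSide.pt θ) ¬ch dg) (blank t e′ (TimeSide.pt θ) ¬ch dg′) (blank′ e dg)
      (blank′ e′ dg′)
      (W-blank zt zi λ z _ → ¬ch (0 , time-start s θ z))
    where
    open SpaceSide σ hiding (pt; pt′; st)
    blank : ∀ t e {τ} → Pt (padj s) τ t → ¬ (∃ λ n → TimeAt (padj s) n t) → (∀ j → Pt (padj s′) δ (e (suc j))) →
        halfBits s s′ t e ≡ tabulate λ _ → false
    blank t e p ¬ch dg =
        tabulate-cong λ j → ≢true⇒false λ h → ¬ch (proj₁ (half-digit s s′ {t} {e (suc j)} h p (dg j)))
    blank′ : ∀ e → (∀ j → Pt (padj s′) δ (e (suc j))) → halfBits s s′ t′ e ≡ tabulate λ _ → false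
    blank′ e dg = blank t′ e (TimeSide.pt′ θ) (λ (n , ch) → ¬ch (time-prev s {zt} θ n ch)) dg
  ... | yes _ | no ¬ch =
      W-back zt zi (blank t (TimeSide.pt θ)) (blank-next t (TimeSide.pt θ)) (blank t′ (TimeSide.pt′ θ))
      (blank-next t′ (TimeSide.pt′ θ))
      (W-blank zt zi λ _ z → ¬ch (0 , space-start s′ σ z))
    where
    open SpaceSide σ
    blank : ∀ t {τ} → Pt (padj s) τ t → halfBits s s′ t e ≡ tabulate λ _ → false
    blank t p = tabulate-cong λ j → ≢true⇒false λ h →
      let (k , n , ch) =
              proj₂ (half-digit s s′ {t} {e (suc j)} h p (dg j)) in ¬ch
              (k , comb-base s′ {zi} {e} pt dg th (suc j) k n ch)
    blank-next : ∀ t {τ} → Pt (padj s) τ t → halfBits s s′ t e′ ≡ tabulate λ _ → false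
    blank-next t p = tabulate-cong λ j → ≢true⇒false λ h →
      let (k , n , ch) = proj₂ (half-digit s s′ {t} {e′ (suc j)} h p (dg′ j))
      in ¬ch (space-prev s′ σ k (comb-base s′ {false} {e′} pt′ dg′ th′ (suc j) k n ch))

  step-side : ∀ {τ τ′ c d} → Pt sumAdj τ c → Pt sumAdj τ′ d → Step sumAdj c d → proj₁ (d zero) ≡ proj₁ (c zero)
  step-side p q h with on-side p
  ... | o@(on s c′ p′ eq) with sum-step o q h
  ... | _ , _ , eq′ , _ = trans (cong proj₁ (eq′ zero)) (sym (cong proj₁ (eq zero)))

  step-down : ∀ {s} {c d : Role → Sum} {c′ d′ : Role → Vertex s} → (∀ i → c i ≡ (s , c′ i)) →
      (∀ i → d i ≡ (s , d′ i)) → Step sumAdj c d → Step (padj s) c′ d′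
  step-down {s} eq eq′ h =
      trans (sym (sumAdj-same s _ _)) (trans (cong₂ sumAdj (sym (eq sourceRole)) (sym (eq′ targetRole))) h)

  comb-side : ∀ {τ} {e : Comb Sum} → Pt sumAdj τ (e zero) → (∀ j → Pt sumAdj δ (e (suc j))) →
              (∀ j → Step sumAdj (e (inject₁ j)) (e (suc j))) → ∀ j i → proj₁ (e j i) ≡ proj₁ (e zero zero)
  comb-side {τ} {e} p dg th j i = trans (point-side (proj₂ (typed j)) i) (along j)
    where
    typed : ∀ j → ∃ λ σ → Pt sumAdj σ (e j)
    typed zero    = τ , p
    typed (suc j) = δ , dg j
    along : ∀ j → proj₁ (e j zero) ≡ proj₁ (e zero zero)
    along = <-weakInduction (λ j → proj₁ (e j zero) ≡ proj₁ (e zero zero)) refl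
      λ j ih → trans (step-side {c = e (inject₁ j)} {e (suc j)} (proj₂ (typed (inject₁ j))) (dg j) (th j)) ih

  LowerComb : ∀ {s} → Comb Sum → Comb (Vertex s) → Set
  LowerComb {s} e e₀ = ∀ j i → e j i ≡ (s , e₀ j i)

  sum-bits : ∀ {s s′} {t : Role → Sum} {t₀ : Role → Vertex s} {e e₀} → (∀ i → t i ≡ (s , t₀ i)) →
      LowerComb {s′} e e₀ →
             bits sumAdj t e ≡ tabulate λ j → sumAdj (s , t₀ labelRole) (s′ , e₀ (suc j) labelRole)
  sum-bits eq eq′ = tabulate-cong λ j → cong₂ sumAdj (eq labelRole) (eq′ (suc j) labelRole)

  same-bits : ∀ s {t t₀ e e₀} → (∀ i → t i ≡ (s , t₀ i)) → LowerComb {s} e e₀ → bits sumAdj t e ≡ bits (padj s) t₀ e₀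
  same-bits s {t} {t₀} {e} {e₀} eq low =
      trans (sum-bits {s} {s} {t} {t₀} {e} {e₀} eq low) (tabulate-cong λ j →
      sumAdj-same s (t₀ labelRole) (e₀ (suc j) labelRole))

  no-half : ∀ s s′ {τ t₀ u} → Pt (padj s) τ t₀ → Time τ → half s′ s u (t₀ labelRole) ≢ true
  no-half s s′ {t₀ = t₀} {u} p time h with half-sound s′ s u (t₀ labelRole) h
  ... | _ , _ , _ , _ , digitLabel d (q , _) eq
      , _ with disjoint (part-cond s) {c = d} {t₀} {labelRole} {labelRole} q p eq
  no-half s s′ p () h | _ , _ , _ , _ , digitLabel _ (q , _) eq , _ | refl , _

  -- Of the two halves of `cross` only one can contribute, because the label vertex of a time is not
  -- that of a digit.
  cross-bits : ∀ s s′ {τ t t₀ e e₀} → s ≢ s′ → Pt (padj s) τ t₀ → Time τ → (∀ i → t i ≡ (s , t₀ i)) →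
      LowerComb {s′} e e₀ →
               bits sumAdj t e ≡ halfBits s s′ t₀ e₀
  cross-bits s s′ {t = t} {t₀} {e} {e₀} s≢s′ p time eq low =
      trans (sum-bits {s} {s′} {t} {t₀} {e} {e₀} eq low) (tabulate-cong λ j →
    trans (sumAdj-cross s s′ (t₀ labelRole) (e₀ (suc j) labelRole) s≢s′)
    (trans (cong (half s s′ (t₀ labelRole) (e₀ (suc j) labelRole) ∨_)
        (≢true⇒false (no-half s s′ {t₀ = t₀} {e₀ (suc j) labelRole} p time))) (∨-identityʳ _)))

  sum-window : ∀ s s′ {zt zi t t′ e e′ t₀ t₀′ e₀ e₀′} →
    (∀ i → t i ≡ (s , t₀ i)) → (∀ i → t′ i ≡ (s , t₀′ i)) → LowerComb {s′} e e₀ → LowerComb {s′} e′ e₀′ →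
    TimeSide s zt t₀ t₀′ → SpaceSide s′ zi e₀ e₀′ →
    W zt zi (bits sumAdj t e) (bits sumAdj t e′) (bits sumAdj t′ e) (bits sumAdj t′ e′)
  sum-window s s′ {zt} {zi} {t} {t′} {e} {e′} {t₀} {t₀′} {e₀} {e₀′} eq eq′ low low′ θ σ with s ≟ᵇ s′
  ... | yes refl = W-back zt zi
      (same-bits s {t} {t₀} {e} {e₀} eq low) (same-bits s {t} {t₀} {e′} {e₀′} eq low′)
      (same-bits s {t′} {t₀′} {e} {e₀} eq′ low) (same-bits s {t′} {t₀′} {e′} {e₀′} eq′ low′)
      (windows (part-cond s) {zt} {zi} {t₀} {t₀′} {e₀} {e₀′} (record
      { time = TimeSide.pt θ ; time′ = TimeSide.pt′ θ ; tick = TimeSide.st θ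
      ; space = SpaceSide.pt σ ; space′ = SpaceSide.pt′ σ ; shift = SpaceSide.st σ ; digit = SpaceSide.dg σ ; digit′ =
          SpaceSide.dg′ σ
      ; tooth = SpaceSide.th σ ; tooth′ = SpaceSide.th′ σ }))
  ... | no s≢s′ = W-back zt zi
      (cross-bits s s′ {t = t} {t₀} {e} {e₀} s≢s′ (TimeSide.pt θ) (timeTy-time zt) eq low)
      (cross-bits s s′ {t = t} {t₀} {e′} {e₀′} s≢s′ (TimeSide.pt θ) (timeTy-time zt) eq low′)
      (cross-bits s s′ {t = t′} {t₀′} {e} {e₀} s≢s′ (TimeSide.pt′ θ) τ₊ eq′ low)
      (cross-bits s s′ {t = t′} {t₀′} {e′} {e₀′} s≢s′ (TimeSide.pt′ θ) τ₊ eq′ low′)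
      (half-window s s′ θ σ)
    where
    timeTy-time : ∀ zt → Time (timeTy zt)
    timeTy-time true  = τ₀
    timeTy-time false = τ₊

  -- Steps never cross between the parts, so the two times share a side and the two combs share a
  -- side. It remains to compare these two sides.
  sum-windows : ∀ {zt zi t t′ e e′} → Window sumAdj zt zi t t′ e e′ →
                W zt zi (bits sumAdj t e) (bits sumAdj t e′) (bits sumAdj t′ e) (bits sumAdj t′ e′)
  sum-windows {zt} {zi} {t} {t′} {e} {e′} w =
    sum-window s s′ {zt} {zi} {t} {t′} {e} {e′} {T₀} {T₀′} {E} {E′} eqt eqt′ eqe eqe′
      (timeSide (pt-down {c = t} {T₀} eqt (time w)) (pt-down {c = t′} {T₀′} eqt′ (time′ w))
          (step-down {c = t} {t′} {T₀} {T₀′} eqt eqt′ (tick w)))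
      (spaceSide (pt-down {c = e zero} {E zero} (eqe zero) (space w))
          (pt-down {c = e′ zero} {E′ zero} (eqe′ zero) (space′ w))
        (step-down {c = e zero} {e′ zero} {E zero} {E′ zero} (eqe zero) (eqe′ zero) (shift w))
        (λ j → pt-down {c = e (suc j)} {E (suc j)} (eqe (suc j)) (digit w j))
            (λ j → pt-down {c = e′ (suc j)} {E′ (suc j)} (eqe′ (suc j)) (digit′ w j))
        (λ j → step-down {c = e (inject₁ j)} {e (suc j)} {E (inject₁ j)} {E (suc j)} (eqe (inject₁ j)) (eqe (suc j))
            (tooth w j))
        (λ j → step-down {c = e′ (inject₁ j)} {e′ (suc j)} {E′ (inject₁ j)} {E′ (suc j)} (eqe′ (inject₁ j))
            (eqe′ (suc j)) (tooth′ w j)))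
    where
    s s′ : Bool
    s  = proj₁ (t zero)
    s′ = proj₁ (e zero zero)
    at : ∀ i → proj₁ (t i) ≡ s
    at = point-side {c = t} (time w)
    at′ : ∀ i → proj₁ (t′ i) ≡ s
    at′ i = trans (point-side {c = t′} (time′ w) i) (step-side {c = t} {t′} (time w) (time′ w) (tick w))
    ate : ∀ j i → proj₁ (e j i) ≡ s′
    ate = comb-side {e = e} (space w) (digit w) (tooth w)
    ate′ : ∀ j i → proj₁ (e′ j i) ≡ s′
    ate′ j i = trans (comb-side {e = e′} (space′ w) (digit′ w) (tooth′ w) j i)
        (step-side {c = e zero} {e′ zero} (space w) (space′ w) (shift w))
    T₀ T₀′ : Role → Vertex s
    T₀  = proj₁ (lower {s} {t} at)
    T₀′ = proj₁ (lower {s} {t′} at′)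
    E E′ : Comb (Vertex s′)
    E  j = proj₁ (lower {s′} {e j} (ate j))
    E′ j = proj₁ (lower {s′} {e′ j} (ate′ j))
    eqt : ∀ i → t i ≡ (s , T₀ i)
    eqt = proj₂ (lower {s} {t} at)
    eqt′ : ∀ i → t′ i ≡ (s , T₀′ i)
    eqt′ = proj₂ (lower {s} {t′} at′)
    eqe : LowerComb {s′} e E
    eqe j = proj₂ (lower {s′} {e j} (ate j))
    eqe′ : LowerComb {s′} e′ E′
    eqe′ j = proj₂ (lower {s′} {e′ j} (ate′ j))

  sum-cond : Cond sumAdj
  sum-cond = record
    { disjoint = λ p q → sum-disjoint (on-side p) (on-side q)
    ; links    = λ p q → sum-links (on-side p) (on-side q)
    ; parent   = λ p p′ q → sum-parent (on-side p) (on-side p′) q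
    ; windows  = sum-windows }

  -- The amalgam as a numbered graph

  a b : ℕ
  a = size (part true)
  b = size (part false)

  unsplit : Fin a ⊎ Fin b → Sum
  unsplit = [ (true ,_) , (false ,_) ]′

  sumVertex : Fin (a + b) → Sum
  sumVertex u = unsplit (splitAt a u)

  sumVertex-injective : Injective _≡_ _≡_ sumVertex
  sumVertex-injective {u} {v} eq =
      trans (sym (join-splitAt a b u))
      (trans (cong (join a b) (unsplit-injective (splitAt a u) (splitAt a v) eq)) (join-splitAt a b v))
    where
    unsplit-injective : ∀ x y → unsplit x ≡ unsplit y → x ≡ y
    unsplit-injective (inj₁ _) (inj₁ _) refl = refl
    unsplit-injective (inj₂ _) (inj₂ _) refl = refl

  amalgam : Graph
  amalgam = record
    { size   = a + b
    ; adj    = λ u v → sumAdj (sumVertex u) (sumVertex v)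
    ; symm   = λ u v → sumAdj-sym (sumVertex u) (sumVertex v)
    ; irrefl = λ u → sumAdj-irrefl (sumVertex u) }

  amalgam-cond : Cond (adj amalgam)
  amalgam-cond = cond-pull sumVertex sumVertex-injective (λ _ _ → refl) sum-cond

  homˡ : Hom (part true) amalgam
  homˡ = (_↑ˡ b) , λ i j h → trans (cong₂ sumAdj (cong unsplit (splitAt-↑ˡ a i b)) (cong unsplit (splitAt-↑ˡ a j b)))
      (trans (sumAdj-same true i j) h)

  homʳ : Hom (part false) amalgam
  homʳ = (a ↑ʳ_) , λ i j h → trans (cong₂ sumAdj (cong unsplit (splitAt-↑ʳ a b i)) (cong unsplit (splitAt-↑ʳ a b j)))
      (trans (sumAdj-same false i j) h)

  module _
    (n : ℕ) (j₀ : Fin L) (j₀≡0 : toℕ j₀ ≡ 0) (marked : cell 0 n j₀ ≡ true)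
    (M : Structure) (root : Fin (card M)) (line : Fin (2 + n) → Fin (card M))
    (cover : ∀ x → x ≡ root ⊎ ∃ λ i → x ≡ line i) (root≢line : ∀ i → root ≢ line i)
    (root-type : ty M root ≡ τ₀) (line-type : ∀ i → ty M (line i) ≡ inputTy n (suc (toℕ i)))
    (line-arc : ∀ i → arc M (line (inject₁ i)) (line (suc i)) ≡ true)
    (part-avoids : ∀ s → ¬ InducedSub (graphOf M) (part s))
    where
    open Structures L W

    -- In an induced copy the line stays on one side, since steps do not cross. With the root on the
    -- same side, a part already contains the copy; with the root on the other side, the completion
    -- has put in the marking label edge, which an induced copy forbids.
    amalgam-avoids : ¬ InducedSub (graphOf M) amalgam
    amalgam-avoids (f , f-inj , f-same) = contradict (s ≟ᵇ s′)
      where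
      hom : Hom (graphOf M) amalgam
      hom = f , λ i j h → trans (f-same i j) h
      point : Fin (card M) → Role → Sum
      point x i = sumVertex (f (combine x i))
      point-pt : ∀ x → Pt sumAdj (ty M x) (point x)
      point-pt x = copy-pt M {amalgam} hom x
      chain : Fin (2 + n) → Role → Sum
      chain i = point (line i)
      chain-pt : ∀ i → Pt sumAdj (inputTy n (suc (toℕ i))) (chain i)
      chain-pt i = subst (λ σ → Pt sumAdj σ (chain i)) (line-type i) (point-pt (line i))
      root-pt : Pt sumAdj τ₀ (point root)
      root-pt = subst (λ σ → Pt sumAdj σ (point root)) root-type (point-pt root)
      chain-step : ∀ (i : Fin (1 + n)) → Step sumAdj (chain (inject₁ i)) (chain (suc i))
      chain-step i = copy-step M {amalgam} hom (line (inject₁ i)) (line (suc i)) (line-arc i)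
      s s′ : Bool
      s  = proj₁ (point root zero)
      s′ = proj₁ (chain zero zero)
      chain-side : ∀ i r → proj₁ (chain i r) ≡ s′
      chain-side i r = trans (point-side {c = chain i} (chain-pt i) r)
          (<-weakInduction (λ i → proj₁ (chain i zero) ≡ s′) refl
        (λ i ih → trans (step-side {c = chain (inject₁ i)} {chain (suc i)} (chain-pt (inject₁ i)) (chain-pt (suc i))
            (chain-step i)) ih) i)
      root-side : ∀ r → proj₁ (point root r) ≡ s
      root-side = point-side {c = point root} root-pt
      same : s ≡ s′ → ⊥
      same s≡s′ = part-avoids s (below , below-inj , below-same)
        where
        all-side : ∀ x r → proj₁ (point x r) ≡ s
        all-side x r with cover x
        ... | inj₁ refl       = root-side r
        ... | inj₂ (i , refl) = trans (chain-side i r) (sym s≡s′)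
        vertex-side : ∀ u → proj₁ (sumVertex (f u)) ≡ s
        vertex-side u = subst (λ u → proj₁ (sumVertex (f u)) ≡ s) (combine-remQuot {card M} 10 u)
            (uncurry all-side (remQuot 10 u))
        below : Fin (card M * 10) → Vertex s
        below u = proj₁ (fibre (sumVertex (f u)) (vertex-side u))
        below-eq : ∀ u → sumVertex (f u) ≡ (s , below u)
        below-eq u = proj₂ (fibre (sumVertex (f u)) (vertex-side u))
        below-inj : ∀ {u v} → below u ≡ below v → u ≡ v
        below-inj {u} {v} eq =
            f-inj (sumVertex-injective (trans (below-eq u) (trans (cong (s ,_) eq) (sym (below-eq v)))))
        below-same : ∀ u v → padj s (below u) (below v) ≡ adj (graphOf M) u v
        below-same u v = trans (sym (sumAdj-same s _ _))
            (trans (cong₂ sumAdj (sym (below-eq u)) (sym (below-eq v))) (f-same u v))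
      different : s ≢ s′ → ⊥
      different s≢s′ = false≢true no-edge
          (trans (sumAdj-cross s s′ (t₀ labelRole) (e last labelRole) s≢s′)
          (cong (_∨ half s′ s (e last labelRole) (t₀ labelRole)) has-edge))
        where
        t₀ : Role → Vertex s
        t₀ = proj₁ (lower {s} {point root} root-side)
        t₀-eq : ∀ r → point root r ≡ (s , t₀ r)
        t₀-eq = proj₂ (lower {s} {point root} root-side)
        e : Fin (2 + n) → Role → Vertex s′
        e i = proj₁ (lower {s′} {chain i} (chain-side i))
        e-eq : ∀ i r → chain i r ≡ (s′ , e i r)
        e-eq i = proj₂ (lower {s′} {chain i} (chain-side i))
        e-pt : ∀ i → Pt (padj s′) (inputTy n (suc (toℕ i))) (e i)
        e-pt i = pt-down {c = chain i} {e i} (e-eq i) (chain-pt i)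
        e-step : ∀ i → Step (padj s′) (e (inject₁ i)) (e (suc i))
        e-step i = step-down {c = chain (inject₁ i)} {chain (suc i)} {e (inject₁ i)} {e (suc i)} (e-eq (inject₁ i))
            (e-eq (suc i)) (chain-step i)
        space-at : ∀ i → toℕ i ≤ n → SpaceAt (padj s′) (toℕ i) (e i)
        space-at = <-weakInduction (λ i → toℕ i ≤ n → SpaceAt (padj s′) (toℕ i) (e i)) (λ _ → e-pt zero)
          λ i ih le → subst (λ σ → Pt (padj s′) σ (e (suc i))) (inputTy-space n (suc (toℕ i)) le) (e-pt (suc i))
              , e (inject₁ i) , e-step i ,
            subst (λ k → SpaceAt (padj s′) k (e (inject₁ i))) (toℕ-inject₁ i)
                (ih (subst (_≤ n) (sym (toℕ-inject₁ i)) (≤-trans (n≤1+n _) le)))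
        last-cell : Fin (2 + n)
        last-cell = inject₁ (fromℕ n)
        last : Fin (2 + n)
        last = suc (fromℕ n)
        toℕ-last-cell : toℕ last-cell ≡ n
        toℕ-last-cell = trans (toℕ-inject₁ (fromℕ n)) (toℕ-fromℕ n)
        last-type : inputTy n (suc (toℕ last)) ≡ δ
        last-type rewrite toℕ-fromℕ n | ≡ᵇ-refl n = refl
        digit-at : DigitAt (padj s′) n 1 (e last)
        digit-at = subst (λ σ → Pt (padj s′) σ (e last)) last-type (e-pt last) , e last-cell , e-step (fromℕ n) ,
          subst (λ k → SpaceAt (padj s′) k (e last-cell)) toℕ-last-cell
              (space-at last-cell (subst (_≤ n) (sym toℕ-last-cell) ≤-refl))
        time-at : TimeAt (padj s) 0 t₀
        time-at = pt-down {c = point root} {t₀} t₀-eq root-pt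
        has-edge : half s s′ (t₀ labelRole) (e last labelRole) ≡ true
        has-edge = trans (half-cell s s′ 0 n j₀ {t₀} {e last} time-at
            (subst (λ j → DigitAt (padj s′) n (suc j) (e last)) (sym j₀≡0) digit-at)) marked
        no-edge : sumAdj (s , t₀ labelRole) (s′ , e last labelRole) ≡ false
        no-edge = trans (cong₂ sumAdj (sym (t₀-eq labelRole)) (sym (e-eq last labelRole)))
                 (trans (f-same (combine root labelRole) (combine (line last) labelRole))
                 (trans (cong₂ (edge M) (remQuot-combine root labelRole) (remQuot-combine (line last) labelRole))
                     (no-label-edge M root (line last) (root≢line last))))
      contradict : Dec (s ≡ s′) → ⊥
      contradict (yes p) = same p
      contradict (no q)  = different q

-- Labellings read off from a joint homomorphism

hom-type : ∀ M M′ → Hom (graphOf M) (graphOf M′) → ∀ x → ∃ λ y → ty M x ≡ ty M′ y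
hom-type M M′ (f , hom) x =
  let (y , e , _) = points-of-structure M′ {c = λ i → remQuot 10 (f (combine x i))} λ i j g →
        hom _ _ (trans (cong₂ (edge M) (remQuot-combine x i) (remQuot-combine x j)) (edge-inner M x i j g))
  in y , e

induced-hom : ∀ {G H} → InducedSub G H → Hom G H
induced-hom (f , _ , same) = f , λ i j h → trans (same i j) h

no-arrow-τ₀ : ∀ {τ} → ¬ (τ ⟶ τ₀)
no-arrow-τ₀ ()

no-arrow-ι₀ : ∀ {τ} → ¬ (τ ⟶ ι₀)
no-arrow-ι₀ ()

chainTy-ι-not-δ : ∀ k → chainTy ι₀ ι₊ k ≢ δ
chainTy-ι-not-δ zero    ()
chainTy-ι-not-δ (suc _) ()

chainTy-ι-not-time : ∀ k → ¬ Time (chainTy ι₀ ι₊ k)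
chainTy-ι-not-time zero    ()
chainTy-ι-not-time (suc _) ()

chainTy-τ-not-space : ∀ k zi → spaceTy zi ≢ chainTy τ₀ τ₊ k
chainTy-τ-not-space zero    true  ()
chainTy-τ-not-space zero    false ()
chainTy-τ-not-space (suc _) true  ()
chainTy-τ-not-space (suc _) false ()

combTy-not-time : ∀ k j zt → timeTy zt ≢ combTy k j
combTy-not-time zero    zero    true  ()
combTy-not-time zero    zero    false ()
combTy-not-time (suc _) zero    true  ()
combTy-not-time (suc _) zero    false ()
combTy-not-time k       (suc _) true  ()
combTy-not-time k       (suc _) false ()

timeTy-chain : ∀ t → timeTy (t ≡ᵇ 0) ≡ chainTy τ₀ τ₊ t
timeTy-chain zero    = refl
timeTy-chain (suc _) = refl

spaceTy-chain : ∀ t → spaceTy (t ≡ᵇ 0) ≡ chainTy ι₀ ι₊ t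
spaceTy-chain zero    = refl
spaceTy-chain (suc _) = refl

-- Truncation at `N` makes labellings total functions on numbers; the windows considered reach
-- positions up to `N` only.
clamp : ∀ N → ℕ → Fin (suc N)
clamp N       zero    = zero
clamp zero    (suc t) = zero
clamp (suc N) (suc t) = suc (clamp N t)

toℕ-clamp : ∀ N t → t ≤ N → toℕ (clamp N t) ≡ t
toℕ-clamp N       zero    _        = refl
toℕ-clamp (suc N) (suc t) (s≤s le) = cong suc (toℕ-clamp N t le)

inputTy-digit : ∀ n → inputTy n (2 + n) ≡ δ
inputTy-digit n rewrite ≡ᵇ-refl n = refl

data InputView (n : ℕ) : ℕ → Set where
  root  : InputView n 0
  line  : ∀ {k} → k ≤ n → InputView n (suc k)
  digit : InputView n (2 + n)

inputView : ∀ n m → m < 3 + n → InputView n m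
inputView n zero    _ = root
inputView n (suc k) lt with m≤n⇒m<n∨m≡n (s≤s⁻¹ (s≤s⁻¹ lt))
... | inj₁ k<1+n = line (s≤s⁻¹ k<1+n)
... | inj₂ refl  = digit

module Reduction (L : ℕ) (W : Bool → Bool → (v v′ u u′ : Vec Bool (suc L)) → Set) (n : ℕ) where
  open Class (suc L) W
  open Structures (suc L) W
  open Chains (suc L) W

  Allowed : Graph → Set
  Allowed G = Cond (adj G) × ¬ InducedSub (inputGraph n) G

  jhp : (cell : ℕ → ℕ → Fin (suc L) → Bool) →
        (∀ t k zt zi → (zt ≡ true → t ≡ 0) → (zi ≡ true → k ≡ 0) →
          W zt zi (tabulate (cell t k)) (tabulate (cell t (suc k))) (tabulate (cell (suc t) k))
              (tabulate (cell (suc t) (suc k)))) →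
        (∀ zt zi → (zt ≡ true → zi ≡ true → ⊥) →
          W zt zi (tabulate λ _ → false) (tabulate λ _ → false) (tabulate λ _ → false) (tabulate λ _ → false)) →
        cell 0 n zero ≡ true → JHP Allowed
  jhp cell W-cell W-blank marked A B (CA , avA) (CB , avB) = amalgam , (amalgam-cond , avoids) , homˡ , homʳ
    where
    part : Bool → Graph
    part true  = A
    part false = B
    part-cond : ∀ s → Cond (adj (part s))
    part-cond true  = CA
    part-cond false = CB
    part-avoids : ∀ s → ¬ InducedSub (inputGraph n) (part s)
    part-avoids true  = avA
    part-avoids false = avB
    cover : ∀ (x : Fin (3 + n)) → x ≡ zero ⊎ ∃ λ i → x ≡ suc i
    cover zero    = inj₁ refl
    cover (suc i) = inj₂ (i , refl)
    line-arc : ∀ (i : Fin (1 + n)) → inputArc (suc (toℕ (inject₁ i))) (suc (suc (toℕ i))) ≡ true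
    line-arc i rewrite toℕ-inject₁ i = ≡ᵇ-refl (toℕ i)
    open Amalgam (suc L) W cell W-cell W-blank part part-cond
    avoids : ¬ InducedSub (inputGraph n) amalgam
    avoids = amalgam-avoids n zero refl marked (inputStructure n) zero suc cover (λ _ ()) refl
        (λ _ → refl) line-arc part-avoids

  module _ (N : ℕ) where

    timeGraph spaceGraph : Graph
    timeGraph  = graphOf (timeStructure N)
    spaceGraph = graphOf (spaceStructure (suc L) N)

    -- The space root of the input graph has nowhere to go on a pure time line.
    timeGraph-allowed : Allowed timeGraph
    timeGraph-allowed = graphOf-cond (timeStructure N) (λ x y zt zi _ e → chainTy-τ-not-space (toℕ y) zi e) , λ sub →
      let (y , e) = hom-type (inputStructure n) (timeStructure N) (induced-hom {inputGraph n} {timeGraph} sub)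
              (suc zero) in chainTy-τ-not-space (toℕ y) true e

    -- Here it is the time root of the input graph that has no possible image.
    spaceGraph-allowed : Allowed spaceGraph
    spaceGraph-allowed =
        graphOf-cond (spaceStructure (suc L) N)
        (λ x y zt zi e _ → combTy-not-time (cellOf (suc L) N x) (digitOf (suc L) N x) zt e) , λ sub →
      let (y , e) = hom-type (inputStructure n) (spaceStructure (suc L) N)
              (induced-hom {inputGraph n} {spaceGraph} sub) zero in combTy-not-time (cellOf (suc L) N y)
              (digitOf (suc L) N y) true e

    module _ (D : Graph) (C : Cond (adj D)) (avoids : ¬ InducedSub (inputGraph n) D)
             (f : Hom timeGraph D) (g : Hom spaceGraph D) (n≤N : n ≤ N) where

      private
        V : Set
        V = Fin (size D)

      timePoint : ℕ → Role → V
      timePoint t = copy (timeStructure N) {D} f (clamp N t)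

      combPoint : ℕ → Comb V
      combPoint k j = copy (spaceStructure (suc L) N) {D} g (combine (clamp N k) j)

      label-bit : ℕ → ℕ → Fin (suc L) → Bool
      label-bit t k j = label (adj D) (timePoint t) (combPoint k (suc j))

      timePoint-pt : ∀ t → t ≤ N → Pt (adj D) (chainTy τ₀ τ₊ t) (timePoint t)
      timePoint-pt t le =
          subst (λ t′ → Pt (adj D) (chainTy τ₀ τ₊ t′) (timePoint t)) (toℕ-clamp N t le)
          (copy-pt (timeStructure N) {D} f (clamp N t))

      timePoint-step : ∀ t → t < N → Step (adj D) (timePoint t) (timePoint (suc t))
      timePoint-step t lt = copy-step (timeStructure N) {D} f (clamp N t) (clamp N (suc t))
        (subst₂ (λ x y → (suc x ≡ᵇ y) ≡ true) (sym (toℕ-clamp N t (<⇒≤ lt))) (sym (toℕ-clamp N (suc t) lt))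
            (≡ᵇ-refl t))

      combPoint-pt : ∀ k → k ≤ N → ∀ j → Pt (adj D) (combTy k (toℕ j)) (combPoint k j)
      combPoint-pt k le j =
          subst (λ τ → Pt (adj D) τ (combPoint k j)) type
          (copy-pt (spaceStructure (suc L) N) {D} g (combine (clamp N k) j))
        where
        type : ty (spaceStructure (suc L) N) (combine (clamp N k) j) ≡ combTy k (toℕ j)
        type = trans (cong (λ (x , y) → combTy (toℕ x) (toℕ y)) (remQuot-combine (clamp N k) j))
            (cong (λ k → combTy k (toℕ j)) (toℕ-clamp N k le))

      combPoint-step : ∀ k j k′ j′ → k ≤ N → k′ ≤ N → combArc k (toℕ j) k′ (toℕ j′) ≡ true →
          Step (adj D) (combPoint k j) (combPoint k′ j′)
      combPoint-step k j k′ j′ le le′ a =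
          copy-step (spaceStructure (suc L) N) {D} g (combine (clamp N k) j) (combine (clamp N k′) j′) (trans arcs a)
        where
        arcs : arc (spaceStructure (suc L) N) (combine (clamp N k) j) (combine (clamp N k′) j′) ≡ combArc k (toℕ j) k′
            (toℕ j′)
        arcs = trans (cong₂ (λ (x , y) (x′ , y′) → combArc (toℕ x) (toℕ y) (toℕ x′) (toℕ y′))
            (remQuot-combine (clamp N k) j) (remQuot-combine (clamp N k′) j′))
                     (cong₂ (λ k k′ → combArc k (toℕ j) k′ (toℕ j′)) (toℕ-clamp N k le) (toℕ-clamp N k′ le′))

      cell-pt : ∀ k → k ≤ N → Pt (adj D) (chainTy ι₀ ι₊ k) (combPoint k zero)
      cell-pt k le = combPoint-pt k le zero

      cell-step : ∀ k → k < N → Step (adj D) (combPoint k zero) (combPoint (suc k) zero)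
      cell-step k lt = combPoint-step k zero (suc k) zero (<⇒≤ lt) lt (≡ᵇ-refl k)

      tooth-step : ∀ k → k ≤ N → ∀ (j : Fin (suc L)) → Step (adj D) (combPoint k (inject₁ j)) (combPoint k (suc j))
      tooth-step k le j = combPoint-step k (inject₁ j) k (suc j) le le
        (subst (λ i → combArc k i k (suc (toℕ j)) ≡ true) (sym (toℕ-inject₁ j)) (combArc-digit-refl k (toℕ j)))

      label-windows : ∀ t k → t < N → k < N →
        W (t ≡ᵇ 0) (k ≡ᵇ 0) (tabulate (label-bit t k)) (tabulate (label-bit t (suc k)))
            (tabulate (label-bit (suc t) k)) (tabulate (label-bit (suc t) (suc k)))
      label-windows t k t<N k<N =
          windows C {t ≡ᵇ 0} {k ≡ᵇ 0} {timePoint t} {timePoint (suc t)} {combPoint k} {combPoint (suc k)} (record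
        { time = subst (λ τ → Pt (adj D) τ (timePoint t)) (sym (timeTy-chain t)) (timePoint-pt t (<⇒≤ t<N))
        ; time′ = timePoint-pt (suc t) t<N
        ; tick = timePoint-step t t<N
        ; space = subst (λ τ → Pt (adj D) τ (combPoint k zero)) (sym (spaceTy-chain k)) (cell-pt k (<⇒≤ k<N))
        ; space′ = cell-pt (suc k) k<N
        ; shift = cell-step k k<N
        ; digit = λ j → combPoint-pt k (<⇒≤ k<N) (suc j)
        ; digit′ = λ j → combPoint-pt (suc k) k<N (suc j)
        ; tooth = tooth-step k (<⇒≤ k<N)
        ; tooth′ = tooth-step (suc k) k<N })

      space-at : ∀ k → k ≤ N → SpaceAt (adj D) k (combPoint k zero)
      space-at zero    le = cell-pt zero le
      space-at (suc k) le = cell-pt (suc k) le , combPoint k zero , cell-step k le , space-at k (<⇒≤ le)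

      inputPoint : ℕ → Role → V
      inputPoint zero    = timePoint 0
      inputPoint (suc k) = if k ≡ᵇ suc n then combPoint n (suc zero) else combPoint k zero

      inputPoint-line : ∀ k → k ≤ n → inputPoint (suc k) ≡ combPoint k zero
      inputPoint-line k le with k ≡ᵇ suc n in eq
      ... | false = refl
      ... | true  with ≡ᵇ-sound k (suc n) eq
      ... | refl = ⊥-elim (<-irrefl refl le)

      inputPoint-digit : inputPoint (2 + n) ≡ combPoint n (suc zero)
      inputPoint-digit rewrite ≡ᵇ-refl n = refl

      input-pt : ∀ {m} → InputView n m → Pt (adj D) (inputTy n m) (inputPoint m)
      input-pt root = timePoint-pt 0 z≤n
      input-pt (line {k} le) =
          subst₂ (Pt (adj D)) (sym (inputTy-space n k le)) (sym (inputPoint-line k le)) (cell-pt k (≤-trans le n≤N))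
      input-pt digit = subst₂ (Pt (adj D)) (sym (inputTy-digit n)) (sym inputPoint-digit)
          (combPoint-pt n n≤N (suc zero))

      input-step : ∀ {m} k → k ≤ n → InputView n m → m ≡ 2 + k → Step (adj D) (inputPoint (suc k)) (inputPoint m)
      input-step k le (line {suc _} le′) refl =
          subst₂ (Step (adj D)) (sym (inputPoint-line k le)) (sym (inputPoint-line (suc k) le′))
          (cell-step k (≤-trans le′ n≤N))
      input-step k le digit refl =
          subst₂ (Step (adj D)) (sym (inputPoint-line k le)) (sym inputPoint-digit) (tooth-step n n≤N zero)

      -- A homomorphism might identify cells of the space line; uniqueness of positions in `D`
      -- prevents this.
      input-distinct : ∀ {m m′} → InputView n m → InputView n m′ → inputTy n m ≡ inputTy n m′ →
          inputPoint m ≗ inputPoint m′ → m ≡ m′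
      input-distinct root root _ _ = refl
      input-distinct digit digit _ _ = refl
      input-distinct (line {k} le) (line {k′} le′) _ e =
          cong suc (spaceAt-unique C k k′ {combPoint k zero} {combPoint k′ zero}
        (λ i → trans (cong (λ c → c i) (sym (inputPoint-line k le)))
            (trans (e i) (cong (λ c → c i) (inputPoint-line k′ le′))))
        (space-at k (≤-trans le n≤N)) (space-at k′ (≤-trans le′ n≤N)))
      input-distinct root (line {zero} le) () _
      input-distinct root (line {suc k} le) t _ with trans t (inputTy-space n (suc k) le)
      ... | ()
      input-distinct root digit t _ with trans t (inputTy-digit n)
      ... | ()
      input-distinct (line {zero} le) root () _
      input-distinct (line {suc k} le) root t _ with trans (sym (inputTy-space n (suc k) le)) t
      ... | ()
      input-distinct digit root t _ with trans (sym (inputTy-digit n)) t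
      ... | ()
      input-distinct (line {k} le) digit t _ =
          ⊥-elim (chainTy-ι-not-δ k (trans (sym (inputTy-space n k le)) (trans t (inputTy-digit n))))
      input-distinct digit (line {k} le) t _ =
          ⊥-elim (chainTy-ι-not-δ k (trans (sym (inputTy-space n k le)) (trans (sym t) (inputTy-digit n))))

      input-label : label-bit 0 n zero ≡ false → ∀ {m m′} → InputView n m → InputView n m′ → Time (inputTy n m) →
          inputTy n m′ ≡ δ →
                    label (adj D) (inputPoint m) (inputPoint m′) ≡ false
      input-label ¬bit root digit _ _ =
          subst (λ c → label (adj D) (timePoint 0) c ≡ false) (sym inputPoint-digit) ¬bit
      input-label ¬bit root root _ ()
      input-label ¬bit root (line {k} le) _ d = ⊥-elim (chainTy-ι-not-δ k (trans (sym (inputTy-space n k le)) d))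
      input-label ¬bit (line {k} le) _ time _ = ⊥-elim (chainTy-ι-not-time k (subst Time (inputTy-space n k le) time))
      input-label ¬bit digit _ time _ with subst Time (inputTy-digit n) time
      ... | ()

      -- Were this label edge missing, the images of the time root, of the cells up to `n` and of
      -- the first digit of cell `n` would span an induced copy of the forbidden input graph.
      marked : label-bit 0 n zero ≡ true
      marked with label-bit 0 n zero in ¬bit
      ... | true  = refl
      ... | false = ⊥-elim (avoids (embedding M D C (λ x → inputPoint (toℕ x))
          (λ x → input-pt (view x))
          (λ x y a → steps (toℕ x) (toℕ y) (toℕ<n y) a)
          (λ x y e → toℕ-injective
              (input-distinct (view x) (view y) (proj₁ (disjoint C (input-pt (view x)) (input-pt (view y)) (e zero)))
              e))
          (λ x y time d → input-label ¬bit (view x) (view y) time d)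
          (λ y → rooted (view y))))
        where
        M : Structure
        M = inputStructure n
        view : (x : Fin (3 + n)) → InputView n (toℕ x)
        view x = inputView n (toℕ x) (toℕ<n x)
        steps : ∀ x y → y < 3 + n → inputArc x y ≡ true → Step (adj D) (inputPoint x) (inputPoint y)
        steps (suc k) y lt a with ≡ᵇ-sound (suc (suc k)) y a
        ... | refl = input-step k (s≤s⁻¹ (s≤s⁻¹ (s≤s⁻¹ lt))) (inputView n y lt) refl
        before : ∀ k y → k < 2 + n → inputArc (suc k) y ≡ true → ∃ λ x → inputArc (toℕ {3 + n} x) y ≡ true
        before k y lt a = suc (fromℕ< lt) , subst (λ k → inputArc (suc k) y ≡ true) (sym (toℕ-fromℕ< lt)) a
        rooted : ∀ {m} → InputView n m → (∃ λ x → inputArc (toℕ {3 + n} x) m ≡ true) ⊎ (∀ {τ} → ¬ (τ ⟶ inputTy n m))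
        rooted root            = inj₂ no-arrow-τ₀
        rooted (line {zero} _) = inj₂ no-arrow-ι₀
        rooted (line {suc k} le) =
            inj₁ (before k (2 + k) (≤-trans le (≤-trans (n≤1+n n) (n≤1+n (suc n)))) (≡ᵇ-refl k))
        rooted digit           = inj₁ (before n (2 + n) (n≤1+n (suc n)) (≡ᵇ-refl n))

    labels-of-amalgam : n ≤ N → JHP Allowed → Σ (ℕ → ℕ → Fin (suc L) → Bool) λ b →
      (∀ t k → t < N → k < N → W (t ≡ᵇ 0) (k ≡ᵇ 0) (tabulate (b t k)) (tabulate (b t (suc k)))
          (tabulate (b (suc t) k)) (tabulate (b (suc t) (suc k)))) ×
      b 0 n zero ≡ true
    labels-of-amalgam n≤N joint with joint timeGraph spaceGraph timeGraph-allowed spaceGraph-allowed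
    ... | D , (C , avoids) , f , g = label-bit D C avoids f g n≤N , label-windows D C avoids f g n≤N
        , marked D C avoids f g n≤N

-- Labellings and machine runs

data Action : Set where
  increment decrement keep : Action

apply : Action → ℕ → ℕ
apply increment = suc
apply decrement = pred
apply keep      = id

Store : Set
Store = ℕ → ℕ

record Machine : Set₁ where
  field
    State       : Set
    states      : ℕ
    index       : State → Fin states
    index-inj   : ∀ {p q} → index p ≡ index q → p ≡ q
    registers   : ℕ
    reg         : State → ℕ
    reg-bound   : ∀ p → reg p < registers
    act         : State → Action
    next        : State → Bool → State
    start final : State

  actOn : State → ℕ → Action
  actOn p r = if r ≡ᵇ reg p then act p else keep

  step : State × Store → State × Store
  step (p , σ) = next p (0 <ᵇ σ (reg p)) , λ r → apply (actOn p r) (σ r)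

  initial : ℕ → Store
  initial n r = if r ≡ᵇ 0 then n else 0

  run : ℕ → ℕ → State × Store
  run n zero    = start , initial n
  run n (suc t) = step (run n t)

-- The cells of row t describe the configuration at time t: cell k holds the state and, for every register, whether its
-- value exceeds k.  The mark singles out cell n and thereby fixes the input.
module Rows (M : Machine) where
  open Machine M

  width : ℕ
  width = suc (states + registers)

  Bits : Set
  Bits = Fin (suc width) → Bool

  mark defined : Bits → Bool
  mark v = v zero
  defined v = v (suc zero)

  stateBit : Bits → Fin states → Bool
  stateBit v i = v (suc (suc (i ↑ˡ registers)))

  regBit : Bits → Fin registers → Bool
  regBit v r = v (suc (suc (states ↑ʳ r)))

  Holds : Bits → State → Set
  Holds v p = ∀ i → stateBit v i ≡ does (i ≟ index p)

  -- Values are written in unary along the row. Incrementing shifts the row to the right and feeds a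
  -- set bit into the first cell; decrementing shifts it to the left, which also leaves zero at
  -- zero.
  RegRule : Action → Bool → (v v′ u u′ : Bool) → Set
  RegRule increment zi v v′ u u′ = (zi ≡ true → u ≡ true) × u′ ≡ v
  RegRule decrement zi v v′ u u′ = u ≡ v′
  RegRule keep      zi v v′ u u′ = u ≡ v

  -- A local description of the unary input: the bits of register 0 are set up to the first mark and
  -- unset from there on, and no mark may follow an unset bit. A mark at cell `n` thus forces the
  -- value `n`.
  record InitialRule (zi : Bool) (v v′ : Bits) (p : State) : Set where
    field
      starts : p ≡ start
      empty  : ∀ r → toℕ r ≢ 0 → regBit v r ≡ false × regBit v′ r ≡ false
      first  : ∀ r → toℕ r ≡ 0 → zi ≡ true → regBit v r ≡ not (mark v)
      before : ∀ r → toℕ r ≡ 0 → regBit v r ≡ true → regBit v′ r ≡ not (mark v′)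
      after  : ∀ r → toℕ r ≡ 0 → regBit v r ≡ false → regBit v′ r ≡ false × mark v′ ≡ false

  -- Every cell of a row repeats the state, since the register rules of each cell depend on it. The
  -- next state is determined only at the first cell, where the test for zero is visible, and is
  -- copied to the right from there.
  record Rule (zt zi : Bool) (v v′ u u′ : Bits) : Set where
    field
      p q     : State
      def-v′  : defined v′ ≡ true
      def-u   : defined u ≡ true
      holds   : Holds v p
      holds′  : Holds v′ p
      then′   : Holds u q
      then″   : Holds u′ q
      running : p ≢ final
      jump    : zi ≡ true → q ≡ next p (regBit v (fromℕ< (reg-bound p)))
      regs    : ∀ r → RegRule (actOn p (toℕ r)) zi (regBit v r) (regBit v′ r) (regBit u r) (regBit u′ r)
      opening : zt ≡ true → InitialRule zi v v′ p

  -- Points without a position rely on the first alternative. In the second, `Rule` hands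
  -- definedness to the right and to the next row.
  Locally : (zt zi : Bool) (v v′ u u′ : Bits) → Set
  Locally zt zi v v′ u u′ = (defined v ≡ false × (zt ≡ true → zi ≡ true → ⊥))
      ⊎ (defined v ≡ true × Rule zt zi v v′ u u′)

  W : Bool → Bool → (v v′ u u′ : Vec Bool (suc width)) → Set
  W zt zi v v′ u u′ = Locally zt zi (lookup v) (lookup v′) (lookup u) (lookup u′)

  locally-resp : ∀ {zt zi v v′ u u′ x x′ y y′} → v ≗ x → v′ ≗ x′ → u ≗ y → u′ ≗ y′ → Locally zt zi v v′ u u′ →
      Locally zt zi x x′ y y′
  locally-resp ev ev′ eu eu′ (inj₁ (d , z)) = inj₁ (trans (sym (ev _)) d , z)
  locally-resp {zi = zi} ev ev′ eu eu′ (inj₂ (d , R)) = inj₂ (trans (sym (ev _)) d , record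
    { p = p ; q = q ; def-v′ = trans (sym (ev′ _)) def-v′ ; def-u = trans (sym (eu _)) def-u
    ; holds = λ i → trans (sym (ev _)) (holds i) ; holds′ = λ i → trans (sym (ev′ _)) (holds′ i)
    ; then′ = λ i → trans (sym (eu _)) (then′ i) ; then″ = λ i → trans (sym (eu′ _)) (then″ i)
    ; running = running
    ; jump = λ z → trans (jump z) (cong (next p) (ev _))
    ; regs = λ r → regRule-resp (actOn p (toℕ r)) (ev _) (ev′ _) (eu _) (eu′ _) (regs r)
    ; opening = λ z → let open InitialRule (opening z) in record
      { starts = starts
      ; empty  = λ r r≢0 → let (a , b) = empty r r≢0 in trans (sym (ev _)) a , trans (sym (ev′ _)) b
      ; first  = λ r r≡0 z → trans (sym (ev _)) (trans (first r r≡0 z) (cong not (ev _)))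
      ; before = λ r r≡0 h → trans (sym (ev′ _)) (trans (before r r≡0 (trans (ev _) h)) (cong not (ev′ _)))
      ; after  = λ r r≡0 h → let (a , b) = after r r≡0 (trans (ev _) h) in trans (sym (ev′ _)) a , trans (sym (ev′ _)) b } })
    where
    open Rule R
    regRule-resp : ∀ a {v v′ u u′ x x′ y y′} → v ≡ x → v′ ≡ x′ → u ≡ y → u′ ≡ y′ → RegRule a zi v v′ u u′ →
        RegRule a zi x x′ y y′
    regRule-resp a refl refl refl refl w = w

  module _ (n : ℕ) where

    stateAt : ℕ → State
    stateAt t = proj₁ (run n t)

    storeAt : ℕ → Store
    storeAt t = proj₂ (run n t)

    payload : ℕ → ℕ → Fin states ⊎ Fin registers → Bool
    payload t k = [ (λ i → does (i ≟ index (stateAt t))) , (λ r → k <ᵇ storeAt t (toℕ r)) ]′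

    cell : ℕ → ℕ → Bits
    cell t k zero          = k ≡ᵇ n
    cell t k (suc zero)    = true
    cell t k (suc (suc i)) = payload t k (splitAt states i)

    cell-state : ∀ t k → Holds (cell t k) (stateAt t)
    cell-state t k i = cong (payload t k) (splitAt-↑ˡ states i registers)

    cell-reg : ∀ t k r → regBit (cell t k) r ≡ (k <ᵇ storeAt t (toℕ r))
    cell-reg t k r = cong (payload t k) (splitAt-↑ʳ states registers r)

    regRule-cell : ∀ t k zi → (zi ≡ true → k ≡ 0) → ∀ r → RegRule (actOn (stateAt t) (toℕ r)) zi
      (regBit (cell t k) r) (regBit (cell t (suc k)) r) (regBit (cell (suc t) k) r) (regBit (cell (suc t) (suc k)) r)
    regRule-cell t k zi k≡0 r rewrite cell-reg t k r | cell-reg t (suc k) r | cell-reg (suc t) k r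
        | cell-reg (suc t) (suc k) r
      with actOn (stateAt t) (toℕ r)
    ... | increment = (λ z → trans (cong (_<ᵇ suc (storeAt t (toℕ r))) (k≡0 z)) refl) , refl
    ... | keep      = refl
    ... | decrement with storeAt t (toℕ r)
    ... | zero  = refl
    ... | suc x = refl

    initial-zero : ∀ r → r ≢ 0 → initial n r ≡ 0
    initial-zero zero    r≢0 = ⊥-elim (r≢0 refl)
    initial-zero (suc _) _   = refl

    initial-input : ∀ r → r ≡ 0 → initial n r ≡ n
    initial-input zero refl = refl

    input-first : ∀ n → (0 <ᵇ n) ≡ not (0 ≡ᵇ n)
    input-first zero    = refl
    input-first (suc n) = refl

    input-before : ∀ k n → (k <ᵇ n) ≡ true → (suc k <ᵇ n) ≡ not (suc k ≡ᵇ n)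
    input-before zero    (suc n) _ = input-first n
    input-before (suc k) (suc n) h = input-before k n h

    input-after : ∀ k n → (k <ᵇ n) ≡ false → (suc k <ᵇ n) ≡ false × (suc k ≡ᵇ n) ≡ false
    input-after k       zero    _ = refl , refl
    input-after (suc k) (suc n) h = input-after k n h

    initialRule-cell : ∀ k zi → (zi ≡ true → k ≡ 0) → InitialRule zi (cell 0 k) (cell 0 (suc k)) start
    initialRule-cell k zi k≡0 = record
      { starts = refl
      ; empty  = λ r r≢0 → trans (cell-reg 0 k r) (cong (k <ᵇ_) (initial-zero (toℕ r) r≢0))
          , trans (cell-reg 0 (suc k) r) (cong (suc k <ᵇ_) (initial-zero (toℕ r) r≢0))
      ; first  = λ r r≡0 z →
          trans (inputBit k r r≡0)
          (trans (cong (_<ᵇ n) (k≡0 z)) (trans (input-first n) (cong (λ k → not (k ≡ᵇ n)) (sym (k≡0 z)))))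
      ; before = λ r r≡0 h → trans (inputBit (suc k) r r≡0) (input-before k n (trans (sym (inputBit k r r≡0)) h))
      ; after  = λ r r≡0 h → let (a , b) = input-after k n (trans (sym (inputBit k r r≡0)) h) in trans (inputBit (suc k) r r≡0) a , b }
      where
      inputBit : ∀ k r → toℕ r ≡ 0 → regBit (cell 0 k) r ≡ (k <ᵇ n)
      inputBit k r r≡0 = trans (cell-reg 0 k r) (cong (k <ᵇ_) (initial-input (toℕ r) r≡0))

    locally-cell : (∀ t → stateAt t ≢ final) → ∀ t k zt zi → (zt ≡ true → t ≡ 0) → (zi ≡ true → k ≡ 0) →
      Locally zt zi (cell t k) (cell t (suc k)) (cell (suc t) k) (cell (suc t) (suc k))
    locally-cell never t k zt zi t≡0 k≡0 = inj₂ (refl , record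
      { p = stateAt t ; q = stateAt (suc t) ; def-v′ = refl ; def-u = refl
      ; holds = cell-state t k ; holds′ = cell-state t (suc k) ; then′ = cell-state (suc t) k ; then″ =
          cell-state (suc t) (suc k)
      ; running = never t
      -- At cell 0 the bit of the tested register says exactly whether its value is positive.
      ; jump = λ z → cong (next (stateAt t)) (sym (trans (cell-reg t k _)
          (trans (cong (λ k → k <ᵇ storeAt t (toℕ (fromℕ< (reg-bound (stateAt t))))) (k≡0 z))
              (cong (λ r → 0 <ᵇ storeAt t r) (toℕ-fromℕ< (reg-bound (stateAt t)))))))
      ; regs = regRule-cell t k zi k≡0
      ; opening = λ z → opening (t≡0 z) })
      where
      opening : ∀ {t} → t ≡ 0 → InitialRule zi (cell t k) (cell t (suc k)) (stateAt t)
      opening refl = initialRule-cell k zi k≡0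

    cell-marked : cell 0 n zero ≡ true
    cell-marked = ≡ᵇ-refl n

    -- Legal labellings follow the run

    record Faithful (b : ℕ → ℕ → Bits) (t k : ℕ) : Set where
      field
        def  : defined (b t k) ≡ true
        hold : Holds (b t k) (stateAt t)
        regs : ∀ r → regBit (b t k) r ≡ (k <ᵇ storeAt t (toℕ r))
    open Faithful

    holds-unique : ∀ {v p q} → Holds v p → Holds v q → p ≡ q
    holds-unique {v} {p} {q} h h′ =
        index-inj (reflects (index p) (index q) (trans (sym (h (index p))) (h′ (index p))))
      where
      reflects : ∀ i j → does (i ≟ i) ≡ does (i ≟ j) → i ≡ j
      reflects i j eq with i ≟ i | i ≟ j
      ... | _      | yes e = e
      ... | no ¬e  | no _  = ⊥-elim (¬e refl)
      reflects i j () | yes _ | no _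

    -- Only the marked cell can end the initial segment of set input bits.
    segment : ∀ N (bit mk : ℕ → Bool) → bit 0 ≡ not (mk 0) →
      (∀ k → k < N → bit k ≡ true → bit (suc k) ≡ not (mk (suc k))) →
      (∀ k → k < N → bit k ≡ false → bit (suc k) ≡ false × mk (suc k) ≡ false) →
      ∀ n → n ≤ N → mk n ≡ true → ∀ k → k ≤ N → bit k ≡ (k <ᵇ n)
    segment N bit mk f b a zero n≤N m zero    le = trans f (cong not m)
    segment N bit mk f b a zero n≤N m (suc k) le = proj₁ (a k le (segment N bit mk f b a zero n≤N m k (<⇒≤ le)))
    segment (suc N) bit mk f b a (suc n) (s≤s n≤N) m zero le with bit 0 in eq
    ... | true  = refl
    ... | false = ⊥-elim (false≢true (stays n ≤-refl) m)
      where
      stays : ∀ j → j ≤ n → mk (suc j) ≡ false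
      low   : ∀ j → j ≤ n → bit j ≡ false
      low zero    _  = eq
      low (suc j) le = proj₁ (a j (s≤s (≤-trans (<⇒≤ le) n≤N)) (low j (<⇒≤ le)))
      stays j le = proj₂ (a j (s≤s (≤-trans le n≤N)) (low j le))
    segment (suc N) bit mk f b a (suc n) (s≤s n≤N) m (suc k) (s≤s le) =
      segment N (bit ∘ suc) (mk ∘ suc) (first eq) (λ k lt → b (suc k) (s≤s lt))
          (λ k lt → a (suc k) (s≤s lt)) n n≤N m k le
      where
      eq : bit 0 ≡ true
      eq = segment (suc N) bit mk f b a (suc n) (s≤s n≤N) m zero z≤n
      first : bit 0 ≡ true → bit 1 ≡ not (mk 1)
      first = b 0 (s≤s z≤n)

    module _ (N : ℕ) (b : ℕ → ℕ → Bits)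
      (legal : ∀ t k → t < N → k < N → Locally (t ≡ᵇ 0) (k ≡ᵇ 0) (b t k) (b t (suc k)) (b (suc t) k)
          (b (suc t) (suc k)))
      (n≤N : n ≤ N) (0<N : 0 < N) (marked : mark (b 0 n) ≡ true)
      where

      rule : ∀ t k → t < N → k < N → defined (b t k) ≡ true →
          Rule (t ≡ᵇ 0) (k ≡ᵇ 0) (b t k) (b t (suc k)) (b (suc t) k) (b (suc t) (suc k))
      rule t k t<N k<N d with legal t k t<N k<N
      ... | inj₁ (d′ , _) = ⊥-elim (false≢true d′ d)
      ... | inj₂ (_ , R)  = R

      corner : defined (b 0 0) ≡ true
      corner with legal 0 0 0<N 0<N
      ... | inj₁ (_ , z) = ⊥-elim (z refl refl)
      ... | inj₂ (d , _) = d

      row₀-defined : ∀ k → k ≤ N → defined (b 0 k) ≡ true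
      row₀-defined zero    _  = corner
      row₀-defined (suc k) le = Rule.def-v′ (rule 0 k 0<N le (row₀-defined k (<⇒≤ le)))

      rule₀ : ∀ k → k < N → Rule true (k ≡ᵇ 0) (b 0 k) (b 0 (suc k)) (b 1 k) (b 1 (suc k))
      rule₀ k lt = rule 0 k 0<N lt (row₀-defined k (<⇒≤ lt))

      opening₀ : ∀ k (lt : k < N) → InitialRule (k ≡ᵇ 0) (b 0 k) (b 0 (suc k)) (Rule.p (rule₀ k lt))
      opening₀ k lt = Rule.opening (rule₀ k lt) refl

      row₀-input : ∀ r → toℕ r ≡ 0 → ∀ k → k ≤ N → regBit (b 0 k) r ≡ (k <ᵇ n)
      row₀-input r r≡0 = segment N (λ k → regBit (b 0 k) r) (λ k → mark (b 0 k))
        (InitialRule.first (opening₀ 0 0<N) r r≡0 refl)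
        (λ k lt → InitialRule.before (opening₀ k lt) r r≡0) (λ k lt → InitialRule.after (opening₀ k lt) r r≡0) n n≤N
            marked

      row₀ : ∀ k → k < N → Faithful b 0 k
      row₀ k lt = record
        { def  = row₀-defined k (<⇒≤ lt)
        ; hold = subst (Holds (b 0 k)) (InitialRule.starts (opening₀ k lt)) (Rule.holds (rule₀ k lt))
        ; regs = λ r → regs₀ r (toℕ r) refl }
        where
        regs₀ : ∀ r m → toℕ r ≡ m → regBit (b 0 k) r ≡ (k <ᵇ initial n (toℕ r))
        regs₀ r zero    e = trans (row₀-input r e k (<⇒≤ lt)) (cong (k <ᵇ_) (sym (initial-input (toℕ r) e)))
        regs₀ r (suc m) e =
            trans (proj₁ (InitialRule.empty (opening₀ k lt) r r≢0)) (cong (k <ᵇ_) (sym (initial-zero (toℕ r) r≢0)))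
          where
          r≢0 : toℕ r ≢ 0
          r≢0 z with trans (sym e) z
          ... | ()

      module _ (t : ℕ) (row : ∀ k → t + k < N → Faithful b t k) where

        bounds : ∀ k → suc t + k < N → t < N × k < N × t + k < N × t + suc k < N
        bounds k lt = ≤-trans (s≤s (≤-trans (m≤m+n t k) (n≤1+n _))) lt
            , ≤-trans (s≤s (≤-trans (m≤n+m k t) (n≤1+n _))) lt ,
                      ≤-trans (n≤1+n _) lt , subst (_< N) (sym (+-suc t k)) lt

        ruleAt : ∀ k → suc t + k < N → Rule (t ≡ᵇ 0) (k ≡ᵇ 0) (b t k) (b t (suc k)) (b (suc t) k) (b (suc t) (suc k))
        ruleAt k lt = let (t< , k< , tk< , _) = bounds k lt in rule t k t< k< (def (row k tk<))

        p-known : ∀ k (lt : suc t + k < N) → Rule.p (ruleAt k lt) ≡ stateAt t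
        p-known k lt = holds-unique {b t k} (Rule.holds (ruleAt k lt))
            (hold (row k (proj₁ (proj₂ (proj₂ (bounds k lt))))))

        smaller : ∀ k → suc t + suc k < N → suc t + k < N
        smaller k lt = ≤-trans (n≤1+n _) (subst (_< N) (+-suc (suc t) k) lt)

        -- The jump fixes the new state at cell 0. Since the two lower cells of a window carry the
        -- same state and a cell carries only one, it passes from cell to cell.
        state-step : ∀ k → suc t + k < N → Holds (b (suc t) k) (stateAt (suc t))
        state-step zero lt = subst (Holds (b (suc t) 0)) jumped (Rule.then′ R)
          where
          R : Rule (t ≡ᵇ 0) true (b t 0) (b t 1) (b (suc t) 0) (b (suc t) 1)
          R = ruleAt 0 lt
          corner-row : Faithful b t 0
          corner-row = row 0 (proj₁ (proj₂ (proj₂ (bounds 0 lt))))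
          jumped : Rule.q R ≡ stateAt (suc t)
          jumped = trans (Rule.jump R refl)
              (trans (cong (λ p → next p (regBit (b t 0) (fromℕ< (reg-bound p)))) (p-known 0 lt))
            (cong (next (stateAt t))
                (trans (regs corner-row _) (cong (λ r → 0 <ᵇ storeAt t r) (toℕ-fromℕ< (reg-bound (stateAt t)))))))
        state-step (suc k) lt =
            subst (Holds (b (suc t) (suc k)))
            (holds-unique {b (suc t) k} (Rule.then′ R) (state-step k (smaller k lt))) (Rule.then″ R)
          where
          R : Rule (t ≡ᵇ 0) (k ≡ᵇ 0) (b t k) (b t (suc k)) (b (suc t) k) (b (suc t) (suc k))
          R = ruleAt k (smaller k lt)

        reg-rule : ∀ k (lt : suc t + k < N) r → RegRule (actOn (stateAt t) (toℕ r)) (k ≡ᵇ 0)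
          (regBit (b t k) r) (regBit (b t (suc k)) r) (regBit (b (suc t) k) r) (regBit (b (suc t) (suc k)) r)
        reg-rule k lt r =
            subst (λ p → RegRule (actOn p (toℕ r)) (k ≡ᵇ 0) (regBit (b t k) r) (regBit (b t (suc k)) r)
            (regBit (b (suc t) k) r) (regBit (b (suc t) (suc k)) r))
          (p-known k lt) (Rule.regs (ruleAt k lt) r)

        reg-step : ∀ k → suc t + k < N → ∀ r → regBit (b (suc t) k) r ≡ (k <ᵇ storeAt (suc t) (toℕ r))
        reg-step k lt r = by (actOn (stateAt t) (toℕ r)) k lt (reg-rule k lt r) (left k lt)
          where
          RuleAt : Action → ℕ → Set
          RuleAt a k = RegRule a (k ≡ᵇ 0) (regBit (b t k) r) (regBit (b t (suc k)) r) (regBit (b (suc t) k) r)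
              (regBit (b (suc t) (suc k)) r)
          below : ∀ k x → (suc k <ᵇ x) ≡ (k <ᵇ pred x)
          below k zero    = refl
          below k (suc x) = refl
          -- After an increment, the bit in cell `suc k` is dictated by the window one cell to the
          -- left, where it is the lower right entry.
          Left : Action → ℕ → Set
          Left a zero    = ⊤
          Left a (suc k) = RuleAt a k
          left : ∀ k → suc t + k < N → Left (actOn (stateAt t) (toℕ r)) k
          left zero    lt = tt
          left (suc k) lt = reg-rule k (smaller k lt) r
          by : ∀ a k → suc t + k < N → RuleAt a k → Left a k →
              regBit (b (suc t) k) r ≡ (k <ᵇ apply a (storeAt t (toℕ r)))
          by keep      k       lt e       _       = trans e (regs (row k (proj₁ (proj₂ (proj₂ (bounds k lt))))) r)
          by decrement k       lt e       _       =
              trans e (trans (regs (row (suc k) (proj₂ (proj₂ (proj₂ (bounds k lt))))) r)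
              (below k (storeAt t (toℕ r))))
          by increment zero    lt (e , _) _       = e refl
          by increment (suc k) lt _       (_ , e) =
              trans e (regs (row k (proj₁ (proj₂ (proj₂ (bounds k (smaller k lt)))))) r)

        row-step : ∀ k → suc t + k < N → Faithful b (suc t) k
        row-step k lt = record { def = Rule.def-u (ruleAt k lt) ; hold = state-step k lt ; regs = reg-step k lt }

      -- A row is computed from windows that need the cell to the right in the row above, so one
      -- cell of certainty is lost per row; hence the triangle `t + k < N`.
      rows : ∀ t k → t + k < N → Faithful b t k
      rows zero    = row₀
      rows (suc t) = row-step t (rows t)

      never-final : ∀ t → t < N → t + 0 < N → stateAt t ≢ final
      never-final t t<N lt eq = Rule.running R (trans (holds-unique {b t 0} (Rule.holds R) (hold (rows t 0 lt))) eq)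
        where
        R : Rule (t ≡ᵇ 0) true (b t 0) (b t 1) (b (suc t) 0) (b (suc t) 1)
        R = rule t 0 t<N 0<N (def (rows t 0 lt))

module Encoding (M : Machine) where
  open Machine M
  open Rows M

  module _ (n : ℕ) where
    open Reduction width W n

    running⇒jhp : (∀ t → stateAt n t ≢ final) → JHP Allowed
    running⇒jhp never = jhp (cell n)
      (λ t k zt zi t≡0 k≡0 → locally-resp
        (λ i → sym (lookup∘tabulate (cell n t k) i)) (λ i → sym (lookup∘tabulate (cell n t (suc k)) i))
        (λ i → sym (lookup∘tabulate (cell n (suc t) k) i)) (λ i → sym (lookup∘tabulate (cell n (suc t) (suc k)) i))
        (locally-cell n never t k zt zi t≡0 k≡0))
      (λ zt zi z → inj₁ (refl , z))
      (cell-marked n)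

    jhp⇒running : JHP Allowed → ∀ t → stateAt n t ≢ final
    jhp⇒running joint t = never-final n N b
      (λ t k t<N k<N → locally-resp
        (lookup∘tabulate (b t k)) (lookup∘tabulate (b t (suc k))) (lookup∘tabulate (b (suc t) k))
            (lookup∘tabulate (b (suc t) (suc k)))
        (proj₁ (proj₂ labels) t k t<N k<N))
      (≤-trans (m≤n+m n t) (m≤n+m (t + n) 1)) (s≤s z≤n) (proj₂ (proj₂ labels)) t (s≤s (m≤m+n t n))
      (s≤s (≤-trans (≤-reflexive (+-identityʳ t)) (m≤m+n t n)))
      where
      N : ℕ
      -- Large enough for cell `n` to lie on the line and for row `t` to be known at cell 0.
      N = suc (t + n)
      labels : Σ (ℕ → ℕ → Bits) λ b →
        (∀ t k → t < N → k < N → W (t ≡ᵇ 0) (k ≡ᵇ 0)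
          (tabulate (b t k)) (tabulate (b t (suc k))) (tabulate (b (suc t) k)) (tabulate (b (suc t) (suc k)))) ×
        mark (b 0 n) ≡ true
      labels = labels-of-amalgam N (≤-trans (m≤n+m n t) (m≤n+m (t + n) 1)) joint
      b : ℕ → ℕ → Bits
      b = proj₁ labels

-- While programs as machines

infixr 5 _⨾_
data Cmd : Set where
  inc dec : ℕ → Cmd
  _⨾_     : Cmd → Cmd → Cmd
  loop    : ℕ → Cmd → Cmd

-- The control points of a command; in a loop, `nothing` is the test of its register.
Pos : Cmd → Set
Pos (inc r)    = ⊤
Pos (dec r)    = ⊤
Pos (c ⨾ d)    = Pos c ⊎ Pos d
Pos (loop r c) = Maybe (Pos c)

entry : ∀ c → Pos c
entry (inc r)    = tt
entry (dec r)    = tt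
entry (c ⨾ d)    = inj₁ (entry c)
entry (loop r c) = nothing

regOf : ∀ c → Pos c → ℕ
regOf (inc r)    _        = r
regOf (dec r)    _        = r
regOf (c ⨾ d)    (inj₁ p) = regOf c p
regOf (c ⨾ d)    (inj₂ p) = regOf d p
regOf (loop r c) nothing  = r
regOf (loop r c) (just p) = regOf c p

actOf : ∀ c → Pos c → Action
actOf (inc r)    _        = increment
actOf (dec r)    _        = decrement
actOf (c ⨾ d)    (inj₁ p) = actOf c p
actOf (c ⨾ d)    (inj₂ p) = actOf d p
actOf (loop r c) nothing  = keep
actOf (loop r c) (just p) = actOf c p

toLeft : ∀ {c} d → Maybe (Pos c) → Maybe (Pos (c ⨾ d))
toLeft d nothing  = just (inj₂ (entry d))
toLeft d (just p) = just (inj₁ p)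

toRight : ∀ c {d} → Maybe (Pos d) → Maybe (Pos (c ⨾ d))
toRight c nothing  = nothing
toRight c (just p) = just (inj₂ p)

-- The result `nothing` means leaving the command. For the body of a loop this value is at the same
-- time the position of the test, so a single `just` turns the exit of the body into a return to the
-- test.
nextOf : ∀ c → Pos c → Bool → Maybe (Pos c)
nextOf (inc r)    _        b     = nothing
nextOf (dec r)    _        b     = nothing
nextOf (c ⨾ d)    (inj₁ p) b     = toLeft d (nextOf c p b)
nextOf (c ⨾ d)    (inj₂ p) b     = toRight c (nextOf d p b)
nextOf (loop r c) nothing  true  = just (just (entry c))
nextOf (loop r c) nothing  false = nothing
nextOf (loop r c) (just p) b     = just (nextOf c p b)

positions : Cmd → ℕ
positions (inc r)    = 1
positions (dec r)    = 1
positions (c ⨾ d)    = positions c + positions d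
positions (loop r c) = suc (positions c)

number : ∀ c → Pos c → Fin (positions c)
number (inc r)    _        = zero
number (dec r)    _        = zero
number (c ⨾ d)    (inj₁ p) = join (positions c) (positions d) (inj₁ (number c p))
number (c ⨾ d)    (inj₂ p) = join (positions c) (positions d) (inj₂ (number d p))
number (loop r c) nothing  = zero
number (loop r c) (just p) = suc (number c p)

join-injective : ∀ m n {x y} → join m n x ≡ join m n y → x ≡ y
join-injective m n {x} {y} eq = trans (sym (splitAt-join m n x)) (trans (cong (splitAt m) eq) (splitAt-join m n y))

number-injective : ∀ c {p q} → number c p ≡ number c q → p ≡ q
number-injective (inc r) _ = refl
number-injective (dec r) _ = refl
number-injective (c ⨾ d) {inj₁ p} {inj₁ q} eq =
    cong inj₁ (number-injective c (inj₁-injective (join-injective (positions c) (positions d) eq)))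
number-injective (c ⨾ d) {inj₂ p} {inj₂ q} eq =
    cong inj₂ (number-injective d (inj₂-injective (join-injective (positions c) (positions d) eq)))
number-injective (c ⨾ d) {inj₁ p} {inj₂ q} eq with join-injective (positions c)
    (positions d) {inj₁ (number c p)} {inj₂ (number d q)} eq
... | ()
number-injective (c ⨾ d) {inj₂ p} {inj₁ q} eq with join-injective (positions c)
    (positions d) {inj₂ (number d p)} {inj₁ (number c q)} eq
... | ()
number-injective (loop r c) {nothing} {nothing} _  = refl
number-injective (loop r c) {just p}  {just q}  eq = cong just (number-injective c (sucᶠ-injective eq))

maxReg : Cmd → ℕ
maxReg (inc r)    = r
maxReg (dec r)    = r
maxReg (c ⨾ d)    = maxReg c ⊔ maxReg d
maxReg (loop r c) = r ⊔ maxReg c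

regOf-bound : ∀ c p → regOf c p ≤ maxReg c
regOf-bound (inc r)    _        = ≤-refl
regOf-bound (dec r)    _        = ≤-refl
regOf-bound (c ⨾ d)    (inj₁ p) = ≤-trans (regOf-bound c p) (m≤m⊔n (maxReg c) (maxReg d))
regOf-bound (c ⨾ d)    (inj₂ p) = ≤-trans (regOf-bound d p) (m≤n⊔m (maxReg c) (maxReg d))
regOf-bound (loop r c) nothing  = m≤m⊔n r (maxReg c)
regOf-bound (loop r c) (just p) = ≤-trans (regOf-bound c p) (m≤n⊔m r (maxReg c))

machine : Cmd → Machine
machine c = record
  { State = Maybe (Pos c) ; states = suc (positions c) ; index = index ; index-inj = index-inj
  ; registers = suc (maxReg c) ; reg = reg ; reg-bound = reg-bound ; act = act ; next = next
  ; start = just (entry c) ; final = nothing }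
  where
  index : Maybe (Pos c) → Fin (suc (positions c))
  index nothing  = zero
  index (just p) = suc (number c p)
  index-inj : ∀ {p q} → index p ≡ index q → p ≡ q
  index-inj {nothing} {nothing} _  = refl
  index-inj {just p}  {just q}  eq = cong just (number-injective c (sucᶠ-injective eq))
  reg : Maybe (Pos c) → ℕ
  reg nothing  = 0
  reg (just p) = regOf c p
  reg-bound : ∀ p → reg p < suc (maxReg c)
  reg-bound nothing  = s≤s z≤n
  reg-bound (just p) = s≤s (regOf-bound c p)
  act : Maybe (Pos c) → Action
  act nothing  = keep
  act (just p) = actOf c p
  next : Maybe (Pos c) → Bool → Maybe (Pos c)
  next nothing  _ = nothing
  next (just p) b = nextOf c p b

update : Action → ℕ → Store → Store
update a r σ x = apply (if x ≡ᵇ r then a else keep) (σ x)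

data Steps (c : Cmd) : Pos c → Store → Maybe (Pos c) → Store → Set where
  one  : ∀ {p σ o σ′} → nextOf c p (0 <ᵇ σ (regOf c p)) ≡ o → σ′ ≗ update (actOf c p) (regOf c p) σ → Steps c p σ o σ′
  more : ∀ {p σ p′ σ′ o σ″} → nextOf c p (0 <ᵇ σ (regOf c p)) ≡ just p′ → σ′ ≗ update (actOf c p) (regOf c p) σ →
         Steps c p′ σ′ o σ″ → Steps c p σ o σ″

steps-trans : ∀ {c p σ p′ σ′ o σ″} → Steps c p σ (just p′) σ′ → Steps c p′ σ′ o σ″ → Steps c p σ o σ″
steps-trans (one e u)    t = more e u t
steps-trans (more e u s) t = more e u (steps-trans s t)

Exec : Cmd → Store → Store → Set
Exec c σ σ′ = Steps c (entry c) σ nothing σ′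

module _ (c d : Cmd) (h : Maybe (Pos c) → Maybe (Pos d)) (e : Pos c → Pos d) (h-just : ∀ p → h (just p) ≡ just (e p))
  (h-next : ∀ p b → nextOf d (e p) b ≡ h (nextOf c p b)) (h-reg : ∀ p → regOf d (e p) ≡ regOf c p)
      (h-act : ∀ p → actOf d (e p) ≡ actOf c p) where

  -- `e` places the control points of a component inside the whole command and `h` translates its
  -- exit. Both halves of a sequence and the body of a loop are instances.
  steps-lift : ∀ {p σ o σ′} → Steps c p σ o σ′ → Steps d (e p) σ (h o) σ′
  steps-lift {p} {σ} (one eq u) =
      one (trans (h-next p _) (trans (cong (λ r → h (nextOf c p (0 <ᵇ σ r))) (h-reg p)) (cong h eq)))
    λ x → trans (u x) (cong₂ (λ a r → update a r σ x) (sym (h-act p)) (sym (h-reg p)))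
  steps-lift {p} {σ} (more {p′ = p′} eq u s) =
      more (trans (h-next p _)
      (trans (cong (λ r → h (nextOf c p (0 <ᵇ σ r))) (h-reg p)) (trans (cong h eq) (h-just p′))))
    (λ x → trans (u x) (cong₂ (λ a r → update a r σ x) (sym (h-act p)) (sym (h-reg p)))) (steps-lift s)

exec-seq : ∀ {c d σ σ′ σ″} → Exec c σ σ′ → Exec d σ′ σ″ → Exec (c ⨾ d) σ σ″
exec-seq {c} {d} s t = steps-trans
  (steps-lift c (c ⨾ d) (toLeft d) inj₁ (λ _ → refl) (λ _ _ → refl) (λ _ → refl) (λ _ → refl) s)
  (steps-lift d (c ⨾ d) (toRight c) inj₂ (λ _ → refl) (λ _ _ → refl) (λ _ → refl) (λ _ → refl) t)

update-keep : ∀ r σ → σ ≗ update keep r σ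
update-keep r σ x with x ≡ᵇ r
... | true  = refl
... | false = refl

exec-loop-exit : ∀ {r c σ} → σ r ≡ 0 → Exec (loop r c) σ σ
exec-loop-exit {r} {c} {σ} z = one (exit (σ r) z) (update-keep r σ)
  where
  exit : ∀ v → v ≡ 0 → nextOf (loop r c) nothing (0 <ᵇ v) ≡ nothing
  exit _ refl = refl

exec-loop-body : ∀ {r c σ k σ′ σ″} → σ r ≡ suc k → Exec c σ σ′ → Exec (loop r c) σ′ σ″ → Exec (loop r c) σ σ″
exec-loop-body {r} {c} {σ} pos s t = more (enter (σ r) pos) (update-keep r σ)
  (steps-trans (steps-lift c (loop r c) just just (λ _ → refl) (λ _ _ → refl) (λ _ → refl) (λ _ → refl) s) t)
  where
  enter : ∀ v {k} → v ≡ suc k → nextOf (loop r c) nothing (0 <ᵇ v) ≡ just (just (entry c))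
  enter _ refl = refl

-- Compilation of partial recursive functions

update-at : ∀ a r σ → update a r σ r ≡ apply a (σ r)
update-at a r σ rewrite ≡ᵇ-refl r = refl

update-other : ∀ a r σ x → x ≢ r → update a r σ x ≡ σ x
update-other a r σ x x≢r with x ≡ᵇ r in eq
... | true  = ⊥-elim (x≢r (≡ᵇ-sound x r eq))
... | false = refl

exec-inc : ∀ r σ → Exec (inc r) σ (update increment r σ)
exec-inc r σ = one refl λ _ → refl

exec-dec : ∀ r σ → Exec (dec r) σ (update decrement r σ)
exec-dec r σ = one refl λ _ → refl

clear : ℕ → Cmd
clear r = loop r (dec r)

exec-clear : ∀ r σ → Σ Store λ σ′ → Exec (clear r) σ σ′ × σ′ r ≡ 0 × (∀ x → x ≢ r → σ′ x ≡ σ x)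
exec-clear r σ = go (σ r) σ refl
  where
  go : ∀ n σ → σ r ≡ n → Σ Store λ σ′ → Exec (clear r) σ σ′ × σ′ r ≡ 0 × (∀ x → x ≢ r → σ′ x ≡ σ x)
  go zero    σ eq = σ , exec-loop-exit eq , eq , λ _ _ → refl
  go (suc n) σ eq =
    let (σ′ , ex , at , fr) = go n (update decrement r σ) (trans (update-at decrement r σ) (cong pred eq))
    in σ′ , exec-loop-body eq (exec-dec r σ) ex , at , λ x x≢r → trans (fr x x≢r) (update-other decrement r σ x x≢r)

-- A register can be read only by draining it, so the value of `x` goes to `y` and to the scratch
-- register `z` at once and is restored from `z`.
copy-reg : (x y z : ℕ) → Cmd
copy-reg x y z = clear y ⨾ clear z ⨾ loop x (dec x ⨾ inc y ⨾ inc z) ⨾ loop z (dec z ⨾ inc x)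

module _ {x y z : ℕ} (x≢y : x ≢ y) (x≢z : x ≢ z) (y≢z : y ≢ z) where

  exec-split : ∀ n σ → σ x ≡ n → Σ Store λ σ′ → Exec (loop x (dec x ⨾ inc y ⨾ inc z)) σ σ′ ×
    σ′ x ≡ 0 × σ′ y ≡ n + σ y × σ′ z ≡ n + σ z × (∀ r → r ≢ x → r ≢ y → r ≢ z → σ′ r ≡ σ r)
  exec-split zero    σ eq = σ , exec-loop-exit eq , eq , refl , refl , λ _ _ _ _ → refl
  exec-split (suc n) σ eq =
    let (σ′ , ex , x0 , yn , zn , fr) = exec-split n σ₃ (trans (update-other increment z σ₂ x x≢z)
          (trans (update-other increment y σ₁ x x≢y) (trans (update-at decrement x σ) (cong pred eq))))
    in σ′ , exec-loop-body eq (exec-seq (exec-dec x σ) (exec-seq (exec-inc y σ₁) (exec-inc z σ₂))) ex , x0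
     , trans yn (trans (cong (n +_) (trans (update-other increment z σ₂ y y≢z) (trans (update-at increment y σ₁)
         (cong suc (update-other decrement x σ y (≢-sym x≢y)))))) (+-suc n (σ y)))
     , trans zn (trans
         (cong (n +_) (trans (update-at increment z σ₂) (cong suc (trans (update-other increment y σ₁ z (≢-sym y≢z))
         (update-other decrement x σ z (≢-sym x≢z)))))) (+-suc n (σ z)))
     , λ r r≢x r≢y r≢z → trans (fr r r≢x r≢y r≢z) (trans (update-other increment z σ₂ r r≢z)
         (trans (update-other increment y σ₁ r r≢y) (update-other decrement x σ r r≢x)))
    where
    σ₁ σ₂ σ₃ : Store
    σ₁ = update decrement x σ
    σ₂ = update increment y σ₁
    σ₃ = update increment z σ₂

  exec-restore : ∀ n σ → σ z ≡ n → Σ Store λ σ′ → Exec (loop z (dec z ⨾ inc x)) σ σ′ ×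
    σ′ x ≡ n + σ x × (∀ r → r ≢ x → r ≢ z → σ′ r ≡ σ r)
  exec-restore zero    σ eq = σ , exec-loop-exit eq , refl , λ _ _ _ → refl
  exec-restore (suc n) σ eq =
    let (σ′ , ex , xn , fr) =
            exec-restore n σ₂
            (trans (update-other increment x σ₁ z (≢-sym x≢z)) (trans (update-at decrement z σ) (cong pred eq)))
    in σ′ , exec-loop-body eq (exec-seq (exec-dec z σ) (exec-inc x σ₁)) ex
     , trans xn (trans (cong (n +_) (trans (update-at increment x σ₁) (cong suc (update-other decrement z σ x x≢z))))
         (+-suc n (σ x)))
     , λ r r≢x r≢z → trans (fr r r≢x r≢z)
         (trans (update-other increment x σ₁ r r≢x) (update-other decrement z σ r r≢z))
    where
    σ₁ σ₂ : Store
    σ₁ = update decrement z σ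
    σ₂ = update increment x σ₁

  exec-copy : ∀ σ → Σ Store λ σ′ → Exec (copy-reg x y z) σ σ′ × σ′ y ≡ σ x × (∀ r → r ≢ y → r ≢ z → σ′ r ≡ σ r)
  exec-copy σ =
    let (σ₁ , ex₁ , y0 , fr₁) = exec-clear y σ
        (σ₂ , ex₂ , z0 , fr₂) = exec-clear z σ₁
        (σ₃ , ex₃ , x₃ , y₃ , z₃ , fr₃) = exec-split (σ x) σ₂ (trans (fr₂ x x≢z) (fr₁ x x≢y))
        (σ₄ , ex₄ , x₄ , fr₄) = exec-restore (σ x) σ₃ (trans z₃ (trans (cong (σ x +_) z0) (+-identityʳ _)))
        at-x = trans x₄ (trans (cong (σ x +_) x₃) (+-identityʳ _))
        frame : ∀ r → r ≢ y → r ≢ z → Dec (r ≡ x) → σ₄ r ≡ σ r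
        frame = λ { r r≢y r≢z (yes refl) → at-x
                  ; r r≢y r≢z (no r≢x) →
                      trans (fr₄ r r≢x r≢z) (trans (fr₃ r r≢x r≢y r≢z) (trans (fr₂ r r≢z) (fr₁ r r≢y))) }
    in σ₄ , exec-seq ex₁ (exec-seq ex₂ (exec-seq ex₃ ex₄))
     , trans (fr₄ y (≢-sym x≢y) y≢z) (trans y₃ (trans (cong (σ x +_) (trans (fr₂ y y≢z) y0)) (+-identityʳ _)))
     , λ r r≢y r≢z → frame r r≢y r≢z (r ≟ⁿ x)

temps : ℕ → ∀ m → Vec ℕ m
temps k zero    = []
temps k (suc m) = k ∷ temps (suc k) m

-- comp f args out k leaves the value of f at the registers args in register out, using only registers from k on as
-- scratch space.
comp    : ∀ {n} → PR n → Vec ℕ n → (out k : ℕ) → Cmd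
compAll : ∀ {m n} → Vec (PR n) m → Vec ℕ n → (k : ℕ) → Cmd

comp Z            args       out k = clear out
comp S            (x ∷ [])   out k = copy-reg x out k ⨾ inc out
comp (P i)        args       out k = copy-reg (lookup args i) out k
comp (Comp {m} f gs) args    out k =
    compAll gs args k ⨾ comp f (temps k m) (m + k) (suc (m + k)) ⨾ copy-reg (m + k) out (suc (m + k))
-- Register `k` counts the rounds done, `1 + k` holds the current value, `2 + k` the number of
-- rounds left and `3 + k` the result of `g`.
comp (Rec f g)    (a ∷ args) out k =
  ((comp f args (1 + k) (4 + k) ⨾ clear k ⨾ copy-reg a (2 + k) (4 + k)) ⨾
   loop (2 + k) (dec (2 + k) ⨾ comp g (k ∷ 1 + k ∷ args) (3 + k) (4 + k) ⨾ copy-reg (3 + k) (1 + k) (4 + k) ⨾ inc k))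
       ⨾
  copy-reg (1 + k) out (4 + k)
-- Register `k` holds the candidate and `1 + k` the value of `f` there; `f` is evaluated once before
-- the loop and once at the end of each round.
comp (Mu f)       args       out k =
  clear k ⨾ comp f (k ∷ args) (1 + k) (2 + k) ⨾ loop (1 + k) (inc k ⨾ comp f (k ∷ args) (1 + k) (2 + k)) ⨾ copy-reg k
      out (2 + k)

-- In place of an empty command, a scratch register is cleared.
compAll []       args k = clear k
compAll (g ∷ gs) args k = comp g args k (suc k) ⨾ compAll gs args (suc k)

Frame : (Store → Store → ℕ → Set)
Frame σ σ′ k = ∀ r → r < k → σ′ r ≡ σ r

Holding : ∀ {n} → Store → Vec ℕ n → Vec ℕ n → Set
Holding σ args xs = ∀ i → σ (lookup args i) ≡ lookup xs i

Below : ∀ {n} → Vec ℕ n → ℕ → Set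
Below args k = ∀ i → lookup args i < k

Computes : Cmd → (out k v : ℕ) → Store → Set
Computes c out k v σ = Σ Store λ σ′ → Exec c σ σ′ × σ′ out ≡ v × (∀ r → r < k → r ≢ out → σ′ r ≡ σ r)

-- Quantifying over the placement of registers lets the same statement serve wherever `comp` puts a
-- subprogram. The output is kept apart from the inputs because `copy-reg` needs distinct registers.
Correct : ∀ {n} → PR n → Vec ℕ n → ℕ → Set
Correct {n} f xs v = ∀ (args : Vec ℕ n) out k σ → Below args k → (∀ i → lookup args i ≢ out) → out < k →
    Holding σ args xs →
                     Computes (comp f args out k) out k v σ

CorrectAll : ∀ {m n} → Vec (PR n) m → Vec ℕ n → Vec ℕ m → Set
CorrectAll {m} {n} gs xs ys = ∀ (args : Vec ℕ n) k σ → Below args k → Holding σ args xs →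
                              Σ Store λ σ′ → Exec (compAll gs args k) σ σ′ × Holding σ′ (temps k m) ys × Frame σ σ′ k

temps-bounds : ∀ k m i → k ≤ lookup (temps k m) i × lookup (temps k m) i < m + k
temps-bounds k (suc m) zero    = ≤-refl , s≤s (m≤n+m k m)
temps-bounds k (suc m) (suc i) =
  let (a , b) = temps-bounds (suc k) m i in ≤-trans (n≤1+n k) a , ≤-trans b (≤-reflexive (+-suc m k))

computes-copy : ∀ x out k σ → x < k → out < k → x ≢ out → Computes (copy-reg x out k) out k (σ x) σ
computes-copy x out k σ x<k out<k x≢out =
  let (σ′ , ex , at , fr) = exec-copy x≢out (<⇒≢ x<k) (<⇒≢ out<k) σ in σ′ , ex , at , λ r r<k r≢out →
          fr r r≢out (<⇒≢ r<k)

correct-Z : ∀ {n} {xs : Vec ℕ n} → Correct Z xs 0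
correct-Z args out k σ _ _ _ _ = let (σ′ , ex , at , fr) = exec-clear out σ in σ′ , ex , at , λ r _ r≢out → fr r r≢out

correct-S : ∀ {x} → Correct S (x ∷ []) (suc x)
correct-S (a ∷ []) out k σ a<k a≢out out<k hold =
  let (σ′ , ex , at , fr) = computes-copy a out k σ (a<k zero) out<k (a≢out zero)
  in update increment out σ′ , exec-seq ex (exec-inc out σ′)
      , trans (update-at increment out σ′) (cong suc (trans at (hold zero)))
   , λ r r<k r≢out → trans (update-other increment out σ′ r r≢out) (fr r r<k r≢out)

correct-P : ∀ {n} (i : Fin n) (xs : Vec ℕ n) → Correct (P i) xs (lookup xs i)
correct-P i xs args out k σ below a≢out out<k hold =
  let (σ′ , ex , at , fr) = computes-copy (lookup args i) out k σ (below i) out<k (a≢out i) in σ′ , ex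
          , trans at (hold i) , fr

correct-Comp : ∀ {m n} {f : PR m} {gs : Vec (PR n) m} {xs ys z} → CorrectAll gs xs ys → Correct f ys z →
    Correct (Comp f gs) xs z
correct-Comp {m} all single args out k σ below a≢out out<k hold =
  let (σ₁ , ex₁ , ys , fr₁) = all args k σ below hold
      (σ₂ , ex₂ , z , fr₂) =
          single (temps k m) (m + k) (suc (m + k)) σ₁ (λ i → ≤-trans (proj₂ (temps-bounds k m i)) (n≤1+n _))
        (λ i → <⇒≢ (proj₂ (temps-bounds k m i))) ≤-refl ys
      (σ₃ , ex₃ , at , fr₃) =
          computes-copy (m + k) out (suc (m + k)) σ₂ ≤-refl (s≤s (≤-trans (<⇒≤ out<k) (m≤n+m k m)))
          (≢-sym (<⇒≢ (≤-trans out<k (m≤n+m k m))))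
  in σ₃ , exec-seq ex₁ (exec-seq ex₂ ex₃) , trans at z ,
     λ r r<k r≢out → trans (fr₃ r (s≤s (≤-trans (<⇒≤ r<k) (m≤n+m k m))) r≢out)
       (trans (fr₂ r (s≤s (≤-trans (<⇒≤ r<k) (m≤n+m k m))) (<⇒≢ (≤-trans r<k (m≤n+m k m)))) (fr₁ r r<k))

correctAll-[] : ∀ {n} {xs : Vec ℕ n} → CorrectAll [] xs []
correctAll-[] args k σ _ _ = let (σ′ , ex , _ , fr) = exec-clear k σ in σ′ , ex , (λ ()) , λ r r<k → fr r (<⇒≢ r<k)

correctAll-∷ : ∀ {m n} {g : PR n} {gs : Vec (PR n) m} {xs y ys} → Correct g xs y → CorrectAll gs xs ys →
    CorrectAll (g ∷ gs) xs (y ∷ ys)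
correctAll-∷ {m} {xs = xs} {y} {ys} single all args k σ below hold =
  let (σ₁ , ex₁ , y≡ , fr₁) = single args k (suc k) σ (λ i → m≤n⇒m≤1+n (below i)) (λ i → <⇒≢ (below i)) ≤-refl hold
      (σ₂ , ex₂ , ys≡ , fr₂) =
          all args (suc k) σ₁ (λ i → m≤n⇒m≤1+n (below i))
          (λ i → trans (fr₁ _ (m≤n⇒m≤1+n (below i)) (<⇒≢ (below i))) (hold i))
  in σ₂ , exec-seq ex₁ ex₂ , (λ { zero → trans (fr₂ k ≤-refl) y≡ ; (suc i) → ys≡ i }) ,
     λ r r<k → trans (fr₂ r (m≤n⇒m≤1+n r<k)) (fr₁ r (m≤n⇒m≤1+n r<k) (<⇒≢ r<k))

module _ {n : ℕ} (f : PR n) (g : PR (suc (suc n))) (xs : Vec ℕ n) where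

  -- Unrolls a derivation for `Rec` into correctness statements for its rounds, which separates the
  -- analysis of the loop from the induction on evaluations.
  data Trace : ℕ → ℕ → Set where
    base : ∀ {v} → Correct f xs v → Trace 0 v
    round : ∀ {i r v} → Trace i r → Correct g (i ∷ r ∷ xs) v → Trace (suc i) v

  module _ (args : Vec ℕ n) (k : ℕ) (below : Below args k) where

    private
      body : Cmd
      body = dec (2 + k) ⨾ comp g (k ∷ 1 + k ∷ args) (3 + k) (4 + k) ⨾ copy-reg (3 + k) (1 + k) (4 + k) ⨾ inc k

      k<k+ : ∀ j {r} → r < k → r < j + k
      k<k+ j r<k = ≤-trans r<k (m≤n+m k j)

      k≢k+ : ∀ j → k ≢ suc j + k
      k≢k+ j = <⇒≢ (s≤s (m≤n+m k j))

    record Loop (i r c : ℕ) (σ : Store) : Set where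
      field
        counter : σ k ≡ i
        value   : σ (1 + k) ≡ r
        left    : σ (2 + k) ≡ c
        inputs  : Holding σ args xs
    open Loop

    loop-body : ∀ {i r v c σ} → Correct g (i ∷ r ∷ xs) v → Loop i r (suc c) σ →
                Σ Store λ σ′ → Exec body σ σ′ × Loop (suc i) v c σ′ × Frame σ σ′ k
    loop-body {i} {r} {v} {c} {σ} good I =
      let σ₁ = update decrement (2 + k) σ
          keeps₁ : ∀ x → x ≢ 2 + k → σ₁ x ≡ σ x
          keeps₁ = update-other decrement (2 + k) σ
          (σ₂ , ex₂ , v₂ , fr₂) = good (k ∷ 1 + k ∷ args) (3 + k) (4 + k) σ₁
            (λ { zero → s≤s (m≤n+m k 3) ; (suc zero) → s≤s (s≤s (m≤n+m k 2)) ; (suc (suc i)) → k<k+ 4 (below i) })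
            (λ { zero → k≢k+ 2 ; (suc zero) → <⇒≢ (s≤s (s≤s (m≤n+m k 1))) ; (suc (suc i)) → <⇒≢ (k<k+ 3 (below i)) })
            ≤-refl
            (λ { zero → trans (keeps₁ k (k≢k+ 1)) (counter I) ; (suc zero) →
                trans (keeps₁ (1 + k) (<⇒≢ ≤-refl)) (value I)
               ; (suc (suc i)) → trans (keeps₁ _ (<⇒≢ (k<k+ 2 (below i)))) (inputs I i) })
          (σ₃ , ex₃ , v₃ , fr₃) =
              computes-copy (3 + k) (1 + k) (4 + k) σ₂ ≤-refl (s≤s (s≤s (m≤n+m k 2)))
              (≢-sym (<⇒≢ (s≤s (s≤s (m≤n+m k 1)))))
          σ₄ = update increment k σ₃
          keeps₄ : ∀ x → x ≢ k → σ₄ x ≡ σ₃ x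
          keeps₄ = update-other increment k σ₃
          frame : Frame σ σ₄ k
          frame = λ r r<k → trans (keeps₄ r (<⇒≢ r<k)) (trans (fr₃ r (k<k+ 4 r<k) (<⇒≢ (k<k+ 1 r<k)))
                   (trans (fr₂ r (k<k+ 4 r<k) (<⇒≢ (k<k+ 3 r<k))) (keeps₁ r (<⇒≢ (k<k+ 2 r<k)))))
      in σ₄ , exec-seq (exec-dec (2 + k) σ) (exec-seq ex₂ (exec-seq ex₃ (exec-inc k σ₃))) , record
         { counter = trans (update-at increment k σ₃) (cong suc (trans (fr₃ k (s≤s (m≤n+m k 3)) (k≢k+ 0))
                       (trans (fr₂ k (s≤s (m≤n+m k 3)) (k≢k+ 2)) (trans (keeps₁ k (k≢k+ 1)) (counter I)))))
         ; value   = trans (keeps₄ (1 + k) (≢-sym (k≢k+ 0))) (trans v₃ v₂)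
         ; left    = trans (keeps₄ (2 + k) (≢-sym (k≢k+ 1)))
             (trans (fr₃ (2 + k) (s≤s (s≤s (s≤s (m≤n+m k 1)))) (≢-sym (<⇒≢ ≤-refl)))
                       (trans (fr₂ (2 + k) (s≤s (s≤s (s≤s (m≤n+m k 1)))) (<⇒≢ ≤-refl))
                           (trans (update-at decrement (2 + k) σ) (cong pred (left I)))))
         ; inputs  = λ i → trans (frame _ (below i)) (inputs I i) }
       , frame

    -- The loop counts upwards while the evaluation recurses downwards, so the first i rounds are peeled off with c
    -- rounds left to go.
    rounds : ∀ {i v} → Trace i v → ∀ c a σ → a < k → σ a ≡ i + c → Holding σ args xs →
             Σ Store λ σ′ → (∀ {σ″} → Exec (loop (2 + k) body) σ′ σ″ →
                 Exec ((comp f args (1 + k) (4 + k) ⨾ clear k ⨾ copy-reg a (2 + k) (4 + k)) ⨾ loop (2 + k) body) σ σ″)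
             × Loop i v c σ′ × Frame σ σ′ k
    rounds (base good) c a σ a<k a≡ hold =
      let (σ₁ , ex₁ , v₁ , fr₁) =
              good args (1 + k) (4 + k) σ (λ i → k<k+ 4 (below i)) (λ i → <⇒≢ (k<k+ 1 (below i)))
              (s≤s (s≤s (m≤n+m k 2))) hold
          (σ₂ , ex₂ , zero₂ , fr₂) = exec-clear k σ₁
          (σ₃ , ex₃ , a₃ , fr₃) =
              computes-copy a (2 + k) (4 + k) σ₂ (k<k+ 4 a<k) (s≤s (s≤s (s≤s (m≤n+m k 1)))) (<⇒≢ (k<k+ 2 a<k))
          frame : Frame σ σ₃ k
          frame = λ r r<k → trans (fr₃ r (k<k+ 4 r<k) (<⇒≢ (k<k+ 2 r<k)))
              (trans (fr₂ r (<⇒≢ r<k)) (fr₁ r (k<k+ 4 r<k) (<⇒≢ (k<k+ 1 r<k))))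
      in σ₃ , exec-seq (exec-seq ex₁ (exec-seq ex₂ ex₃)) , record
         { counter = trans (fr₃ k (s≤s (m≤n+m k 3)) (k≢k+ 1)) zero₂
         ; value   = trans (fr₃ (1 + k) (s≤s (s≤s (m≤n+m k 2))) (<⇒≢ ≤-refl))
             (trans (fr₂ (1 + k) (≢-sym (k≢k+ 0))) v₁)
         ; left    = trans a₃ (trans (fr₂ a (<⇒≢ a<k)) (trans (fr₁ a (k<k+ 4 a<k) (<⇒≢ (k<k+ 1 a<k))) a≡))
         ; inputs  = λ i → trans (frame _ (below i)) (hold i) }
       , frame
    rounds (round {i} tr good) c a σ a<k a≡ hold =
      let (σ₁ , ex₁ , I₁ , fr₁) = rounds tr (suc c) a σ a<k (trans a≡ (sym (+-suc i c))) hold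
          (σ₂ , ex₂ , I₂ , fr₂) = loop-body good I₁
      in σ₂ , (λ ex → ex₁ (exec-loop-body (left I₁) ex₂ ex)) , I₂ , λ r r<k → trans (fr₂ r r<k) (fr₁ r r<k)

  correct-Rec : ∀ {i v} → Trace i v → Correct (Rec f g) (i ∷ xs) v
  correct-Rec {i} tr (a ∷ args) out k σ below a≢out out<k hold =
    let (σ₁ , ex₁ , I , fr₁) =
            rounds args k (λ i → below (suc i)) tr 0 a σ (below zero) (trans (hold zero) (sym (+-identityʳ i)))
            (λ i → hold (suc i))
        (σ₂ , ex₂ , v₂ , fr₂) =
            computes-copy (1 + k) out (4 + k) σ₁ (s≤s (s≤s (m≤n+m k 2))) (≤-trans out<k (m≤n+m k 4))
            (≢-sym (<⇒≢ (≤-trans out<k (n≤1+n k))))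
    in σ₂ , exec-seq (ex₁ (exec-loop-exit (Loop.left I))) ex₂ , trans v₂ (Loop.value I)
     , λ r r<k r≢out → trans (fr₂ r (≤-trans r<k (m≤n+m k 4)) r≢out) (fr₁ r r<k)

module _ {n : ℕ} (f : PR (suc n)) (xs : Vec ℕ n) (m : ℕ) (zero-at : Correct f (m ∷ xs) 0)
  (positive : ∀ j → j < m → Σ ℕ λ v → Correct f (j ∷ xs) (suc v)) where

  -- The index is the distance from the candidate to the minimum `m`, on which the search loop is
  -- analysed by induction.
  Sign : ℕ → ℕ → Set
  Sign zero    w = w ≡ 0
  Sign (suc d) w = ∃ λ w′ → w ≡ suc w′

  value-at : ∀ d i → i + d ≡ m → ∃ λ w → Correct f (i ∷ xs) w × Sign d w
  value-at zero    i eq = 0 , subst (λ i → Correct f (i ∷ xs) 0) (trans (sym eq) (+-identityʳ i)) zero-at , refl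
  value-at (suc d) i eq = let (v , good) = positive i (subst (i <_) eq (≤-trans (s≤s (m≤m+n i d)) (≤-reflexive (sym (+-suc i d)))))
    in suc v , good , v , refl

  module _ (args : Vec ℕ n) (k : ℕ) (below : Below args k) where

    evaluate : ∀ {i w σ} → Correct f (i ∷ xs) w → σ k ≡ i → Holding σ args xs →
               Σ Store λ σ′ → Exec (comp f (k ∷ args) (1 + k) (2 + k)) σ σ′ × σ′ (1 + k) ≡ w
                   × (∀ r → r < suc k → σ′ r ≡ σ r)
    evaluate {σ = σ} good i≡ hold =
      let (σ′ , ex , w , fr) = good (k ∷ args) (1 + k) (2 + k) σ
            (λ { zero → s≤s (n≤1+n k) ; (suc i) → ≤-trans (below i) (m≤n+m k 2) })
            (λ { zero → <⇒≢ ≤-refl ; (suc i) → <⇒≢ (≤-trans (below i) (n≤1+n k)) }) ≤-refl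
            (λ { zero → i≡ ; (suc i) → hold i })
      in σ′ , ex , w , λ r r<k → fr r (≤-trans r<k (n≤1+n _)) (<⇒≢ r<k)

    minimize : ∀ d i → i + d ≡ m → ∀ {w σ} → Sign d w → σ (1 + k) ≡ w → σ k ≡ i → Holding σ args xs →
               Σ Store λ σ′ → Exec (loop (1 + k) (inc k ⨾ comp f (k ∷ args) (1 + k) (2 + k))) σ σ′ × σ′ k ≡ m
                   × Frame σ σ′ k
    minimize zero    i eq {σ = σ} refl w≡ i≡ hold =
        σ , exec-loop-exit w≡ , trans i≡ (trans (sym (+-identityʳ i)) eq) , λ _ _ → refl
    minimize (suc d) i eq {σ = σ} (w′ , refl) w≡ i≡ hold =
      let σ₁ = update increment k σ
          keeps : Frame σ σ₁ k
          keeps = λ r r<k → update-other increment k σ r (<⇒≢ r<k)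
          (w , good , sign) = value-at d (suc i) (trans (sym (+-suc i d)) eq)
          i₁ = trans (update-at increment k σ) (cong suc i≡)
          hold₁ = λ j → trans (keeps _ (below j)) (hold j)
          (σ₂ , ex₂ , w₂ , fr₂) = evaluate good i₁ hold₁
          (σ₃ , ex₃ , m₃ , fr₃) = minimize d (suc i) (trans (sym (+-suc i d)) eq) sign w₂ (trans (fr₂ k ≤-refl) i₁)
                                    (λ j → trans (fr₂ _ (m≤n⇒m≤1+n (below j))) (hold₁ j))
      in σ₃ , exec-loop-body w≡ (exec-seq (exec-inc k σ) ex₂) ex₃ , m₃ , λ r r<k →
          trans (fr₃ r r<k) (trans (fr₂ r (m≤n⇒m≤1+n r<k)) (keeps r r<k))

  correct-Mu : Correct (Mu f) xs m
  correct-Mu args out k σ below a≢out out<k hold =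
    let (σ₁ , ex₁ , zero₁ , fr₁) = exec-clear k σ
        hold₁ = λ i → trans (fr₁ _ (<⇒≢ (below i))) (hold i)
        (w , good , sign) = value-at m 0 refl
        (σ₂ , ex₂ , w₂ , fr₂) = evaluate args k below good zero₁ hold₁
        (σ₃ , ex₃ , m₃ , fr₃) =
            minimize args k below m 0 refl sign w₂ (trans (fr₂ k ≤-refl) zero₁)
            (λ i → trans (fr₂ _ (m≤n⇒m≤1+n (below i))) (hold₁ i))
        (σ₄ , ex₄ , v₄ , fr₄) =
            computes-copy k out (2 + k) σ₃ (s≤s (n≤1+n k)) (≤-trans out<k (m≤n+m k 2)) (≢-sym (<⇒≢ out<k))
    in σ₄ , exec-seq ex₁ (exec-seq ex₂ (exec-seq ex₃ ex₄)) , trans v₄ m₃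
     , λ r r<k r≢out → trans (fr₄ r (≤-trans r<k (m≤n+m k 2)) r≢out)
         (trans (fr₃ r r<k) (trans (fr₂ r (m≤n⇒m≤1+n r<k)) (fr₁ r (<⇒≢ r<k))))

correct    : ∀ {n} {f : PR n} {xs v} → Eval f xs v → Correct f xs v
correctAll : ∀ {m n} {gs : Vec (PR n) m} {xs ys} → EvalAll gs xs ys → CorrectAll gs xs ys
trace      : ∀ {n} {f : PR n} {g xs i v} → Eval (Rec f g) (i ∷ xs) v → Trace f g xs i v

correct (evZ {xs = xs}) = correct-Z {xs = xs}
correct evS           = correct-S
correct (evP {i = i} {xs}) = correct-P i xs
correct (evComp {f = f} {gs} {xs} {ys} all single) =
    correct-Comp {f = f} {gs} {xs} {ys} (correctAll all) (correct single)
correct (evRec0 {f = f} {g} {xs} e)   = correct-Rec f g xs (base (correct e))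
correct (evRecS {f = f} {g} {xs} e e′) = correct-Rec f g xs (round (trace e) (correct e′))
correct (evMu {f = f} {xs} {m} e lower) =
    correct-Mu f xs m (correct e) λ j lt → proj₁ (lower j lt) , correct (proj₂ (lower j lt))

correctAll ([] {xs = xs}) = correctAll-[] {xs = xs}
correctAll (_∷_ {g = g} {gs} {xs} {ys = ys} e es) =
    correctAll-∷ {g = g} {gs} {xs} {ys = ys} (correct e) (correctAll es)

trace (evRec0 e)    = base (correct e)
trace (evRecS e e′) = round (trace e) (correct e′)

-- Turns the value zero into halting and every other value into divergence, because register 1 then
-- grows without end.
program : PR 1 → Cmd
program d = comp d (0 ∷ []) 1 2 ⨾ loop 1 (inc 1)

module _ (c : Cmd) (n : ℕ) where
  open Machine (machine c) hiding (State)

  ReachesIn : ℕ → Maybe (Pos c) → Store → Set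
  ReachesIn t o σ = proj₁ (run n t) ≡ o × proj₂ (run n t) ≗ σ

  run-step : ∀ t {p σ o σ′} → ReachesIn t (just p) σ → nextOf c p (0 <ᵇ σ (regOf c p)) ≡ o →
             σ′ ≗ update (actOf c p) (regOf c p) σ → ReachesIn (suc t) o σ′
  run-step t {p} {σ} {o} {σ′} (at , same) eq u with run n t
  run-step t {p} {σ} {o} {σ′} (refl , same) eq u | _ , ρ =
    trans (cong (λ v → nextOf c p (0 <ᵇ v)) (same (regOf c p))) eq ,
    λ x → trans (cong (apply (if x ≡ᵇ regOf c p then actOf c p else keep)) (same x)) (sym (u x))

  run-steps : ∀ t {p σ o σ′} → ReachesIn t (just p) σ → Steps c p σ o σ′ → ∃ λ t′ → ReachesIn t′ o σ′
  run-steps t h (one eq u)    = suc t , run-step t h eq u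
  run-steps t h (more eq u s) = run-steps (suc t) (run-step t h eq u) s

  final-stays : ∀ t s → proj₁ (run n t) ≡ nothing → proj₁ (run n (s + t)) ≡ nothing
  final-stays t zero    eq = eq
  final-stays t (suc s) eq with run n (s + t) | final-stays t s eq
  ... | .nothing , _ | refl = refl

module _ (d : PR 1) (n v : ℕ) (eval : Eval d (n ∷ []) v) where

  private
    c : Cmd
    c = program d

  open Machine (machine c) hiding (State)

  computed : Computes (comp d (0 ∷ []) 1 2) 1 2 v (initial n)
  computed = correct eval (0 ∷ []) 1 2 (initial n) (λ { zero → s≤s z≤n }) (λ { zero () }) ≤-refl (λ { zero → refl })

  result : Store
  result = proj₁ computed

  at-loop : ∃ λ t → ReachesIn c n t (just (inj₂ nothing)) result
  at-loop = run-steps c n 0 (refl , λ _ → refl)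
    (steps-lift (comp d (0 ∷ []) 1 2) c (toLeft (loop 1 (inc 1))) inj₁ (λ _ → refl) (λ _ _ → refl) (λ _ → refl)
        (λ _ → refl) (proj₁ (proj₂ computed)))

  halts : v ≡ 0 → ∃ λ t → proj₁ (run n t) ≡ nothing
  halts v≡0 =
    let (t , reach) = at-loop
        (t′ , (eq , _)) =
            run-steps c n t reach (steps-lift (loop 1 (inc 1)) c (toRight (comp d (0 ∷ []) 1 2) {loop 1 (inc 1)}) inj₂
            (λ _ → refl) (λ _ _ → refl) (λ _ → refl) (λ _ → refl)
          (exec-loop-exit {1} {inc 1} (trans (proj₁ (proj₂ (proj₂ computed))) v≡0)))
    in t′ , eq

  -- The invariant of the endless loop at its two control points, the test and the increment.
  Looping : ℕ → Set
  Looping t = (∃ λ σ → ReachesIn c n t (just (inj₂ nothing)) σ × ∃ λ w → σ 1 ≡ suc w)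
            ⊎ (∃ λ σ → ReachesIn c n t (just (inj₂ (just tt))) σ × ∃ λ w → σ 1 ≡ suc w)

  looping-step : ∀ t → Looping t → Looping (suc t)
  looping-step t (inj₁ (σ , reach , w , eq)) = inj₂ (update keep 1 σ
    , run-step c n t reach (cong (λ v → nextOf c (inj₂ nothing) (0 <ᵇ v)) eq) (λ _ → refl) , w , eq)
  looping-step t (inj₂ (σ , reach , w , eq)) = inj₁ (update increment 1 σ
    , run-step c n t reach refl (λ _ → refl) , suc w , cong suc eq)

  -- A run that has halted at step `t` is still halted at step `t + t₀`, where the invariant places
  -- it inside the loop.
  never-halts : v ≡ 1 → ∀ t → proj₁ (run n t) ≢ nothing
  never-halts v≡1 t stop with at-loop
  ... | t₀ , reach =
      not-final {t + t₀} (loops t) (subst (λ s → proj₁ (run n s) ≡ nothing) (+-comm t₀ t) (final-stays c n t t₀ stop))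
    where
    loops : ∀ s → Looping (s + t₀)
    loops zero    = inj₁ (result , reach , 0 , trans (proj₁ (proj₂ (proj₂ computed))) v≡1)
    loops (suc s) = looping-step (s + t₀) (loops s)
    not-final : ∀ {s} → Looping s → proj₁ (run n s) ≢ nothing
    not-final (inj₁ (_ , (at , _) , _)) stop with trans (sym at) stop
    ... | ()
    not-final (inj₂ (_ , (at , _) , _)) stop with trans (sym at) stop
    ... | ()

-- Computability of the code of the input graph

Computable : ∀ {n} → (Vec ℕ n → ℕ) → Set
Computable {n} F = Σ (PR n) λ t → ∀ xs → Eval t xs (F xs)

record ComputableB {n} (F : Vec ℕ n → Bool) : Set where
  constructor boolean
  field
    numeric : Computable (bit ∘ F)
open ComputableB

c-resp : ∀ {n} {F G : Vec ℕ n → ℕ} → F ≗ G → Computable F → Computable G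
c-resp eq (t , ev) = t , λ xs → subst (Eval t xs) (eq xs) (ev xs)

data Arguments (n : ℕ) : (m : ℕ) → (Vec ℕ n → Vec ℕ m) → Set where
  []  : Arguments n 0 (λ _ → [])
  _∷_ : ∀ {m F Fs} → Computable F → Arguments n m Fs → Arguments n (suc m) (λ xs → F xs ∷ Fs xs)

arguments : ∀ {n m Fs} → Arguments n m Fs → Σ (Vec (PR n) m) λ ts → ∀ xs → EvalAll ts xs (Fs xs)
arguments []               = [] , λ _ → []
arguments ((t , ev) ∷ cs) = let (ts , evs) = arguments cs in t ∷ ts , λ xs → ev xs ∷ evs xs

c-apply : ∀ {n m G Fs} → Computable {m} G → Arguments n m Fs → Computable (λ xs → G (Fs xs))
c-apply (t , ev) cs = let (ts , evs) = arguments cs in Comp t ts , λ xs → evComp (evs xs) (ev _)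

c-var : ∀ {n} (i : Fin n) → Computable (λ xs → lookup xs i)
c-var i = P i , λ xs → evP

c-suc : ∀ {n} {F : Vec ℕ n → ℕ} → Computable F → Computable (suc ∘ F)
c-suc (t , ev) = Comp S (t ∷ []) , λ xs → evComp (ev xs ∷ []) evS

c-const : ∀ {n} k → Computable {n} (λ _ → k)
c-const zero    = Z , λ _ → evZ
c-const (suc k) = c-suc (c-const k)

-- In the argument of the step function entry 0 is the counter, entry 1 the previous value, and the
-- parameters begin at entry 2, as in `Rec`.
primrec : ∀ {n} → (Vec ℕ n → ℕ) → (Vec ℕ (suc (suc n)) → ℕ) → ℕ → Vec ℕ n → ℕ
primrec b s zero    xs = b xs
primrec b s (suc k) xs = s (k ∷ primrec b s k xs ∷ xs)

c-primrec : ∀ {n} {b : Vec ℕ n → ℕ} {s} → Computable b → Computable s →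
    Computable {suc n} (λ { (k ∷ xs) → primrec b s k xs })
c-primrec {b = b} {s} (tb , eb) (ts , es) = Rec tb ts , λ { (k ∷ xs) → go k xs }
  where
  go : ∀ k xs → Eval (Rec tb ts) (k ∷ xs) (primrec b s k xs)
  go zero    xs = evRec0 (eb xs)
  go (suc k) xs = evRecS (go k xs) (es _)

c-rec : ∀ {n m} {b : Vec ℕ m → ℕ} {s} {K : Vec ℕ n → ℕ} {Fs} → Computable b → Computable s → Computable K →
    Arguments n m Fs →
        Computable (λ xs → primrec b s (K xs) (Fs xs))
c-rec cb cs cK cFs = c-apply (c-primrec cb cs) (cK ∷ cFs)

module _ {n : ℕ} where

  c-+ : {F G : Vec ℕ n → ℕ} → Computable F → Computable G → Computable (λ xs → F xs + G xs)
  c-+ {F} {G} cF cG = c-resp (λ xs → eq (F xs) (G xs)) (c-rec (c-var (# 0)) (c-suc (c-var (# 1))) cF (cG ∷ []))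
    where
    eq : ∀ k m → primrec (λ xs → lookup xs (# 0)) (λ xs → suc (lookup xs (# 1))) k (m ∷ []) ≡ k + m
    eq zero    m = refl
    eq (suc k) m = cong suc (eq k m)

  c-pred : {F : Vec ℕ n → ℕ} → Computable F → Computable (λ xs → pred (F xs))
  c-pred {F} cF = c-resp (λ xs → eq (F xs)) (c-rec {m = 0} (c-const 0) (c-var (# 0)) cF [])
    where
    eq : ∀ k → primrec {0} (λ _ → 0) (λ xs → lookup xs (# 0)) k [] ≡ pred k
    eq zero    = refl
    eq (suc k) = refl

module _ {n : ℕ} where

  c-∸ : {F G : Vec ℕ n → ℕ} → Computable F → Computable G → Computable (λ xs → F xs ∸ G xs)
  c-∸ {F} {G} cF cG = c-resp (λ xs → eq (G xs) (F xs)) (c-rec (c-var (# 0)) (c-pred (c-var (# 1))) cG (cF ∷ []))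
    where
    eq : ∀ k m → primrec (λ xs → lookup xs (# 0)) (λ xs → pred (lookup xs (# 1))) k (m ∷ []) ≡ m ∸ k
    eq zero    m = refl
    eq (suc k) m = trans (cong pred (eq k m)) (pred-∸ m k)
      where
      pred-∸ : ∀ m k → pred (m ∸ k) ≡ m ∸ suc k
      pred-∸ zero    zero    = refl
      pred-∸ zero    (suc k) = refl
      pred-∸ (suc m) zero    = refl
      pred-∸ (suc m) (suc k) = pred-∸ m k

  c-if0 : {F G H : Vec ℕ n → ℕ} → Computable F → Computable G → Computable H →
      Computable (λ xs → if F xs ≡ᵇ 0 then G xs else H xs)
  c-if0 {F} {G} {H} cF cG cH =
      c-resp (λ xs → eq (F xs) (G xs) (H xs)) (c-rec (c-var (# 0)) (c-var (# 3)) cF (cG ∷ cH ∷ []))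
    where
    eq : ∀ k g h → primrec (λ xs → lookup xs (# 0)) (λ xs → lookup xs (# 3)) k
        (g ∷ h ∷ []) ≡ (if k ≡ᵇ 0 then g else h)
    eq zero    g h = refl
    eq (suc k) g h = refl

  c-if : {B : Vec ℕ n → Bool} {G H : Vec ℕ n → ℕ} →
         ComputableB B → Computable G → Computable H → Computable (λ xs → if B xs then G xs else H xs)
  c-if {B} cB cG cH = c-resp (λ xs → eq (B xs)) (c-if0 (numeric cB) cH cG)
    where
    eq : ∀ b {g h : ℕ} → (if bit b ≡ᵇ 0 then h else g) ≡ (if b then g else h)
    eq true  = refl
    eq false = refl

  b-if : {B G H : Vec ℕ n → Bool} →
         ComputableB B → ComputableB G → ComputableB H → ComputableB (λ xs → if B xs then G xs else H xs)
  b-if {B} cB cG cH = boolean (c-resp (λ xs → eq (B xs)) (c-if cB (numeric cG) (numeric cH)))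
    where
    eq : ∀ b {g h : Bool} → (if b then bit g else bit h) ≡ bit (if b then g else h)
    eq true  = refl
    eq false = refl

  b-const : ∀ b → ComputableB {n} (λ _ → b)
  b-const b = boolean (c-const (bit b))

  b-∧ : {F G : Vec ℕ n → Bool} → ComputableB F → ComputableB G → ComputableB (λ xs → F xs ∧ G xs)
  b-∧ {F} cF cG = boolean (c-resp (λ xs → eq (F xs)) (numeric (b-if cF cG (b-const false))))
    where
    eq : ∀ f {g} → bit (if f then g else false) ≡ bit (f ∧ g)
    eq true  = refl
    eq false = refl

  b-∨ : {F G : Vec ℕ n → Bool} → ComputableB F → ComputableB G → ComputableB (λ xs → F xs ∨ G xs)
  b-∨ {F} cF cG = boolean (c-resp (λ xs → eq (F xs)) (numeric (b-if cF (b-const true) cG)))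
    where
    eq : ∀ f {g} → bit (if f then true else g) ≡ bit (f ∨ g)
    eq true  = refl
    eq false = refl

  -- Two numbers are equal exactly when both truncated differences vanish, that is, when their sum
  -- does.
  b-≡ : {F G : Vec ℕ n → ℕ} → Computable F → Computable G → ComputableB (λ xs → F xs ≡ᵇ G xs)
  b-≡ {F} {G} cF cG =
    boolean (c-resp (λ xs → eq (F xs) (G xs)) (c-if0 (c-+ (c-∸ cF cG) (c-∸ cG cF)) (c-const 1) (c-const 0)))
    where
    eq : ∀ f g → (if (f ∸ g) + (g ∸ f) ≡ᵇ 0 then 1 else 0) ≡ bit (f ≡ᵇ g)
    eq zero    zero    = refl
    eq zero    (suc g) = refl
    eq (suc f) zero    = refl
    eq (suc f) (suc g) = eq f g

  c-tri : {F : Vec ℕ n → ℕ} → Computable F → Computable (λ xs → tri (F xs))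
  c-tri {F} cF = c-resp (λ xs → eq (F xs)) (c-rec {m = 0} (c-const 0) (c-suc (c-+ (c-var (# 0)) (c-var (# 1)))) cF [])
    where
    eq : ∀ k → primrec {0} (λ _ → 0) (λ xs → suc (lookup xs (# 0) + lookup xs (# 1))) k [] ≡ tri k
    eq zero    = refl
    eq (suc k) = cong (λ r → suc (k + r)) (eq k)

  c-pair : {F G : Vec ℕ n → ℕ} → Computable F → Computable G → Computable (λ xs → pair (F xs) (G xs))
  c-pair cF cG = c-+ (c-tri (c-+ cF cG)) cG

-- These undo `combine`, which numbers role `i` of copy `x` by `10 * x + i`; counting upwards keeps
-- both primitive recursive.
mod10 div10 : ℕ → ℕ
mod10 zero    = 0
mod10 (suc k) = if mod10 k ≡ᵇ 9 then 0 else suc (mod10 k)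
div10 zero    = 0
div10 (suc k) = if mod10 k ≡ᵇ 9 then suc (div10 k) else div10 k

≢9 : ∀ r → suc r < 10 → (r ≡ᵇ 9) ≡ false
≢9 r lt = ≢true⇒false λ eq → <-irrefl (cong suc (≡ᵇ-sound r 9 eq)) lt

9<10 : 9 < 10
9<10 = ≤-refl

mod10-+ : ∀ q r → r < 10 → mod10 (r + q * 10) ≡ r
mod10-+ zero    zero    _  = refl
-- A positive multiple of ten is the successor of a number ending in nine.
mod10-+ (suc q) zero    _  = cong (λ m → if m ≡ᵇ 9 then 0 else suc m) (mod10-+ q 9 9<10)
mod10-+ q       (suc r) lt = trans (cong (λ m → if m ≡ᵇ 9 then 0 else suc m) (mod10-+ q r (≤-trans (n≤1+n _) lt)))
                                   (cong (λ b → if b then 0 else suc r) (≢9 r lt))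

div10-+ : ∀ q r → r < 10 → div10 (r + q * 10) ≡ q
div10-+ zero    zero    _  = refl
div10-+ (suc q) zero    _  = cong₂ (λ m d → if m ≡ᵇ 9 then suc d else d) (mod10-+ q 9 9<10) (div10-+ q 9 9<10)
div10-+ q       (suc r) lt =
    trans (cong₂ (λ m d → if m ≡ᵇ 9 then suc d else d) (mod10-+ q r (≤-trans (n≤1+n _) lt))
    (div10-+ q r (≤-trans (n≤1+n _) lt)))
                                   (cong (λ b → if b then suc q else q) (≢9 r lt))

c-mod10 : ∀ {n} {F : Vec ℕ n → ℕ} → Computable F → Computable (λ xs → mod10 (F xs))
c-mod10 {F = F} cF = c-resp (λ xs → eq (F xs)) (c-rec {m = 0} (c-const 0) step cF [])
  where
  next : Vec ℕ 2 → ℕ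
  next xs = if lookup xs (# 1) ≡ᵇ 9 then 0 else suc (lookup xs (# 1))
  step : Computable next
  step = c-if (b-≡ (c-var (# 1)) (c-const 9)) (c-const 0) (c-suc (c-var (# 1)))
  eq : ∀ k → primrec {0} (λ _ → 0) next k [] ≡ mod10 k
  eq zero    = refl
  eq (suc k) = cong (λ m → if m ≡ᵇ 9 then 0 else suc m) (eq k)

c-div10 : ∀ {n} {F : Vec ℕ n → ℕ} → Computable F → Computable (λ xs → div10 (F xs))
c-div10 {F = F} cF = c-resp (λ xs → eq (F xs)) (c-rec {m = 0} (c-const 0) step cF [])
  where
  next : Vec ℕ 2 → ℕ
  next xs = if mod10 (lookup xs (# 0)) ≡ᵇ 9 then suc (lookup xs (# 1)) else lookup xs (# 1)
  step : Computable next
  step = c-if (b-≡ (c-mod10 (c-var (# 0))) (c-const 9)) (c-suc (c-var (# 1))) (c-var (# 1))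
  eq : ∀ k → primrec {0} (λ _ → 0) next k [] ≡ div10 k
  eq zero    = refl
  eq (suc k) = cong (λ d → if mod10 k ≡ᵇ 9 then suc d else d) (eq k)

-- The literals repeat `chord` for the types given by `inputTy`: `τ₀` at vertex 0, `ι₀` at vertex 1,
-- `δ` at the last vertex and `ι₊` elsewhere.
chordCode : ℕ → ℕ → ℕ → ℕ → Bool
chordCode n x r s =
  if x ≡ᵇ 0 then joins 0 8 r s else if x ≡ᵇ 1 then joins 5 7 r s else if x ≡ᵇ suc
      (suc n) then joins 0 7 r s else joins 6 9 r s

arcCode : ℕ → ℕ → Bool
arcCode x y = (if x ≡ᵇ 0 then false else true) ∧ (suc x ≡ᵇ y)

arcEdgeCode : ℕ → ℕ → ℕ → ℕ → Bool
arcEdgeCode x y r s = arcCode x y ∧ ((r ≡ᵇ 0) ∧ (s ≡ᵇ 4))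

edgeCode : ℕ → ℕ → ℕ → ℕ → ℕ → Bool
edgeCode n x r y s =
    ((x ≡ᵇ y) ∧ (joinsAny coreEdges r s ∨ chordCode n x r s)) ∨ (arcEdgeCode x y r s ∨ arcEdgeCode y x s r)

adjCode : ℕ → ℕ → ℕ → Bool
adjCode n i j = edgeCode n (div10 i) (mod10 i) (div10 j) (mod10 j)

module _ {n : ℕ} where

  b-joins : ∀ p q {R σ : Vec ℕ n → ℕ} → Computable R → Computable σ → ComputableB (λ xs → joins p q (R xs) (σ xs))
  b-joins p q cR cσ =
    b-∨ (b-∧ (b-≡ cR (c-const p)) (b-≡ cσ (c-const q))) (b-∧ (b-≡ cR (c-const q)) (b-≡ cσ (c-const p)))

  b-joinsAny : ∀ es {R σ : Vec ℕ n → ℕ} → Computable R → Computable σ → ComputableB (λ xs → joinsAny es (R xs) (σ xs))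
  b-joinsAny []             cR cσ = b-const false
  b-joinsAny ((p , q) ∷ es) cR cσ = b-∨ (b-joins p q cR cσ) (b-joinsAny es cR cσ)

  b-chordCode : {N X R σ : Vec ℕ n → ℕ} → Computable N → Computable X → Computable R → Computable σ →
                ComputableB (λ xs → chordCode (N xs) (X xs) (R xs) (σ xs))
  b-chordCode cN cX cR cσ =
    b-if (b-≡ cX (c-const 0)) (b-joins 0 8 cR cσ)
    (b-if (b-≡ cX (c-const 1)) (b-joins 5 7 cR cσ)
    (b-if (b-≡ cX (c-suc (c-suc cN))) (b-joins 0 7 cR cσ) (b-joins 6 9 cR cσ)))

  b-arcEdgeCode : {X Y R σ : Vec ℕ n → ℕ} → Computable X → Computable Y → Computable R → Computable σ →
                  ComputableB (λ xs → arcEdgeCode (X xs) (Y xs) (R xs) (σ xs))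
  b-arcEdgeCode cX cY cR cσ =
    b-∧ (b-∧ (b-if (b-≡ cX (c-const 0)) (b-const false) (b-const true)) (b-≡ (c-suc cX) cY))
        (b-∧ (b-≡ cR (c-const 0)) (b-≡ cσ (c-const 4)))

  b-edgeCode : {N X R Y σ : Vec ℕ n → ℕ} → Computable N → Computable X → Computable R → Computable Y → Computable σ →
               ComputableB (λ xs → edgeCode (N xs) (X xs) (R xs) (Y xs) (σ xs))
  b-edgeCode cN cX cR cY cσ =
    b-∨ (b-∧ (b-≡ cX cY) (b-∨ (b-joinsAny coreEdges cR cσ) (b-chordCode cN cX cR cσ)))
        (b-∨ (b-arcEdgeCode cX cY cR cσ) (b-arcEdgeCode cY cX cσ cR))

  b-adjCode : {N I J : Vec ℕ n → ℕ} → Computable N → Computable I → Computable J →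
              ComputableB (λ xs → adjCode (N xs) (I xs) (J xs))
  b-adjCode cN cI cJ = b-edgeCode cN (c-div10 cI) (c-mod10 cI) (c-div10 cJ) (c-mod10 cJ)

does-≟ : ∀ {n} (x y : Fin n) → does (x ≟ y) ≡ (toℕ x ≡ᵇ toℕ y)
does-≟ zero    zero    = refl
does-≟ zero    (suc y) = refl
does-≟ (suc x) zero    = refl
does-≟ (suc x) (suc y) = does-≟ x y

inputArc-code : ∀ x y → inputArc x y ≡ arcCode x y
inputArc-code zero    y = refl
inputArc-code (suc x) y = refl

opaque
  unfolding gadget edge

  chord-code : ∀ n x r s → isChord (inputTy n x) r s ≡ chordCode n x (toℕ r) (toℕ s)
  chord-code n zero          r s = refl
  chord-code n (suc zero)    r s = refl
  chord-code n (suc (suc k)) r s with k ≡ᵇ n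
  ... | true  = refl
  ... | false = refl

  arcEdge-code : ∀ x y r s → arcEdge (inputArc x y) r s ≡ arcEdgeCode x y (toℕ r) (toℕ s)
  arcEdge-code x y r s = cong₂ _∧_ (inputArc-code x y) (cong₂ _∧_ (does-≟ r (# 0)) (does-≟ s (# 4)))

  edge-code : ∀ n x r y s → edge (inputStructure n) (x , r) (y , s) ≡ edgeCode n (toℕ x) (toℕ r) (toℕ y) (toℕ s)
  edge-code n x r y s = cong₂ _∨_ (cong₂ _∧_ (does-≟ x y) (cong (core r s ∨_) (chord-code n (toℕ x) r s)))
    (cong₂ _∨_ (arcEdge-code (toℕ x) (toℕ y) r s) (arcEdge-code (toℕ y) (toℕ x) s r))

toℕ-remQuot : ∀ {m} (u : Fin (m * 10)) → toℕ u ≡ toℕ (proj₂ (remQuot {m} 10 u)) + toℕ (proj₁ (remQuot {m} 10 u)) * 10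
toℕ-remQuot {m} u =
    trans (cong toℕ (sym (combine-remQuot {m} 10 u)))
    (trans (toℕ-combine (proj₁ (remQuot {m} 10 u)) (proj₂ (remQuot {m} 10 u)))
  (trans (+-comm (10 * toℕ (proj₁ (remQuot {m} 10 u))) _)
      (cong (toℕ (proj₂ (remQuot {m} 10 u)) +_) (*-comm 10 (toℕ (proj₁ (remQuot {m} 10 u)))))))

div10-remQuot : ∀ {m} (u : Fin (m * 10)) → div10 (toℕ u) ≡ toℕ (proj₁ (remQuot {m} 10 u))
div10-remQuot {m} u =
    trans (cong div10 (toℕ-remQuot {m} u))
    (div10-+ (toℕ (proj₁ (remQuot {m} 10 u))) _ (toℕ<n (proj₂ (remQuot {m} 10 u))))

mod10-remQuot : ∀ {m} (u : Fin (m * 10)) → mod10 (toℕ u) ≡ toℕ (proj₂ (remQuot {m} 10 u))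
mod10-remQuot {m} u =
    trans (cong mod10 (toℕ-remQuot {m} u))
    (mod10-+ (toℕ (proj₁ (remQuot {m} 10 u))) _ (toℕ<n (proj₂ (remQuot {m} 10 u))))

edgeCode-cong : ∀ n {x x′ r r′ y y′ s s′} → x ≡ x′ → r ≡ r′ → y ≡ y′ → s ≡ s′ →
    edgeCode n x r y s ≡ edgeCode n x′ r′ y′ s′
edgeCode-cong n refl refl refl refl = refl

adj-code : ∀ n (u v : Fin (size (inputGraph n))) → adj (inputGraph n) u v ≡ adjCode n (toℕ u) (toℕ v)
adj-code n u v = trans (edge-code n (proj₁ (remQuot {3 + n} 10 u)) (proj₂ (remQuot {3 + n} 10 u))
    (proj₁ (remQuot {3 + n} 10 v)) (proj₂ (remQuot {3 + n} 10 v)))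
  (edgeCode-cong n (sym (div10-remQuot {3 + n} u)) (sym (mod10-remQuot {3 + n} u)) (sym (div10-remQuot {3 + n} v))
      (sym (mod10-remQuot {3 + n} v)))

-- Codes of lists and adjacency matrices

consCode : ℕ → ℕ → ℕ
consCode x c = suc (pair x c)

codeList-++ : ∀ xs ys → codeList (xs ++ ys) ≡ foldr consCode (codeList ys) xs
codeList-++ []       ys = refl
codeList-++ (x ∷ xs) ys = cong (consCode x) (codeList-++ xs ys)

-- Each row is coded on top of the code of the rows after it, so the concatenation becomes one
-- recursion nested in another.
codeList-concatMap : ∀ {A : Set} (f : A → List ℕ) xs →
    codeList (concatMap f xs) ≡ foldr (λ x c → foldr consCode c (f x)) 0 xs
codeList-concatMap f []       = refl
codeList-concatMap f (x ∷ xs) =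
    trans (codeList-++ (f x) (concatMap f xs)) (cong (λ c → foldr consCode c (f x)) (codeList-concatMap f xs))

-- The entries N − k, …, N − 1 of a list, folded by F.
foldLast : (ℕ → ℕ → ℕ) → ℕ → ℕ → ℕ → ℕ
foldLast F N zero    c = c
foldLast F N (suc k) c = F (N ∸ suc k) (foldLast F N k c)

-- The offset `s` keeps entry numbers absolute: passing to the tail raises `s` and lowers `m` by one
-- and leaves `s + m` unchanged.
foldr-tabulate : ∀ {A : Set} (K : A → ℕ → ℕ) (F : ℕ → ℕ → ℕ) m (f : Fin m → A) s c →
                 (∀ i d → K (f i) d ≡ F (s + toℕ i) d) → foldr K c (tabulateˡ f) ≡ foldLast F (s + m) m c
foldr-tabulate K F zero    f s c eq = refl
foldr-tabulate K F (suc m) f s c eq = trans (eq zero _)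
  (cong₂ F (trans (+-identityʳ s) (sym (m+n∸n≡m s (suc m))))
    (trans (foldr-tabulate K F m (f ∘ suc) (suc s) c λ i d →
        trans (eq (suc i) d) (cong (λ x → F x d) (+-suc s (toℕ i))))
           (cong (λ N → foldLast F N m c) (sym (+-suc s m)))))

foldr-map-tabulate : ∀ {A : Set} (h : A → ℕ) (F : ℕ → ℕ) m (f : Fin m → A) c → (∀ i → h (f i) ≡ F (toℕ i)) →
                     foldr consCode c (map h (tabulateˡ f)) ≡ foldLast (λ j d → consCode (F j) d) m m c
foldr-map-tabulate h F m f c eq =
    trans (fuse (tabulateˡ f)) (foldr-tabulate (λ x → consCode (h x)) (λ j → consCode (F j)) m f 0 c λ i d →
    cong (λ x → consCode x d) (eq i))
  where
  fuse : ∀ xs → foldr consCode c (map h xs) ≡ foldr (λ x → consCode (h x)) c xs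
  fuse []       = refl
  fuse (x ∷ xs) = cong (consCode (h x)) (fuse xs)

rowCode : ℕ → ℕ → ℕ → ℕ → ℕ
rowCode n N i c = foldLast (λ j d → consCode (bit (adjCode n i j)) d) N N c

matrixCode : ℕ → ℕ → ℕ
matrixCode n N = foldLast (λ i c → rowCode n N i c) N N 0

codeGraph-input : ∀ n N (G : Graph) → size G ≡ N → (∀ u v → adj G u v ≡ adjCode n (toℕ u) (toℕ v)) →
    codeGraph G ≡ pair N (matrixCode n N)
codeGraph-input n N G refl eq =
    cong (pair (size G))
    (trans (codeList-concatMap (λ i → map (λ j → bit (adj G i j)) (allFin (size G))) (allFin (size G)))
  (foldr-tabulate _ (λ i c → rowCode n (size G) i c) (size G) (λ i → i) 0 0 λ i d →
    foldr-map-tabulate (λ j → bit (adj G i j)) (λ j → bit (adjCode n (toℕ i) j)) (size G) (λ j → j) d λ j →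
        cong bit (eq i j)))

c-consCode : ∀ {n} {F G : Vec ℕ n → ℕ} → Computable F → Computable G → Computable (λ xs → consCode (F xs) (G xs))
c-consCode cF cG = c-suc (c-pair cF cG)

c-rowCode : ∀ {m} {n N I C : Vec ℕ m → ℕ} → Computable n → Computable N → Computable I → Computable C →
            Computable (λ xs → rowCode (n xs) (N xs) (I xs) (C xs))
c-rowCode {n = n} {N} {I} {C} cn cN cI cC = c-resp (λ xs → eq (n xs) (N xs) (I xs) (C xs) (N xs))
  (c-rec (c-var (# 3)) step cN (cn ∷ cN ∷ cI ∷ cC ∷ []))
  where
  next : Vec ℕ 6 → ℕ
  next xs = consCode (bit (adjCode (lookup xs (# 2)) (lookup xs (# 4)) (lookup xs (# 3) ∸ suc (lookup xs (# 0)))))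
      (lookup xs (# 1))
  step : Computable next
  step = c-consCode
      (ComputableB.numeric (b-adjCode (c-var (# 2)) (c-var (# 4)) (c-∸ (c-var (# 3)) (c-suc (c-var (# 0))))))
      (c-var (# 1))
  eq : ∀ n N i c k → primrec (λ xs → lookup xs (# 3)) next k (n ∷ N ∷ i ∷ c ∷ []) ≡ foldLast
      (λ j d → consCode (bit (adjCode n i j)) d) N k c
  eq n N i c zero    = refl
  eq n N i c (suc k) = cong (consCode (bit (adjCode n i (N ∸ suc k)))) (eq n N i c k)

c-matrixCode : ∀ {m} {n N : Vec ℕ m → ℕ} → Computable n → Computable N → Computable (λ xs → matrixCode (n xs) (N xs))
c-matrixCode {n = n} {N} cn cN = c-resp (λ xs → eq (n xs) (N xs) (N xs)) (c-rec (c-const 0) step cN (cn ∷ cN ∷ []))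
  where
  next : Vec ℕ 4 → ℕ
  next xs = rowCode (lookup xs (# 2)) (lookup xs (# 3)) (lookup xs (# 3) ∸ suc (lookup xs (# 0))) (lookup xs (# 1))
  step : Computable next
  step = c-rowCode (c-var (# 2)) (c-var (# 3)) (c-∸ (c-var (# 3)) (c-suc (c-var (# 0)))) (c-var (# 1))
  eq : ∀ n N k → primrec (λ _ → 0) next k (n ∷ N ∷ []) ≡ foldLast (λ i c → rowCode n N i c) N k 0
  eq n N zero    = refl
  eq n N (suc k) = cong (rowCode n N (N ∸ suc k)) (eq n N k)

c-*10 : ∀ {m} {F : Vec ℕ m → ℕ} → Computable F → Computable (λ xs → F xs * 10)
c-*10 {F = F} cF = c-resp (λ xs → eq (F xs)) (c-rec {m = 0} (c-const 0) (c-+ (c-const 10) (c-var (# 1))) cF [])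
  where
  eq : ∀ k → primrec {0} (λ _ → 0) (λ xs → 10 + lookup xs (# 1)) k [] ≡ k * 10
  eq zero    = refl
  eq (suc k) = cong (10 +_) (eq k)

c-codeInput : ∀ {m} {F : Vec ℕ m → ℕ} → Computable F → Computable (λ xs → codeGraph (inputGraph (F xs)))
c-codeInput {F = F} cF =
    c-resp (λ xs → sym (codeGraph-input (F xs) ((3 + F xs) * 10) (inputGraph (F xs)) refl (adj-code (F xs))))
  (c-pair size-c (c-matrixCode cF size-c))
  where
  size-c : Computable (λ xs → (3 + F xs) * 10)
  size-c = c-*10 (c-suc (c-suc (c-suc cF)))

-- The diagonal argument

jhp-resp : ∀ {C C′ : Graph → Set} → (∀ G → C G → C′ G) → (∀ G → C′ G → C G) → JHP C → JHP C′
jhp-resp to from joint A B cA cB = let (D , cD , homs) = joint A B (from A cA) (from B cB) in D , to D cD , homs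

module _ (e d : PR 1)
  (negates : ∀ F v → Eval e (codeGraphs (inputGraph (codeGraphs F) ∷ F) ∷ []) v →
      Eval d (codeGraphs F ∷ []) (if v ≡ᵇ 0 then 1 else 0))
  where
  open Rows (machine (program d))
  open Encoding (machine (program d))
  open Finite (suc width) W

  -- The list `F` depends on the machine, but the machine meets it only as an input, through the
  -- code `x`; this breaks the circle. The joint homomorphism property is first refuted, since the
  -- answer 1 would make the machine halt. The answer is then 0, the machine runs forever, and this
  -- proves the property after all.
  diagonal : ¬ Decides e (λ F → JHP (Forb F))
  diagonal decides = finite-basis contradiction
    where
    contradiction : ¬ (Σ (List Graph) λ F → ∀ G → (Forb F G → Class.Cond (suc width) W (adj G))
        × (Class.Cond (suc width) W (adj G) → Forb F G))
    contradiction (F , basis) =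
        not-joint (jhp-resp allowed⇒forb forb⇒allowed
        (running⇒jhp x (never-halts d x 1 (negates F 0 (proj₂ (decides F⁺) not-joint)) refl)))
      where
      x : ℕ
      x = codeGraphs F
      F⁺ : List Graph
      F⁺ = inputGraph x ∷ F
      open Reduction width W x using (Allowed)
      allowed⇒forb : ∀ H → Allowed H → Forb F⁺ H
      allowed⇒forb H (C , avoids) _ (here refl) = avoids
      allowed⇒forb H (C , avoids) K (there m)   = proj₂ (basis H) C K m
      forb⇒allowed : ∀ H → Forb F⁺ H → Allowed H
      forb⇒allowed H forb = proj₁ (basis H) (λ K m → forb K (there m)) , forb (inputGraph x) (here refl)
      not-joint : ¬ JHP (Forb F⁺)
      not-joint joint =
        let (t , stop) = halts d x 0 (negates F 1 (proj₁ (decides F⁺) joint)) refl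
        in jhp⇒running x (jhp-resp forb⇒allowed allowed⇒forb joint) t stop

opaque
  negate : Computable {1} (λ xs → if lookup xs (# 0) ≡ᵇ 0 then 1 else 0)
  negate = c-if0 (c-var (# 0)) (c-const 1) (c-const 0)

  -- Prepending a graph to a list acts on its code by a single `consCode`, so the given number is
  -- used as it stands, without decoding.
  extend : Computable {1} (λ xs → consCode (codeGraph (inputGraph (lookup xs (# 0)))) (lookup xs (# 0)))
  extend = c-consCode (c-codeInput (c-var (# 0))) (c-var (# 0))

theorem5p2 : ¬ (Σ (PR 1) λ e → Decides e (λ F → JHP (Forb F)))
theorem5p2 (e , decides) = diagonal e (Comp (proj₁ negate) (Comp e (proj₁ extend ∷ []) ∷ []))
  (λ F v ev → evComp (evComp (proj₂ extend (codeGraphs F ∷ []) ∷ []) ev ∷ []) (proj₂ negate (v ∷ []))) decides
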